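{- For every $\delta>0$ and every $n\in\mathbb{N}$ there exists $N\in\mathbb{N}$ such that every $N$-partitioned hypergraph $H$ with density at least $4/27+\delta$ has a $4n$-partitioned subhypergraph $H_0$ with index set $I=\{i_1,\ldots,i_{4n}\}$, $i_1<i_2<\cdots<i_{4n}$, such that (writing all triples below as edges of $H_0$) one of the following holds. (1) There exist vertices $\alpha_{ij},\beta_{ij},\gamma^0_{ij},\omega_{ij},\alpha^{\omega}_{ij},\gamma^{\omega}_{ij}\in V_{ij}$ for all $i<j$, $i,j\in I$, such that for all $i<j<k$, $i,j,k\in I$: $\{\alpha_{ij},\beta_{jk},\gamma^0_{ik}\}$, $\{\omega_{ij},\beta_{jk},\gamma^{\omega}_{ik}\}$ and $\{\alpha^{\omega}_{ij},\omega_{jk},\gamma^0_{ik}\}$ are edges. (2) There exist vertices $\alpha_{ij},\beta_{ij},\gamma^0_{ij},\omega_{ij},\beta^{\omega}_{ij},\gamma^{\omega}_{ij}\in V_{ij}$ for all $i<j$, $i,j\in I$, such that for all $i<j<k$, $i,j,k\in I$: $\{\alpha_{ij},\beta_{jk},\gamma^0_{ik}\}$, $\{\alpha_{ij},\omega_{jk},\gamma^{\omega}_{ik}\}$ and $\{\omega_{ij},\beta^{\omega}_{jk},\gamma^0_{ik}\}$ are edges. (3) There exist vertices $\alpha_{ij},\beta_{ij},\alpha'_{ij},\beta'_{ij},\gamma^0_{ij},\gamma^{\bullet}_{ij}\in V_{ij}$ for all $i<j$, $i,j\in I$, and vertices $\beta^{\bullet}_{ijkst}\in V_{jk}$ and $\alpha^{\bullet}_{ijkst}\in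 V_{ks}$ for all $i<j<k<s<t$, $i,j,k,s,t\in I$, such that for all $i<j<k<s<t$, $i,j,k,s,t\in I$: $\{\alpha_{ij},\beta_{jk},\gamma^0_{ik}\}$ and $\{\alpha'_{ij},\beta^{\bullet}_{ijkst},\gamma^0_{ik}\}$ are edges in the $(i,j,k)$-triad, $\{\beta^{\bullet}_{ijkst},\alpha^{\bullet}_{ijkst},\gamma^{\bullet}_{js}\}$ is an edge in the $(j,k,s)$-triad, and $\{\alpha^{\bullet}_{ijkst},\beta'_{st},\gamma^0_{kt}\}$ is an edge in the $(k,s,t)$-triad. (4) There exist vertices $\alpha^*_{ij},\beta^*_{ij},\gamma_{ij},\alpha^1_{ij},\beta^1_{ij},\gamma^1_{ij},\alpha^2_{ij},\beta^2_{ij},\gamma^2_{ij}\in V_{ij}$ for all $i<j$, $i,j\in I$, such that for all $i<j<k$, $i,j,k\in I$: $\{\gamma^1_{ij},\beta^*_{jk},\gamma_{ik}\}$, $\{\alpha^*_{ij},\gamma^2_{jk},\gamma_{ik}\}$, $\{\alpha^1_{ij},\beta^1_{jk},\gamma^1_{ik}\}$ and $\{\alpha^2_{ij},\beta^2_{jk},\gamma^2_{ik}\}$ are edges; and in addition there exist $\alpha\in V_{i_{2n}i_{2n+1}}$ and $\beta\in V_{i_{2n+1}i_{2n+2}}$ such that $\alpha$ is a left neighbor of $\gamma^2_{i_{2n}i_{3n+1}}$ in the $(i_{2n},i_{2n+1},i_{3n+1})$-triad, $\beta$ is a right neighbor of $\gamma^1_{i_ni_{2n+2}}$ in the $(i_n,i_{2n+1},i_{2n+2})$-triad,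 and the $(i_{2n},i_{2n+1},i_{2n+2})$-triad contains an edge containing both $\alpha$ and $\beta$.
   Context: An $n$-partitioned hypergraph $H$ is a $3$-uniform hypergraph whose vertex set is partitioned into nonempty finite sets $V_{ij}$, $1\le i<j\le n$, such that every edge has one vertex in each of $V_{ij},V_{ik},V_{jk}$ for some $1\le i<j<k\le n$. For $i<j<k$, the $(i,j,k)$-triad is the set of edges with one vertex in each of $V_{ij}$, $V_{ik}$, $V_{jk}$; vertices of $V_{ij}$, $V_{jk}$, $V_{ik}$ are its left, right and top vertices, respectively. The density of a triad is its number of edges divided by $|V_{ij}||V_{ik}||V_{jk}|$, and the density of $H$ is the minimum density of its triads. For $I\subseteq[n]$, the subhypergraph induced by $I$ is the $|I|$-partitioned hypergraph with parts $V_{ij}$, $i<j$, $i,j\in I$ (keeping the original indices) and all edges of $H$ contained in the union of these parts; $I$ is its index set. A subhypergraph of $H$ is obtained from an induced subhypergraph by deleting some edges. For a top vertex $v\in V_{ik}$ of the $(i,j,k)$-triad, a vertex $w\in V_{ij}$ is a left neighbor of $v$ (in that triad) if some edge of the triad contains both $v$ and $w$, and a vertex $w\in V_{jk}$ is a right neighbor of $v$ if some edge of the triad contains both. -}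

module Defs where

open import Data.Nat using (ℕ; zero; suc; _+_; _*_) renaming (_<_ to _<ℕ_; _≤_ to _≤ℕ_)
open import Data.Fin using (Fin; toℕ; _<_)
open import Data.Bool using (Bool; true; false; if_then_else_)
open import Data.Integer using (+_)
open import Data.Product using (Σ; _×_; _,_; ∃)
open import Data.Sum using (_⊎_)
open import Relation.Binary.PropositionalEquality using (_≡_)
open import Data.Fin.Properties using (<-trans)
import Data.Rational as Q

∑ : (m : ℕ) → (Fin m → ℕ) → ℕ
∑ zero f = 0
∑ (suc m) f = f Fin.zero + ∑ m (λ x → f (Fin.suc x))

ℕ→ℚ : ℕ → Q.ℚ
ℕ→ℚ c = (+ c) Q./ 1

-- An N-partitioned 3-uniform hypergraph.  Parts V_ij are indexed by pairs
-- (i , j) of Fin N; only pairs with i < j are meaningful (and those are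
-- required to be nonempty).  V_ij = Fin (size i j).
-- edge i j k l r t : for i<j<k, whether {l , r , t} is an edge of the
-- (i,j,k)-triad, with l ∈ V_ij (left), r ∈ V_jk (right), t ∈ V_ik (top).
record PHyp (N : ℕ) : Set where
  field
    size     : Fin N → Fin N → ℕ
    nonempty : ∀ i j → i < j → 1 ≤ℕ size i j
    edge     : ∀ i j k → Fin (size i j) → Fin (size j k) → Fin (size i k) → Bool

  V : Fin N → Fin N → Set
  V i j = Fin (size i j)

  triadEdges : Fin N → Fin N → Fin N → ℕ
  triadEdges i j k =
    ∑ (size i j) λ l → ∑ (size j k) λ r → ∑ (size i k) λ t →
      if edge i j k l r t then 1 else 0

  triadSize : Fin N → Fin N → Fin N → ℕ
  triadSize i j k = size i j * size i k * size j k

open PHyp public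

-- density of H (minimum of triad densities) is at least d :
-- every triad has density ≥ d, i.e. d * |V_ij||V_ik||V_jk| ≤ #edges
DensityAtLeast : ∀ {N} → PHyp N → Q.ℚ → Set
DensityAtLeast {N} H d = ∀ (i j k : Fin N) → i < j → j < k →
  d Q.* ℕ→ℚ (triadSize H i j k) Q.≤ ℕ→ℚ (triadEdges H i j k)

-- An m-partitioned subhypergraph of H: index set I = {ι 0 < ι 1 < ... < ι (m-1)}
-- (original indices kept), with an edge set E0 contained in the edges of the
-- induced subhypergraph.  E0 a b c l r t : {l,r,t} is an edge of H0 in the
-- (ι a, ι b, ι c)-triad, l left, r right, t top.
record SubHyp {N : ℕ} (H : PHyp N) (m : ℕ) : Set₁ where
  field
    ι    : Fin m → Fin N
    mono : ∀ a b → a < b → ι a < ι b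
    E0   : ∀ a b c → V H (ι a) (ι b) → V H (ι b) (ι c) → V H (ι a) (ι c) → Set
    E0⊆  : ∀ a b c → a < b → b < c → ∀ l r t → E0 a b c l r t →
           edge H (ι a) (ι b) (ι c) l r t ≡ true

  W : Fin m → Fin m → Set
  W a b = V H (ι a) (ι b)

  Fam : Set
  Fam = (a b : Fin m) → a < b → W a b

open SubHyp public

module _ {N : ℕ} {H : PHyp N} {m : ℕ} (S : SubHyp H m) where

  Cond1 : Set
  Cond1 = Σ (Fam S) λ α → Σ (Fam S) λ β → Σ (Fam S) λ γ0 → Σ (Fam S) λ ω →
          Σ (Fam S) λ αω → Σ (Fam S) λ γω →
    ∀ a b c (ab : a < b) (bc : b < c) → let ac = <-trans ab bc in
      E0 S a b c (α a b ab) (β b c bc) (γ0 a c ac)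
    × E0 S a b c (ω a b ab) (β b c bc) (γω a c ac)
    × E0 S a b c (αω a b ab) (ω b c bc) (γ0 a c ac)

  Cond2 : Set
  Cond2 = Σ (Fam S) λ α → Σ (Fam S) λ β → Σ (Fam S) λ γ0 → Σ (Fam S) λ ω →
          Σ (Fam S) λ βω → Σ (Fam S) λ γω →
    ∀ a b c (ab : a < b) (bc : b < c) → let ac = <-trans ab bc in
      E0 S a b c (α a b ab) (β b c bc) (γ0 a c ac)
    × E0 S a b c (α a b ab) (ω b c bc) (γω a c ac)
    × E0 S a b c (ω a b ab) (βω b c bc) (γ0 a c ac)

  Cond3 : Set
  Cond3 = Σ (Fam S) λ α → Σ (Fam S) λ β → Σ (Fam S) λ α' → Σ (Fam S) λ β' →
          Σ (Fam S) λ γ0 → Σ (Fam S) λ γ• →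
          Σ ((a b c d e : Fin m) → a < b → b < c → c < d → d < e → W S b c) λ β• →
          Σ ((a b c d e : Fin m) → a < b → b < c → c < d → d < e → W S c d) λ α• →
    ∀ a b c d e (ab : a < b) (bc : b < c) (cd : c < d) (de : d < e) →
      let ac = <-trans ab bc
          bd = <-trans bc cd
          ce = <-trans cd de
          b• = β• a b c d e ab bc cd de
          a• = α• a b c d e ab bc cd de
      in
      E0 S a b c (α a b ab) (β b c bc) (γ0 a c ac)
    × E0 S a b c (α' a b ab) b• (γ0 a c ac)
    × E0 S b c d b• a• (γ• b d bd)
    × E0 S c d e a• (β' d e de) (γ0 c e ce)

  -- Condition (4).  In the index set I = {i_1 < ... < i_{4n}} we have
  -- i_k = ι (k-1); the positions p,q,r,u,v below are those of
  -- i_{2n}, i_{2n+1}, i_{2n+2}, i_{3n+1}, i_n respectively.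
  Cond4 : ℕ → Set
  Cond4 n = Σ (Fam S) λ α* → Σ (Fam S) λ β* → Σ (Fam S) λ γ →
            Σ (Fam S) λ α1 → Σ (Fam S) λ β1 → Σ (Fam S) λ γ1 →
            Σ (Fam S) λ α2 → Σ (Fam S) λ β2 → Σ (Fam S) λ γ2 →
    (∀ a b c (ab : a < b) (bc : b < c) → let ac = <-trans ab bc in
        E0 S a b c (γ1 a b ab) (β* b c bc) (γ a c ac)
      × E0 S a b c (α* a b ab) (γ2 b c bc) (γ a c ac)
      × E0 S a b c (α1 a b ab) (β1 b c bc) (γ1 a c ac)
      × E0 S a b c (α2 a b ab) (β2 b c bc) (γ2 a c ac))
    ×
    Σ (Fin m) λ p → Σ (Fin m) λ q → Σ (Fin m) λ r → Σ (Fin m) λ u → Σ (Fin m) λ v →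
      suc (toℕ p) ≡ 2 * n × toℕ q ≡ 2 * n × toℕ r ≡ 2 * n + 1 ×
      toℕ u ≡ 3 * n × suc (toℕ v) ≡ n ×
      Σ (p < u) λ pu → Σ (v < r) λ vr →
      Σ (W S p q) λ α → Σ (W S q r) λ β →
        (Σ (W S q u) λ y → E0 S p q u α y (γ2 p u pu))
      × (Σ (W S v q) λ x → E0 S v q r x β (γ1 v r vr))
      × (Σ (W S p r) λ z → E0 S p q r α β z)

{-# OPTIONS --safe #-}
module Submission where

-- A palette is a set P of triples of colours.  First, H contains a dense palette: choose m families of
-- vertices v^c_ij one after the other, each time trading one share of the uniform distribution on the
-- parts for a point mass.  Ramsey's theorem allows the new family to be chosen so that its left, right
-- and top degrees together do not fall below their averages, in all triads at once; hence the density
-- of the sampled pattern stays above 4/27, and one more application of Ramsey's theorem makes that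
-- pattern the same palette in all triads.
--
-- Second, a palette of density above 4/27 contains one of the four configurations.  Deleting colours
-- of small degree, assume that every colour lies in more than 4m²/9 triples.  Suppose that there is no
-- configuration, and choose colours a, b with the largest number s of common tops, and a top c over
-- a b with l left and r right neighbours.  The tops over a b span no edge, so the degree of c gives
-- l r + s (m - s) > 4m²/9.  Some top w over a b is a right neighbour of c, up to reversal; comparing
-- the neighbourhoods of c, w and a bounds the degree of a by s (m - l) + 2 l (m - l - r), which is
-- less than 4m²/9.

-- The thresholds come from one palette. Split the colours into A and B with |B| = 2|A| and take all
-- triples with left colour in A and right and top colours in B. It contains none of the four
-- configurations, has density 4/27, and each colour has degree exactly 4m²/9. There s = m - l =
-- 2m/3, so the final pair of inequalities must be tight at this point, while the auxiliary
-- estimates before it have room to spare.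
--
-- The obstacle in the sampling is that a vertex of V_ij is a left, right or top vertex according to
-- the third index, and it may fall below the average in one of these roles. Averaging controls only
-- the sum over the roles of one vertex, but a triad uses three different vertices, one in each
-- role. Their deficits and surpluses cancel if all pairs show the same profile of degrees, and this
-- is what Ramsey's theorem is used for. The profiles must come from a finite set that is fixed
-- before the hypergraph is known, so degrees are rounded to boundedly many levels.

-- Finite sums of natural numbers.

module Sums where

  open import Defs using (∑)
  open import Data.Nat
  open import Data.Nat.Properties
  open import Data.Nat.Tactic.RingSolver using (solve-∀)
  open import Data.Fin using (Fin; zero; suc; punchIn; cast)
  open import Data.Bool using (Bool; true; false; if_then_else_)
  open import Data.Product using (∃; _,_)
  open import Data.Sum using (inj₁; inj₂)
  open import Function using (_∘_)
  open import Relation.Nullary using (yes; no)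
  open import Relation.Binary.PropositionalEquality

  χ : Bool → ℕ
  χ b = if b then 1 else 0

  χ≤1 : ∀ b → χ b ≤ 1
  χ≤1 true = ≤-refl
  χ≤1 false = z≤n

  ∑-cong : ∀ m {f g : Fin m → ℕ} → (∀ i → f i ≡ g i) → ∑ m f ≡ ∑ m g
  ∑-cong zero eq = refl
  ∑-cong (suc m) eq = cong₂ _+_ (eq zero) (∑-cong m (eq ∘ suc))

  ∑-mono : ∀ m {f g : Fin m → ℕ} → (∀ i → f i ≤ g i) → ∑ m f ≤ ∑ m g
  ∑-mono zero le = z≤n
  ∑-mono (suc m) le = +-mono-≤ (le zero) (∑-mono m (le ∘ suc))

  ∑-distrib-+ : ∀ m (f g : Fin m → ℕ) → ∑ m (λ i → f i + g i) ≡ ∑ m f + ∑ m g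
  ∑-distrib-+ zero f g = refl
  ∑-distrib-+ (suc m) f g =
    trans (cong (f zero + g zero +_) (∑-distrib-+ m (f ∘ suc) (g ∘ suc)))
          (interchange (f zero) (g zero) (∑ m (f ∘ suc)) (∑ m (g ∘ suc)))
    where
    interchange : ∀ a b c d → a + b + (c + d) ≡ a + c + (b + d)
    interchange = solve-∀

  ∑-distribˡ-* : ∀ m c (f : Fin m → ℕ) → ∑ m (λ i → c * f i) ≡ c * ∑ m f
  ∑-distribˡ-* zero c f = sym (*-zeroʳ c)
  ∑-distribˡ-* (suc m) c f =
    trans (cong (c * f zero +_) (∑-distribˡ-* m c (f ∘ suc))) (sym (*-distribˡ-+ c (f zero) _))

  ∑-const : ∀ m c → ∑ m (λ _ → c) ≡ m * c
  ∑-const zero c = refl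
  ∑-const (suc m) c = cong (c +_) (∑-const m c)

  ∑-swap : ∀ m n (f : Fin m → Fin n → ℕ) → ∑ m (λ i → ∑ n (f i)) ≡ ∑ n (λ j → ∑ m (λ i → f i j))
  ∑-swap zero n f = sym (trans (∑-const n 0) (*-zeroʳ n))
  ∑-swap (suc m) n f =
    trans (cong (∑ n (f zero) +_) (∑-swap m n (f ∘ suc)))
          (sym (∑-distrib-+ n (f zero) (λ j → ∑ m (λ i → f (suc i) j))))

  ∑-punchIn : ∀ m (f : Fin (suc m) → ℕ) v → ∑ (suc m) f ≡ f v + ∑ m (f ∘ punchIn v)
  ∑-punchIn m f zero = refl
  ∑-punchIn (suc m) f (suc v) =
    trans (cong (f zero +_) (∑-punchIn m (f ∘ suc) v)) (swap (f zero) (f (suc v)) _)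
    where
    swap : ∀ a b c → a + (b + c) ≡ b + (a + c)
    swap = solve-∀

  term≤∑ : ∀ m (f : Fin m → ℕ) i → f i ≤ ∑ m f
  term≤∑ (suc m) f zero = m≤m+n _ _
  term≤∑ (suc m) f (suc i) = ≤-trans (term≤∑ m (f ∘ suc) i) (m≤n+m _ _)

  ∑-punchIn≤ : ∀ m (f : Fin (suc m) → ℕ) v → ∑ m (f ∘ punchIn v) ≤ ∑ (suc m) f
  ∑-punchIn≤ m f v = subst (∑ m (f ∘ punchIn v) ≤_) (sym (∑-punchIn m f v)) (m≤n+m _ _)

  ∑-pos : ∀ m (f : Fin m → ℕ) → 0 < ∑ m f → ∃ λ i → 0 < f i
  ∑-pos (suc m) f p with f zero in eq
  ... | suc k = zero , subst (0 <_) (sym eq) (s≤s z≤n)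
  ... | zero with ∑-pos m (f ∘ suc) p
  ... | i , q = suc i , q

  ∑-pigeonhole : ∀ m (f : Fin (suc m) → ℕ) c → suc m * c ≤ ∑ (suc m) f → ∃ λ i → c ≤ f i
  ∑-pigeonhole zero f c p = zero , subst₂ _≤_ (+-identityʳ c) (+-identityʳ (f zero)) p
  ∑-pigeonhole (suc m) f c p with c ≤? f zero
  ... | yes q = zero , q
  ... | no ¬q =
    let i , r = ∑-pigeonhole m (f ∘ suc) c (+-cancelˡ-≤ c _ _ (≤-trans p (+-monoˡ-≤ _ (<⇒≤ (≰⇒> ¬q)))))
    in suc i , r

  argmax : ∀ m (f : Fin (suc m) → ℕ) → ∃ λ i → ∀ j → f j ≤ f i
  argmax zero f = zero , λ { zero → ≤-refl }
  argmax (suc m) f with argmax m (f ∘ suc)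
  ... | i , max with ≤-total (f zero) (f (suc i))
  ... | inj₁ le = suc i , λ { zero → le ; (suc j) → max j }
  ... | inj₂ ge = zero , λ { zero → ≤-refl ; (suc j) → ≤-trans (max j) ge }

  ∑-cast : ∀ {m n} (eq : m ≡ n) (f : Fin n → ℕ) → ∑ m (f ∘ cast eq) ≡ ∑ n f
  ∑-cast {zero} {zero} eq f = refl
  ∑-cast {suc m} {suc n} eq f = cong (f zero +_) (∑-cast (suc-injective eq) (f ∘ suc))

  ∑∑-product : ∀ m n (f : Fin m → ℕ) (g : Fin n → ℕ) → ∑ m (λ i → ∑ n (λ j → f i * g j)) ≡ ∑ m f * ∑ n g
  ∑∑-product m n f g = begin
    ∑ m (λ i → ∑ n (λ j → f i * g j)) ≡⟨ ∑-cong m (λ i → trans (∑-distribˡ-* n (f i) g) (*-comm (f i) _)) ⟩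
    ∑ m (λ i → ∑ n g * f i)           ≡⟨ ∑-distribˡ-* m (∑ n g) f ⟩
    ∑ n g * ∑ m f                     ≡⟨ *-comm (∑ n g) _ ⟩
    ∑ m f * ∑ n g                     ∎
    where open ≡-Reasoning

-- Polynomial inequalities over the integers, with explicit certificates.

module Certificates where

  open import Data.Nat as ℕ using (ℕ; z≤n; s≤s)
  import Data.Nat.Properties as ℕP
  open import Data.Integer
  open import Data.Integer.Properties
  open import Data.Integer.Tactic.RingSolver using (solve-∀)
  open import Data.Sum using (inj₁; inj₂)
  open import Data.Empty using (⊥)
  open import Relation.Binary.PropositionalEquality using (_≡_; refl; subst; subst₂; sym; trans; cong; cong₂)

  infixr 6 _⊕_
  infixr 7 _⊗_

  _⊕_ : ∀ {x y} → + 0 ≤ x → + 0 ≤ y → + 0 ≤ x + y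
  _⊕_ = +-mono-≤

  _⊗_ : ∀ {x y} → + 0 ≤ x → + 0 ≤ y → + 0 ≤ x * y
  _⊗_ {+ a} {+ b} _ _ = subst (+ 0 ≤_) (pos-* a b) (+≤+ z≤n)

  square : ∀ x → + 0 ≤ x * x
  square (+ a) = _⊗_ {+ a} {+ a} (+≤+ z≤n) (+≤+ z≤n)
  square -[1+ a ] = +≤+ z≤n

  _⊗<_ : ∀ {x y} → + 0 < x → + 0 < y → + 0 < x * y
  _⊗<_ {+[1+ a ]} {+[1+ b ]} _ _ = +<+ (s≤s z≤n)
  _⊗<_ {+ ℕ.zero} (+<+ ()) _
  _⊗<_ {+[1+ a ]} {+ ℕ.zero} _ (+<+ ())

  -- The shape of the certificates: a positive multiple of a strict hypothesis plus products of
  -- nonnegative quantities vanishes identically, which the ring solver confirms.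
  refute : ∀ {x y} → + 0 < x → + 0 ≤ y → x + y ≡ + 0 → ⊥
  refute {x} {y} p q eq = <-irrefl refl (subst (+ 0 <_) eq (subst (_< x + y) refl (+-mono-<-≤ p q)))

  ÷ : ∀ k .{{_ : Positive k}} {x} → + 0 ≤ k * x → + 0 ≤ x
  ÷ k {x} p = *-cancelˡ-≤-pos (+ 0) x k (subst (_≤ k * x) (sym (*-zeroʳ k)) p)

  const : ∀ n → + 0 ≤ + n
  const n = +≤+ z≤n


  -- 8 times the first excess plus 4 times the second is minus a sum of squares, which vanishes at s = m - l = 2m/3.
  excess-absurd : ∀ m l r s →
    + 0 < + 9 * (l * r) + + 9 * (s * (m - s)) - + 4 * (m * m) →
    + 0 < + 9 * (s * (m - l)) + + 18 * (l * (m - l - r)) - + 4 * (m * m) → ⊥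
  excess-absurd m l r s p q =
    refute (_⊗<_ {+ 4} (+<+ (s≤s z≤n)) q)
      (const 8 ⊗ <⇒≤ p ⊕ const 3 ⊗ square (+ 3 * (s + (m - l)) - + 4 * m) ⊕ const 45 ⊗ square (s - (m - l)))
      (identity m l r s)
    where
    identity : ∀ m l r s →
      + 4 * (+ 9 * (s * (m - l)) + + 18 * (l * (m - l - r)) - + 4 * (m * m)) +
      (+ 8 * (+ 9 * (l * r) + + 9 * (s * (m - s)) - + 4 * (m * m)) +
       (+ 3 * ((+ 3 * (s + (m - l)) - + 4 * m) * (+ 3 * (s + (m - l)) - + 4 * m)) +
        + 45 * ((s - (m - l)) * (s - (m - l))))) ≡ + 0
    identity = solve-∀

  -- From `l + r ≤ m - s` follows `l r ≤ (m - s)² / 4`. Then `l r + s (m - s)` is largest at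
  -- `s = m / 3`, with value `m² / 3`, below `4 m² / 9`.
  outside-absurd : ∀ m l r s →
    + 0 < + 9 * (l * r) + + 9 * (s * (m - s)) - + 4 * (m * m) →
    + 0 ≤ m - l - r - s → + 0 ≤ m - s → + 0 ≤ l → + 0 ≤ r → ⊥
  outside-absurd m l r s p q u v w =
    refute (_⊗<_ {+ 4} (+<+ (s≤s z≤n)) p)
      (const 9 ⊗ square (l - r) ⊕ const 9 ⊗ (q ⊗ (u ⊕ v ⊕ w)) ⊕ const 3 ⊗ square (+ 3 * s - m) ⊕ const 4 ⊗ square m)
      (identity m l r s)
    where
    identity : ∀ m l r s →
      + 4 * (+ 9 * (l * r) + + 9 * (s * (m - s)) - + 4 * (m * m)) +
      (+ 9 * ((l - r) * (l - r)) + (+ 9 * ((m - l - r - s) * (m - s + (l + r))) +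
       (+ 3 * ((+ 3 * s - m) * (+ 3 * s - m)) + + 4 * (m * m)))) ≡ + 0
    identity = solve-∀

  -- For `m > 0` the minimum over `s ≥ 0`, at `s = m / √6`, is positive but small. The squares sit
  -- at rational points near it: `3 m / 8` for `s ≤ m / 2`, and `m / 2` beyond.
  top-cubic-nonneg : ∀ m s → + 0 ≤ m → + 0 ≤ s →
    + 0 ≤ + 48 * (s * s * s) - + 24 * (m * m * s) + + 7 * (m * m * m)
  top-cubic-nonneg m s m≥0 s≥0 with ≤-total (+ 2 * s) m
  ... | inj₁ 2s≤m = ÷ (+ 16) (subst (+ 0 ≤_) (sym (identity m s))
      (const 3 ⊗ (square (+ 8 * s - + 3 * m) ⊗ (const 4 ⊗ s≥0 ⊕ const 3 ⊗ m≥0)) ⊕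
       square m ⊗ (const 30 ⊗ i≤j⇒0≤j-i 2s≤m ⊕ m≥0)))
    where
    identity : ∀ m s → + 16 * (+ 48 * (s * s * s) - + 24 * (m * m * s) + + 7 * (m * m * m)) ≡
      + 3 * ((+ 8 * s - + 3 * m) * (+ 8 * s - + 3 * m) * (+ 4 * s + + 3 * m)) +
      m * m * (+ 30 * (m - + 2 * s) + m)
    identity = solve-∀
  ... | inj₂ m≤2s = subst (+ 0 ≤_) (sym (identity m s))
      (const 12 ⊗ (square (+ 2 * s - m) ⊗ (s≥0 ⊕ m≥0)) ⊕
       square m ⊗ (const 5 ⊗ i≤j⇒0≤j-i m≤2s ⊕ const 2 ⊗ s≥0))
    where
    identity : ∀ m s → + 48 * (s * s * s) - + 24 * (m * m * s) + + 7 * (m * m * m) ≡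
      + 12 * ((+ 2 * s - m) * (+ 2 * s - m) * (s + m)) + m * m * (+ 5 * (+ 2 * s - m) + + 2 * s)
    identity = solve-∀

  -- If `s + r < 3 m / 4`, replace `r` by `3 m / 4 - s` in `h` and bound `l` through `e`. What
  -- remains is a polynomial in `m` and `s` only, a negative multiple of the cubic above.
  right-plus-top-absurd : ∀ m l r s →
    + 0 ≤ m → + 0 ≤ l → + 0 ≤ r → + 0 ≤ s →
    + 0 < + 9 * (l * r) + + 9 * (s * (m - s)) - + 4 * (m * m) →
    + 0 < + 36 * (s * (m - l)) - + 7 * (m * m) →
    + 0 < + 3 * m - + 4 * s - + 4 * r → ⊥
  right-plus-top-absurd m l r s m≥0 l≥0 r≥0 s≥0 h e y =
    refute (_⊗<_ e (+-mono-<-≤ y (const 4 ⊗ r≥0)))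
      (const 16 ⊗ (s≥0 ⊗ <⇒≤ h) ⊕ const 36 ⊗ (s≥0 ⊗ l≥0 ⊗ <⇒≤ y) ⊕
       const 3 ⊗ top-cubic-nonneg m s m≥0 s≥0)
      (identity m l r s)
    where
    identity : ∀ m l r s →
      (+ 36 * (s * (m - l)) - + 7 * (m * m)) * (+ 3 * m - + 4 * s - + 4 * r + + 4 * r) +
      (+ 16 * (s * (+ 9 * (l * r) + + 9 * (s * (m - s)) - + 4 * (m * m))) +
       (+ 36 * (s * (l * (+ 3 * m - + 4 * s - + 4 * r))) +
        + 3 * (+ 48 * (s * s * s) - + 24 * (m * m * s) + + 7 * (m * m * m)))) ≡ + 0
    identity = solve-∀

  -- Since `s (m - s) ≤ m² / 4`, a share `4/9 - 1/4 = 7/36` of `m²` is left for `k`. This is the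
  -- origin of the constant 7/36.
  product-excess : ∀ m k s →
    + 0 < + 9 * k + + 9 * (s * (m - s)) - + 4 * (m * m) →
    + 0 < + 36 * k - + 7 * (m * m)
  product-excess m k s h =
    subst (+ 0 <_) (identity m k s)
      (+-mono-<-≤ (_⊗<_ {+ 4} (+<+ (s≤s z≤n)) h) (const 9 ⊗ square (m - + 2 * s)))
    where
    identity : ∀ m k s →
      + 4 * (+ 9 * k + + 9 * (s * (m - s)) - + 4 * (m * m)) + + 9 * ((m - + 2 * s) * (m - + 2 * s))
      ≡ + 36 * k - + 7 * (m * m)
    identity = solve-∀

  quarter-excess : ∀ m k s l →
    + 0 < + 9 * k + + 9 * (s * (m - l)) - + 4 * (m * m) → + 0 ≤ m * m - + 4 * k →
    + 0 < + 36 * (s * (m - l)) - + 7 * (m * m)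
  quarter-excess m k s l h q =
    subst (+ 0 <_) (identity m k s l)
      (+-mono-<-≤ (_⊗<_ {+ 4} (+<+ (s≤s z≤n)) h) (const 9 ⊗ q))
    where
    identity : ∀ m k s l →
      + 4 * (+ 9 * k + + 9 * (s * (m - l)) - + 4 * (m * m)) + + 9 * (m * m - + 4 * k)
      ≡ + 36 * (s * (m - l)) - + 7 * (m * m)
    identity = solve-∀

  difference-pos : ∀ {i j} → i < j → + 0 < j - i
  difference-pos {i} {j} i<j = subst (_< j - i) (+-inverseʳ i) (+-monoˡ-< (- i) i<j)

  cast-≤ : ∀ {a b} → a ℕ.≤ b → + 0 ≤ + b - + a
  cast-≤ a≤b = i≤j⇒0≤j-i (+≤+ a≤b)

  cast-∸ : ∀ {a b} → a ℕ.≤ b → + (b ℕ.∸ a) ≡ + b - + a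
  cast-∸ {a} {b} a≤b = sym (trans (m-n≡m⊖n b a) (⊖-≥ a≤b))

  -- The passage from counting in `ℕ` to the integer certificates: `k` is what a colour of degree
  -- `d` gets beyond `s` from each of `m - x` partners.
  degree-excess : ∀ m s x k d → 4 ℕ.* (m ℕ.* m) ℕ.< 9 ℕ.* d → d ℕ.+ s ℕ.* x ℕ.≤ m ℕ.* s ℕ.+ k →
    + 0 < + 9 * + k + + 9 * (+ s * (+ m - + x)) - + 4 * (+ m * + m)
  degree-excess m s x k d p q =
    subst (+ 0 <_) (identity (+ m) (+ s) (+ x) (+ k)) (difference-pos (subst₂ _<_ lhs rhs (+<+ bound)))
    where
    bound : 4 ℕ.* (m ℕ.* m) ℕ.+ 9 ℕ.* (s ℕ.* x) ℕ.< 9 ℕ.* (m ℕ.* s) ℕ.+ 9 ℕ.* k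
    bound = ℕP.<-≤-trans (ℕP.+-monoˡ-< (9 ℕ.* (s ℕ.* x)) p)
      (subst₂ ℕ._≤_ (ℕP.*-distribˡ-+ 9 d (s ℕ.* x)) (ℕP.*-distribˡ-+ 9 (m ℕ.* s) k) (ℕP.*-monoʳ-≤ 9 q))
    scaled : ∀ c a b → + (c ℕ.* (a ℕ.* b)) ≡ + c * (+ a * + b)
    scaled c a b = trans (pos-* c (a ℕ.* b)) (cong (+ c *_) (pos-* a b))
    lhs : + (4 ℕ.* (m ℕ.* m) ℕ.+ 9 ℕ.* (s ℕ.* x)) ≡ + 4 * (+ m * + m) + + 9 * (+ s * + x)
    lhs = cong₂ _+_ (scaled 4 m m) (scaled 9 s x)
    rhs : + (9 ℕ.* (m ℕ.* s) ℕ.+ 9 ℕ.* k) ≡ + 9 * (+ m * + s) + + 9 * + k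
    rhs = cong₂ _+_ (scaled 9 m s) (pos-* 9 k)
    identity : ∀ m s x k → + 9 * (m * s) + + 9 * k - (+ 4 * (m * m) + + 9 * (s * x)) ≡
      + 9 * k + + 9 * (s * (m - x)) - + 4 * (m * m)
    identity = solve-∀

  -- `l + r ≤ 5 m / 6` would give `l r ≤ 25 m² / 144`, below `7 m² / 36 = 28 m² / 144`.
  rest-absurd : ∀ m l r → + 0 ≤ m → + 0 ≤ l → + 0 ≤ r →
    + 0 < + 36 * (l * r) - + 7 * (m * m) → + 0 ≤ + 6 * (m - l - r) - m → ⊥
  rest-absurd m l r m≥0 l≥0 r≥0 h y =
    refute (_⊗<_ {+ 4} (+<+ (s≤s z≤n)) h)
      (const 36 ⊗ square (l - r) ⊕ y ⊗ (const 5 ⊗ m≥0 ⊕ const 6 ⊗ (l≥0 ⊕ r≥0)) ⊕ const 3 ⊗ square m)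
      (identity m l r)
    where
    identity : ∀ m l r →
      + 4 * (+ 36 * (l * r) - + 7 * (m * m)) +
      (+ 36 * ((l - r) * (l - r)) +
       ((+ 6 * (m - l - r) - m) * (+ 5 * m + + 6 * (l + r)) + + 3 * (m * m))) ≡ + 0
    identity = solve-∀

  -- If `p ≤ m / 6`, both products have a factor at most `m / 6`, so `f ≤ m² / 6`. Otherwise
  -- `z ≤ m / 6 ≤ p`, so `f ≤ p (q + w) ≤ p (m - p) ≤ 3 m² / 16`. Both bounds are below `7 m² / 36`.
  thin-absurd : ∀ m f p q w z →
    + 0 ≤ m → + 0 ≤ p → + 0 ≤ q → + 0 ≤ w →
    + 0 < + 36 * f - + 7 * (m * m) →
    + 0 ≤ p * w + q * z - f →
    + 0 ≤ m - p - q - w → + 0 ≤ m - + 4 * p → + 0 ≤ m - + 6 * z → ⊥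
  thin-absurd m f p q w z m≥0 p≥0 q≥0 w≥0 h f≤ sum≤ 4p≤ 6z≤ with ≤-total (+ 6 * p) m
  ... | inj₁ 6p≤m =
    refute h
      (const 36 ⊗ f≤ ⊕ const 6 ⊗ (w≥0 ⊗ i≤j⇒0≤j-i 6p≤m) ⊕ const 6 ⊗ (q≥0 ⊗ 6z≤) ⊕
       const 6 ⊗ (m≥0 ⊗ sum≤) ⊕ square m ⊕ const 6 ⊗ (m≥0 ⊗ p≥0))
      (identity m f p q w z)
    where
    identity : ∀ m f p q w z →
      + 36 * f - + 7 * (m * m) +
      (+ 36 * (p * w + q * z - f) + (+ 6 * (w * (m - + 6 * p)) + (+ 6 * (q * (m - + 6 * z)) +
       (+ 6 * (m * (m - p - q - w)) + (m * m + + 6 * (m * p)))))) ≡ + 0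
    identity = solve-∀
  ... | inj₂ m≤6p =
    refute (_⊗<_ {+ 4} (+<+ (s≤s z≤n)) h)
      (const 144 ⊗ f≤ ⊕ const 144 ⊗ (p≥0 ⊗ sum≤) ⊕ const 24 ⊗ (q≥0 ⊗ 6z≤) ⊕
       const 24 ⊗ (q≥0 ⊗ i≤j⇒0≤j-i m≤6p) ⊕ const 9 ⊗ (4p≤ ⊗ (4p≤ ⊕ const 2 ⊗ m≥0)) ⊕ square m)
      (identity m f p q w z)
    where
    identity : ∀ m f p q w z →
      + 4 * (+ 36 * f - + 7 * (m * m)) +
      (+ 144 * (p * w + q * z - f) + (+ 144 * (p * (m - p - q - w)) + (+ 24 * (q * (m - + 6 * z)) +
       (+ 24 * (q * (+ 6 * p - m)) + (+ 9 * ((m - + 4 * p) * (m - + 4 * p + + 2 * m)) + m * m))))) ≡ + 0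
    identity = solve-∀

  -- For `l ≤ m / 4`, `l r ≤ l (m - l) ≤ 3 m² / 16 = 27 m² / 144`, just below `28 m² / 144`.
  short-left-absurd : ∀ m l r → + 0 ≤ m → + 0 ≤ l → + 0 ≤ m - l - r →
    + 0 < + 36 * (l * r) - + 7 * (m * m) → + 0 ≤ m - + 4 * l → ⊥
  short-left-absurd m l r m≥0 l≥0 z≥0 h y =
    refute (_⊗<_ {+ 4} (+<+ (s≤s z≤n)) h)
      (const 144 ⊗ (l≥0 ⊗ z≥0) ⊕ const 9 ⊗ (y ⊗ (y ⊕ const 2 ⊗ m≥0)) ⊕ square m)
      (identity m l r)
    where
    identity : ∀ m l r →
      + 4 * (+ 36 * (l * r) - + 7 * (m * m)) +
      (+ 144 * (l * (m - l - r)) + (+ 9 * ((m - + 4 * l) * (m - + 4 * l + + 2 * m)) + m * m)) ≡ + 0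
    identity = solve-∀

  -- What is left of `few-tops-absurd` once `r` and `s` are eliminated, and of `many-tops-absurd` at
  -- `s = m / 2`.
  left-cubic : ℤ → ℤ → ℤ
  left-cubic m l = + 288 * (l * l * l) - + 144 * (l * l * m) - + 4 * (l * m * m) + + 7 * (m * m * m)

  -- The cubic lies above its tangents. The one at `l = m / 3` serves up to `l = 2 m / 5`, where its
  -- height is still `m³ / 15`; the one at `l = 3 m / 8` serves beyond. The surplus `m³ / 15` is
  -- spent in `many-tops-absurd`.
  left-cubic-bound : ∀ m l → + 0 ≤ m → + 0 ≤ l → + 0 ≤ + 15 * left-cubic m l - m * m * m
  left-cubic-bound m l m≥0 l≥0 with ≤-total (+ 5 * l) (+ 2 * m)
  ... | inj₁ 5l≤2m = subst (+ 0 ≤_) (rescale m l (left-cubic m l))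
      (const 5 ⊗ subst (+ 0 ≤_) (sym (tangent m l))
         (square (+ 3 * l - m) ⊗ (const 96 ⊗ l≥0 ⊕ const 16 ⊗ m≥0)) ⊕
       square m ⊗ (const 12 ⊗ i≤j⇒0≤j-i 5l≤2m))
    where
    tangent : ∀ m l →
      + 3 * (+ 288 * (l * l * l) - + 144 * (l * l * m) - + 4 * (l * m * m) + + 7 * (m * m * m)) - m * m * (+ 5 * m - + 12 * l) ≡
      (+ 3 * l - m) * (+ 3 * l - m) * (+ 96 * l + + 16 * m)
    tangent = solve-∀
    rescale : ∀ m l c → + 5 * (+ 3 * c - m * m * (+ 5 * m - + 12 * l)) + m * m * (+ 12 * (+ 2 * m - + 5 * l)) ≡ + 15 * c - m * m * m
    rescale = solve-∀
  ... | inj₂ 2m≤5l = ÷ (+ 8) (subst (+ 0 ≤_) (rescale m (left-cubic m l))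
      (const 15 ⊗ subst (+ 0 ≤_) (regroup m l (left-cubic m l))
         (subst (+ 0 ≤_) (sym (tangent m l))
            (square (+ 8 * l - + 3 * m) ⊗ (const 36 ⊗ l≥0 ⊕ const 9 ⊗ m≥0)) ⊕
          square m ⊗ (const 15 ⊗ i≤j⇒0≤j-i 2m≤5l ⊕ l≥0)) ⊕
       const 67 ⊗ (square m ⊗ m≥0)))
    where
    tangent : ∀ m l →
      + 8 * (+ 288 * (l * l * l) - + 144 * (l * l * m) - + 4 * (l * m * m) + + 7 * (m * m * m)) - m * m * (+ 76 * l - + 25 * m) ≡
      (+ 8 * l - + 3 * m) * (+ 8 * l - + 3 * m) * (+ 36 * l + + 9 * m)
    tangent = solve-∀
    regroup : ∀ m l c →
      + 8 * c - m * m * (+ 76 * l - + 25 * m) + m * m * (+ 15 * (+ 5 * l - + 2 * m) + l) ≡ + 8 * c - + 5 * (m * m * m)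
    regroup = solve-∀
    rescale : ∀ m c → + 15 * (+ 8 * c - + 5 * (m * m * m)) + + 67 * (m * m * m) ≡ + 8 * (+ 15 * c - m * m * m)
    rescale = solve-∀

  -- x (a + b - x) increases up to min a b.
  exchange : ∀ a b x c → + 0 < c + + 9 * (x * (a + b - x)) → + 0 ≤ a - x → + 0 ≤ b - x → + 0 < c + + 9 * (a * b)
  exchange a b x c p q r = subst (+ 0 <_) (identity a b x c) (+-mono-<-≤ p (const 9 ⊗ (q ⊗ r)))
    where
    identity : ∀ a b x c → c + + 9 * (x * (a + b - x)) + + 9 * ((a - x) * (b - x)) ≡ c + + 9 * (a * b)
    identity = solve-∀

  -- Since `x < m - 2 l ≤ 2 l`, `x` is on the increasing branch of `x (m - x)` and may be replaced
  -- by `m - 2 l`. Then `s ≤ m / 2` and the lower bound on `l r` eliminate `s` and `r`.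
  few-tops-absurd : ∀ m l r s x →
    + 0 < m → + 0 ≤ l → + 0 ≤ m - r → + 0 ≤ + 4 * l - m → + 0 ≤ m - + 2 * s →
    + 0 < + 36 * (l * r) - + 7 * (m * m) →
    + 0 < + 9 * (s * (m - r)) - + 4 * (m * m) + + 9 * (x * (m - x)) →
    + 0 < m - + 2 * l - x → ⊥
  few-tops-absurd m l r s x m>0 l≥0 r≤m m≤4l 2s≤m h w y =
    refute (_⊗<_ m>0 h)
      (const 8 ⊗ (l≥0 ⊗ <⇒≤ w′) ⊕ const 36 ⊗ (l≥0 ⊗ 2s≤m ⊗ r≤m) ⊕ cubic≥0)
      (identity m l r s)
    where
    m≥0 : + 0 ≤ m
    m≥0 = <⇒≤ m>0
    cubic≥0 : + 0 ≤ left-cubic m l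
    cubic≥0 = ÷ (+ 15) (subst (+ 0 ≤_) (cancel (left-cubic m l) (m * m * m)) (left-cubic-bound m l m≥0 l≥0 ⊕ square m ⊗ m≥0))
      where
      cancel : ∀ c d → + 15 * c - d + d ≡ + 15 * c
      cancel = solve-∀
    split : ∀ m l → m ≡ m - + 2 * l + + 2 * l
    split = solve-∀
    gap : ∀ m l x → m - + 2 * l - x + (+ 4 * l - m) ≡ + 2 * l - x
    gap = solve-∀
    w′ : + 0 < + 9 * (s * (m - r)) - + 4 * (m * m) + + 9 * ((m - + 2 * l) * (+ 2 * l))
    w′ = exchange (m - + 2 * l) (+ 2 * l) x (+ 9 * (s * (m - r)) - + 4 * (m * m))
      (subst (λ n → + 0 < + 9 * (s * (m - r)) - + 4 * (m * m) + + 9 * (x * (n - x))) (split m l) w)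
      (<⇒≤ y) (subst (+ 0 ≤_) (gap m l x) (<⇒≤ y ⊕ m≤4l))
    identity : ∀ m l r s →
      m * (+ 36 * (l * r) - + 7 * (m * m)) +
      (+ 8 * (l * (+ 9 * (s * (m - r)) - + 4 * (m * m) + + 9 * ((m - + 2 * l) * (+ 2 * l)))) +
       (+ 36 * (l * ((m - + 2 * s) * (m - r))) +
        (+ 288 * (l * l * l) - + 144 * (l * l * m) - + 4 * (l * m * m) + + 7 * (m * m * m)))) ≡ + 0
    identity = solve-∀

  -- The counterpart for `s ≥ m / 2`: `x` is replaced by `2 m - 2 s - 2 l`, which agrees with the
  -- former threshold `m - 2 l` at `s = m / 2`. The certificate is expanded in `t = 2 s - m`.
  many-tops-absurd : ∀ m l r s x →
    + 0 ≤ m → + 0 ≤ l → + 0 < s → + 0 ≤ + 4 * l - m → + 0 ≤ + 2 * s - m →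
    + 0 < + 9 * (l * r) + + 9 * (s * (m - s)) - + 4 * (m * m) →
    + 0 < + 9 * (s * (m - r)) - + 4 * (m * m) + + 9 * (x * (m - x)) →
    + 0 < + 2 * m - + 2 * s - + 2 * l - x → ⊥
  many-tops-absurd m l r s x m≥0 l≥0 s>0 m≤4l t≥0 h w y =
    refute (_⊗<_ {+ 8} (+<+ (s≤s z≤n)) (_⊗<_ s>0 h))
      (const 8 ⊗ (l≥0 ⊗ <⇒≤ w′) ⊕ quadratic≥0 ⊕
       t≥0 ⊗ m≤4l ⊗ (const 18 ⊗ m≤4l ⊕ const 9 ⊗ m≥0) ⊕
       const 18 ⊗ (square t ⊗ m≤4l) ⊕ const 9 ⊗ (t≥0 ⊗ square t))
      (identity m l r s)
    where
    t : ℤ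
    t = + 2 * s - m
    -- As a quadratic in `t` with constant term at least `m³ / 15`, it has negative discriminant:
    -- `4 < 4 * 27 / 15`.
    quadratic≥0 : + 0 ≤ left-cubic m l - + 2 * (m * m * t) + + 27 * (m * (t * t))
    quadratic≥0 = ÷ (+ 15) (subst (+ 0 ≤_) (complete (left-cubic m l) m t)
        (left-cubic-bound m l m≥0 l≥0 ⊕ m≥0 ⊗ (square (m - + 15 * t) ⊕ const 180 ⊗ square t)))
      where
      complete : ∀ c m t → + 15 * c - m * m * m + m * ((m - + 15 * t) * (m - + 15 * t) + + 180 * (t * t)) ≡
        + 15 * (c - + 2 * (m * m * t) + + 27 * (m * (t * t)))
      complete = solve-∀
    split : ∀ m l s → m ≡ + 2 * m - + 2 * s - + 2 * l + (+ 2 * l + + 2 * s - m)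
    split = solve-∀
    gap : ∀ m l s x → + 2 * m - + 2 * s - + 2 * l - x + ((+ 4 * l - m) + + 2 * (+ 2 * s - m)) ≡ + 2 * l + + 2 * s - m - x
    gap = solve-∀
    w′ : + 0 < + 9 * (s * (m - r)) - + 4 * (m * m) + + 9 * ((+ 2 * m - + 2 * s - + 2 * l) * (+ 2 * l + + 2 * s - m))
    w′ = exchange (+ 2 * m - + 2 * s - + 2 * l) (+ 2 * l + + 2 * s - m) x (+ 9 * (s * (m - r)) - + 4 * (m * m))
      (subst (λ n → + 0 < + 9 * (s * (m - r)) - + 4 * (m * m) + + 9 * (x * (n - x))) (split m l s) w)
      (<⇒≤ y) (subst (+ 0 ≤_) (gap m l s x) (<⇒≤ y ⊕ m≤4l ⊕ const 2 ⊗ t≥0))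
    identity : ∀ m l r s →
      + 8 * (s * (+ 9 * (l * r) + + 9 * (s * (m - s)) - + 4 * (m * m))) +
      (+ 8 * (l * (+ 9 * (s * (m - r)) - + 4 * (m * m) + + 9 * ((+ 2 * m - + 2 * s - + 2 * l) * (+ 2 * l + + 2 * s - m)))) +
       ((+ 288 * (l * l * l) - + 144 * (l * l * m) - + 4 * (l * m * m) + + 7 * (m * m * m)
          - + 2 * (m * m * (+ 2 * s - m)) + + 27 * (m * ((+ 2 * s - m) * (+ 2 * s - m)))) +
        ((+ 2 * s - m) * ((+ 4 * l - m) * (+ 18 * (+ 4 * l - m) + + 9 * m)) +
         (+ 18 * ((+ 2 * s - m) * (+ 2 * s - m) * (+ 4 * l - m)) +
          + 9 * ((+ 2 * s - m) * ((+ 2 * s - m) * (+ 2 * s - m))))))) ≡ + 0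
    identity = solve-∀

-- Ramsey's theorem for ordered tuples.

module RamseyTheory where

  open import Data.Nat
  open import Data.Nat.Properties
  open import Data.Fin as Fin using (Fin; zero; suc)
  open import Data.Bool using (Bool; true; false)
  open import Data.List using (List; []; _∷_; length; map; allFin)
  open import Data.List.Membership.Propositional using (_∈_)
  open import Data.List.Relation.Unary.Any using (here; there)
  open import Data.List.Relation.Unary.All using (All; []; _∷_)
  open import Data.List.Relation.Unary.AllPairs using (AllPairs; []; _∷_)
  open import Data.List.Relation.Unary.AllPairs.Properties using (tabulate⁺-<)
  open import Data.List.Relation.Binary.Sublist.Propositional using (_⊆_; []; _∷_; _∷ʳ_; ⊆-refl; ⊆-trans; minimum)
  open import Data.List.Relation.Binary.Sublist.Propositional.Properties using (All-resp-⊆)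
  open import Data.Vec using (Vec; []; _∷_; toList; lookup)
  open import Data.Product using (∃; _×_; _,_; proj₁)
  open import Data.Sum using (_⊎_; inj₁; inj₂)
  open import Relation.Nullary using (yes; no)
  open import Relation.Binary.PropositionalEquality

  -- Tuples are sublists, so the order of the indices survives each passage to a smaller list
  -- without any arithmetic on positions.
  Homogeneous : ∀ {A : Set} {r} → (Vec A r → Bool) → List A → Set
  Homogeneous Q ys = ∃ λ b → ∀ zs → toList zs ⊆ ys → Q zs ≡ b

  homogeneous-⊆ : ∀ {A : Set} {r} {Q : Vec A r → Bool} {xs ys} → xs ⊆ ys → Homogeneous Q ys → Homogeneous Q xs
  homogeneous-⊆ σ (b , h) = b , λ zs τ → h zs (⊆-trans τ σ)

  private
    -- Every r-tuple behind x extends it to an (r + 1)-tuple of the colour recorded with x.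
    data Greedy {A : Set} {r} (Q : Vec A (suc r) → Bool) : List (A × Bool) → Set where
      []  : Greedy Q []
      _∷_ : ∀ {x b ps} → (∀ zs → toList zs ⊆ map proj₁ ps → Q (x ∷ zs) ≡ b) → Greedy Q ps → Greedy Q ((x , b) ∷ ps)

    coloured : ∀ {A : Set} → Bool → List (A × Bool) → List A
    coloured b [] = []
    coloured true ((x , true) ∷ ps) = x ∷ coloured true ps
    coloured true ((x , false) ∷ ps) = coloured true ps
    coloured false ((x , true) ∷ ps) = coloured false ps
    coloured false ((x , false) ∷ ps) = x ∷ coloured false ps

    coloured-⊆ : ∀ {A : Set} b (ps : List (A × Bool)) → coloured b ps ⊆ map proj₁ ps
    coloured-⊆ b [] = []
    coloured-⊆ true ((x , true) ∷ ps) = refl ∷ coloured-⊆ true ps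
    coloured-⊆ true ((x , false) ∷ ps) = x ∷ʳ coloured-⊆ true ps
    coloured-⊆ false ((x , true) ∷ ps) = x ∷ʳ coloured-⊆ false ps
    coloured-⊆ false ((x , false) ∷ ps) = refl ∷ coloured-⊆ false ps

    coloured-length : ∀ {A : Set} (ps : List (A × Bool)) → length (coloured true ps) + length (coloured false ps) ≡ length ps
    coloured-length [] = refl
    coloured-length ((x , true) ∷ ps) = cong suc (coloured-length ps)
    coloured-length ((x , false) ∷ ps) = trans (+-suc _ _) (cong suc (coloured-length ps))

    coloured-homogeneous : ∀ {A : Set} {r} {Q : Vec A (suc r) → Bool} {ps} b → Greedy Q ps →
      ∀ zs → toList zs ⊆ coloured b ps → Q zs ≡ b
    coloured-homogeneous true (_∷_ {b = true} h g) (z ∷ zs) (_ ∷ʳ σ) = coloured-homogeneous true g (z ∷ zs) σ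
    coloured-homogeneous true (_∷_ {b = true} {ps} h g) (_ ∷ zs) (refl ∷ σ) = h zs (⊆-trans σ (coloured-⊆ true ps))
    coloured-homogeneous true (_∷_ {b = false} h g) zs σ = coloured-homogeneous true g zs σ
    coloured-homogeneous false (_∷_ {b = true} h g) zs σ = coloured-homogeneous false g zs σ
    coloured-homogeneous false (_∷_ {b = false} h g) (z ∷ zs) (_ ∷ʳ σ) = coloured-homogeneous false g (z ∷ zs) σ
    coloured-homogeneous false (_∷_ {b = false} {ps} h g) (_ ∷ zs) (refl ∷ σ) = h zs (⊆-trans σ (coloured-⊆ false ps))
    coloured-homogeneous true [] (_ ∷ _) ()
    coloured-homogeneous false [] (_ ∷ _) ()

  -- `N` is fixed before the type `A`, because `A` will be the index set of a hypergraph whose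
  -- number of indices is itself derived from `N`.
  Ramsey : ℕ → ℕ → ℕ → Set₁
  Ramsey r M N = ∀ {A : Set} (Q : Vec A r → Bool) xs → N ≤ length xs → ∃ λ ys → ys ⊆ xs × M ≤ length ys × Homogeneous Q ys

  private
    -- The Erdős-Rado step: keep the head, make the tail homogeneous for the colouring with this
    -- head fixed, and continue inside that tail.
    greedy : ∀ r → (∀ M → ∃ λ N → Ramsey r M N) → ∀ k → ∃ λ N →
      ∀ {A : Set} (Q : Vec A (suc r) → Bool) xs → N ≤ length xs → ∃ λ ps → map proj₁ ps ⊆ xs × k ≤ length ps × Greedy Q ps
    greedy r ram zero = 0 , λ Q xs _ → [] , minimum xs , z≤n , []
    greedy r ram (suc k) with greedy r ram k
    ... | K , next with ram K
    ... | N , split = suc N , step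
      where
      step : ∀ {A : Set} (Q : Vec A (suc r) → Bool) xs → suc N ≤ length xs →
        ∃ λ ps → map proj₁ ps ⊆ xs × suc k ≤ length ps × Greedy Q ps
      step Q (x ∷ xs) (s≤s N≤) with split (λ zs → Q (x ∷ zs)) xs N≤
      ... | ys , σ , K≤ , b , h with next Q ys K≤
      ... | ps , τ , k≤ , g = (x , b) ∷ ps , refl ∷ ⊆-trans τ σ , s≤s k≤ , (λ zs ρ → h zs (⊆-trans ρ τ)) ∷ g

  half : ∀ M a b → M + M ≤ a + b → M ≤ a ⊎ M ≤ b
  half M a b p with M ≤? a
  ... | yes q = inj₁ q
  ... | no ¬q = inj₂ (+-cancelˡ-≤ M _ _ (≤-trans p (+-monoˡ-≤ b (<⇒≤ (≰⇒> ¬q)))))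

  ramsey : ∀ r M → ∃ λ N → Ramsey r M N
  ramsey zero M = M , λ Q xs M≤ → xs , ⊆-refl , M≤ , Q [] , λ { [] _ → refl }
  -- Among `M + M` greedy elements one recorded colour occurs `M` times.
  ramsey (suc r) M with greedy r (ramsey r) (M + M)
  ... | N , build = N , choose
    where
    choose : Ramsey (suc r) M N
    choose Q xs N≤ with build Q xs N≤
    ... | ps , σ , 2M≤ , g with half M _ _ (≤-trans 2M≤ (≤-reflexive (sym (coloured-length ps))))
    ... | inj₁ M≤ = coloured true ps , ⊆-trans (coloured-⊆ true ps) σ , M≤ , true , coloured-homogeneous true g
    ... | inj₂ M≤ = coloured false ps , ⊆-trans (coloured-⊆ false ps) σ , M≤ , false , coloured-homogeneous false g

  RamseyFamily : ∀ {I : Set} → List I → ℕ → ℕ → ℕ → Set₁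
  RamseyFamily {I} is r M N = ∀ {A : Set} (Q : I → Vec A r → Bool) xs → N ≤ length xs →
    ∃ λ ys → ys ⊆ xs × M ≤ length ys × (∀ {i} → i ∈ is → Homogeneous (Q i) ys)

  abstract
    -- Families replace multicoloured Ramsey: a colouring by a finite set is handled as the family
    -- of its indicator functions, made homogeneous one after the other.
    ramsey-family : ∀ {I : Set} (is : List I) r M → ∃ λ N → RamseyFamily is r M N
    ramsey-family [] r M = M , λ Q xs M≤ → xs , ⊆-refl , M≤ , λ ()
    ramsey-family {I} (i ∷ is) r M with ramsey-family is r M
    ... | K , rest with ramsey r K
    ... | N , first = N , both
      where
      both : RamseyFamily (i ∷ is) r M N
      both Q xs N≤ with first (Q i) xs N≤
      ... | ys , σ , K≤ , h with rest Q ys K≤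
      ... | zs , τ , M≤ , hs = zs , ⊆-trans τ σ , M≤ , λ { (here refl) → homogeneous-⊆ τ h ; (there j∈) → hs j∈ }

  initial : ∀ {A : Set} n (xs : List A) → n ≤ length xs → ∃ λ (zs : Vec A n) → toList zs ⊆ xs
  initial zero xs _ = [] , minimum xs
  initial (suc n) (x ∷ xs) (s≤s n≤) = let zs , σ = initial n xs n≤ in x ∷ zs , refl ∷ σ

  single-⊆ : ∀ {A : Set} {n} (zs : Vec A n) i → lookup zs i ∷ [] ⊆ toList zs
  single-⊆ (z ∷ zs) zero = refl ∷ minimum _
  single-⊆ (z ∷ zs) (suc i) = z ∷ʳ single-⊆ zs i

  pair-⊆ : ∀ {A : Set} {n} (zs : Vec A n) {i j} → i Fin.< j → lookup zs i ∷ lookup zs j ∷ [] ⊆ toList zs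
  pair-⊆ (z ∷ zs) {zero} {suc j} _ = refl ∷ single-⊆ zs j
  pair-⊆ (z ∷ zs) {suc i} {suc j} (s≤s i<j) = z ∷ʳ pair-⊆ zs i<j

  triple-⊆ : ∀ {A : Set} {n} (zs : Vec A n) {i j k} → i Fin.< j → j Fin.< k →
    lookup zs i ∷ lookup zs j ∷ lookup zs k ∷ [] ⊆ toList zs
  triple-⊆ (z ∷ zs) {zero} {suc j} {suc k} _ (s≤s j<k) = refl ∷ pair-⊆ zs j<k
  triple-⊆ (z ∷ zs) {suc i} {suc j} {suc k} (s≤s i<j) (s≤s j<k) = z ∷ʳ triple-⊆ zs i<j j<k

  allPairs-⊆ : ∀ {A : Set} {R : A → A → Set} {x y xs} → AllPairs R xs → x ∷ y ∷ [] ⊆ xs → R x y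
  allPairs-⊆ (_ ∷ ps) (_ ∷ʳ σ) = allPairs-⊆ ps σ
  allPairs-⊆ (px ∷ _) (refl ∷ σ) with All-resp-⊆ σ px
  ... | p ∷ [] = p

  allFin-sorted : ∀ n → AllPairs Fin._<_ (allFin n)
  allFin-sorted n = tabulate⁺-< (λ i<j → i<j)

  pair-< : ∀ {n} {i j : Fin n} → i ∷ j ∷ [] ⊆ allFin n → i Fin.< j
  pair-< σ = allPairs-⊆ (allFin-sorted _) σ

-- Vertices whose ratings add up to the mean in every triad.

module LevelSelection where

  open import Defs using (∑)
  open Sums
  open RamseyTheory
  open import Data.Nat
  open import Data.Nat.Properties
  open import Data.Nat.Tactic.RingSolver using (solve-∀)
  open import Data.Fin as Fin using (Fin; zero; suc; toℕ; fromℕ<)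
  import Data.Fin.Properties as FinP
  open import Data.Bool using (Bool; true)
  open import Data.List using (List; []; _∷_; length; _++_; allFin; filter; cartesianProduct)
  open import Data.List.Properties using (filter-all; filter-none; filter-accept; filter-reject; length-tabulate)
  open import Data.List.Membership.Propositional using (_∈_)
  open import Data.List.Membership.Propositional.Properties using (∈-cartesianProduct⁺; ∈-allFin)
  open import Data.List.Relation.Unary.Any using (here; there)
  open import Data.List.Relation.Unary.All as All using (All; []; _∷_)
  open import Data.List.Relation.Unary.All.Properties using (all-filter)
  open import Data.List.Relation.Binary.Sublist.Propositional using (_⊆_; _∷_; ⊆-refl; ⊆-trans; minimum)
  open import Data.List.Relation.Binary.Sublist.Propositional.Properties using (All-resp-⊆; ++⁺; ++⁺ˡ; filter-⊆)
  open import Data.Vec using (Vec; []; _∷_; toList; lookup)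
  open import Data.Product using (Σ; ∃; _×_; _,_; proj₁; proj₂)
  open import Data.Product.Properties using (≡-dec)
  open import Data.Empty using (⊥-elim)
  open import Relation.Nullary using (Dec; yes; no; does; _×-dec_; _→-dec_)
  open import Relation.Nullary.Decidable using (dec-true)
  open import Relation.Binary.PropositionalEquality

  sumOn : ∀ {A : Set} → (A → ℕ) → List A → ℕ
  sumOn f [] = 0
  sumOn f (x ∷ xs) = f x + sumOn f xs

  ∑-sumOn : ∀ {A : Set} m c (f : A → Fin m → ℕ) us → (∀ u → m * c ≤ ∑ m (f u)) →
    m * (length us * c) ≤ ∑ m (λ v → sumOn (λ u → f u v) us)
  ∑-sumOn m c f [] p = ≤-trans (≤-reflexive (*-zeroʳ m)) z≤n
  ∑-sumOn m c f (u ∷ us) p = begin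
    m * (c + length us * c)                       ≡⟨ *-distribˡ-+ m c _ ⟩
    m * c + m * (length us * c)                   ≤⟨ +-mono-≤ (p u) (∑-sumOn m c f us p) ⟩
    ∑ m (f u) + ∑ m (λ v → sumOn (λ u → f u v) us) ≡⟨ sym (∑-distrib-+ m (f u) _) ⟩
    ∑ m (λ v → f u v + sumOn (λ u → f u v) us)    ∎
    where open ≤-Reasoning

  above : ∀ {A : Set} → ℕ → (A → ℕ) → List A → List A
  above g f = filter (λ u → g ≤? f u)

  sumOn≤ : ∀ {A : Set} Λ g (f : A → ℕ) → (∀ u → f u ≤ Λ) → ∀ us →
    sumOn f us ≤ length us * g + length (above (suc g) f us) * Λ
  sumOn≤ Λ g f f≤Λ [] = z≤n
  sumOn≤ Λ g f f≤Λ (u ∷ us) = step (suc g ≤? f u)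
    where
    step : Dec (suc g ≤ f u) → f u + sumOn f us ≤ g + length us * g + length (above (suc g) f (u ∷ us)) * Λ
    step (yes p) rewrite filter-accept (λ u → suc g ≤? f u) {x = u} {xs = us} p =
      ≤-trans (+-mono-≤ (f≤Λ u) (sumOn≤ Λ g f f≤Λ us))
        (≤-trans (m≤n+m _ g) (≤-reflexive (regroup Λ g (length us * g) (length (above (suc g) f us) * Λ))))
      where
      regroup : ∀ Λ g a b → g + (Λ + (a + b)) ≡ g + a + (Λ + b)
      regroup = solve-∀
    step (no ≰) rewrite filter-reject (λ u → suc g ≤? f u) {x = u} {xs = us} ≰ =
      ≤-trans (+-mono-≤ (s≤s⁻¹ (≰⇒> ≰)) (sumOn≤ Λ g f f≤Λ us)) (≤-reflexive (sym (+-assoc g _ _)))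

  -- Turns a large sum into a level attained often: `g` is the highest level that at least `n`
  -- elements reach. At most `n` elements exceed it, and they add at most `n * Λ`.
  popular-level : ∀ {A : Set} n Λ (f : A → ℕ) → (∀ u → f u ≤ Λ) → ∀ us → n ≤ length us →
    ∃ λ (g : Fin (suc Λ)) → n ≤ length (above (toℕ g) f us) × sumOn f us ≤ length us * toℕ g + n * Λ
  popular-level n Λ f f≤Λ us n≤ = search Λ ≤-refl
    (≤-trans (≤-reflexive (cong length (filter-none (λ u → suc Λ ≤? f u) {us} (All.tabulate λ {u} _ p → <⇒≱ p (f≤Λ u))))) z≤n)
    where
    search : ∀ g → g ≤ Λ → length (above (suc g) f us) ≤ n →
      ∃ λ (g : Fin (suc Λ)) → n ≤ length (above (toℕ g) f us) × sumOn f us ≤ length us * toℕ g + n * Λ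
    search g g≤Λ few with n ≤? length (above g f us)
    ... | yes many = fromℕ< (s≤s g≤Λ) ,
      subst (λ h → n ≤ length (above h f us) × sumOn f us ≤ length us * h + n * Λ) (sym (FinP.toℕ-fromℕ< (s≤s g≤Λ)))
        (many , ≤-trans (sumOn≤ Λ g f f≤Λ us) (+-monoʳ-≤ _ (*-monoˡ-≤ Λ few)))
    search zero g≤Λ few | no ≰ =
      ⊥-elim (≰ (≤-trans n≤ (≤-reflexive (cong length (sym (filter-all (λ u → 0 ≤? f u) {us} (All.tabulate λ _ → z≤n)))))))
    search (suc g) g≤Λ few | no ≰ = search g (≤-trans (n≤1+n g) g≤Λ) (<⇒≤ (≰⇒> ≰))

  split-at : ∀ {A : Set} k e (xs : List A) → k + suc e ≤ length xs →
    ∃ λ as → ∃ λ x → ∃ λ bs → xs ≡ as ++ x ∷ bs × length as ≡ k × e ≤ length bs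
  split-at zero e (x ∷ xs) (s≤s e≤) = [] , x , xs , refl , refl , e≤
  split-at (suc k) e (x ∷ xs) (s≤s k≤) with split-at k e xs k≤
  ... | as , y , bs , refl , refl , e≤ = x ∷ as , y , bs , refl , refl , e≤

  initial-list : ∀ {A : Set} k (xs : List A) → k ≤ length xs → ∃ λ as → as ⊆ xs × length as ≡ k
  initial-list zero xs _ = [] , minimum xs , refl
  initial-list (suc k) (x ∷ xs) (s≤s k≤) with initial-list k xs k≤
  ... | as , σ , refl = x ∷ as , refl ∷ σ , refl

  module _ {A : Set} where

    one-position : ∀ {n} (q : Fin n) (J K : A → Set) js y ks → All J js → All K ks → n ≤ length js → n ≤ length ks →
      ∃ λ (zs : Vec A n) → toList zs ⊆ js ++ y ∷ ks × lookup zs q ≡ y ×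
        (∀ u → u Fin.< q → J (lookup zs u)) × (∀ u → q Fin.< u → K (lookup zs u))
    one-position {suc n} zero J K js y ks pj pk nj nk with initial n ks (≤-trans (n≤1+n n) nk)
    ... | zs , σ = y ∷ zs , ++⁺ˡ js (refl ∷ σ) , refl , (λ _ ()) ,
      λ { (suc u) _ → All.lookup (All-resp-⊆ σ pk) (∈-toList u zs) }
      where
      ∈-toList : ∀ {n} (u : Fin n) (zs : Vec A n) → lookup zs u ∈ toList zs
      ∈-toList zero (z ∷ zs) = here refl
      ∈-toList (suc u) (z ∷ zs) = there (∈-toList u zs)
    one-position {suc n} (suc q) J K (j ∷ js) y ks (p ∷ pj) pk (s≤s nj) nk
      with one-position q J K js y ks pj pk nj (≤-trans (n≤1+n n) nk)
    ... | zs , σ , at , before , after = j ∷ zs , refl ∷ σ , at ,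
      (λ { zero _ → p ; (suc u) (s≤s lt) → before u lt }) , (λ { (suc u) (s≤s lt) → after u lt })

    -- Makes one `n`-tuple out of a pair `x`, `y` and the pools before, between and after it. Pools
    -- of size `n` suffice wherever `p` and `q` are.
    two-positions : ∀ {n} (p q : Fin n) → p Fin.< q → (H J K : A → Set) → ∀ hs x js y ks →
      All H hs → All J js → All K ks → n ≤ length hs → n ≤ length js → n ≤ length ks →
      ∃ λ (zs : Vec A n) → toList zs ⊆ hs ++ x ∷ (js ++ y ∷ ks) × lookup zs p ≡ x × lookup zs q ≡ y ×
        (∀ u → u Fin.< p → H (lookup zs u)) ×
        (∀ u → p Fin.< u → u Fin.< q → J (lookup zs u)) × (∀ u → q Fin.< u → K (lookup zs u))
    two-positions {suc n} zero (suc q) _ H J K hs x js y ks ph pj pk nh nj nk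
      with one-position q J K js y ks pj pk (≤-trans (n≤1+n n) nj) (≤-trans (n≤1+n n) nk)
    ... | zs , σ , at , before , after = x ∷ zs , ++⁺ˡ hs (refl ∷ σ) , refl , at , (λ _ ()) ,
      (λ { (suc u) _ (s≤s lt) → before u lt }) , (λ { (suc u) (s≤s lt) → after u lt })
    two-positions {suc n} (suc p) (suc q) (s≤s p<q) H J K (h ∷ hs) x js y ks (ph ∷ phs) pj pk (s≤s nh) nj nk
      with two-positions p q p<q H J K hs x js y ks phs pj pk nh (≤-trans (n≤1+n n) nj) (≤-trans (n≤1+n n) nk)
    ... | zs , σ , at , at′ , before , between , after = h ∷ zs , refl ∷ σ , at , at′ ,
      (λ { zero _ → ph ; (suc u) (s≤s lt) → before u lt }) ,
      (λ { (suc u) (s≤s lt) (s≤s lt′) → between u lt lt′ }) , (λ { (suc u) (s≤s lt) → after u lt })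

  -- fL, fR and fT rate a vertex as the left, right and top vertex of a triad.
  record Levels (A : Set) (Λ β : ℕ) : Set where
    field
      s : A → A → ℕ
    V : A → A → Set
    V x y = Fin (suc (s x y))
    field
      fL : ∀ (i j k : A) → V i j → ℕ
      fR : ∀ (i j k : A) → V j k → ℕ
      fT : ∀ (i j k : A) → V i k → ℕ
      fL≤ : ∀ (i j k : A) v → fL i j k v ≤ Λ
      fR≤ : ∀ (i j k : A) v → fR i j k v ≤ Λ
      fT≤ : ∀ (i j k : A) v → fT i j k v ≤ Λ
      fL-mean : ∀ (i j k : A) → suc (s i j) * β ≤ ∑ (suc (s i j)) (fL i j k)
      fR-mean : ∀ (i j k : A) → suc (s j k) * β ≤ ∑ (suc (s j k)) (fR i j k)
      fT-mean : ∀ (i j k : A) → suc (s i k) * β ≤ ∑ (suc (s i k)) (fT i j k)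

  module Selection (Λ β : ℕ) where

    Θ : Set
    Θ = Fin (suc Λ) × Fin (suc Λ) × Fin (suc Λ)

    Θs : List Θ
    Θs = cartesianProduct (allFin (suc Λ)) (cartesianProduct (allFin (suc Λ)) (allFin (suc Λ)))

    ∈-Θs : ∀ θ → θ ∈ Θs
    ∈-Θs (g , h , k) = ∈-cartesianProduct⁺ (∈-allFin g) (∈-cartesianProduct⁺ (∈-allFin h) (∈-allFin k))

    _≟Θ_ : (θ θ′ : Θ) → Dec (θ ≡ θ′)
    _≟Θ_ = ≡-dec FinP._≟_ (≡-dec FinP._≟_ FinP._≟_)

    Sufficient : Θ → Set
    Sufficient (g , h , k) = 3 * β ≤ toℕ g + toℕ h + toℕ k

    module _ {A : Set} (lev : Levels A Λ β) where
      open Levels lev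

      -- The third index decides the role of the part between `x` and `y`: right if it comes first,
      -- top if it lies between, left if it comes last. The components of a profile are in this
      -- order.
      Good : ∀ {n} → Fin n → Fin n → Θ → (zs : Vec A n) → ∀ x y → V x y → Set
      Good p q (g , h , k) zs x y v = ∀ u →
        (u Fin.< p → toℕ g ≤ fR (lookup zs u) x y v) ×
        (p Fin.< u → u Fin.< q → toℕ h ≤ fT x (lookup zs u) y v) ×
        (q Fin.< u → toℕ k ≤ fL x y (lookup zs u) v)

      good? : ∀ {n} (p q : Fin n) θ zs → Dec (∃ (Good p q θ zs (lookup zs p) (lookup zs q)))
      good? p q (g , h , k) zs = FinP.any? λ v → FinP.all? λ u →
        ((u FinP.<? p) →-dec (toℕ g ≤? _)) ×-dec
        (((p FinP.<? u) →-dec ((u FinP.<? q) →-dec (toℕ h ≤? _))) ×-dec ((q FinP.<? u) →-dec (toℕ k ≤? _)))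

      transport : ∀ {n} {p q : Fin n} {θ zs x y} → lookup zs p ≡ x → lookup zs q ≡ y →
        ∃ (Good p q θ zs x y) → ∃ (Good p q θ zs (lookup zs p) (lookup zs q))
      transport refl refl good = good

      module _ (x y : A) (K : ℕ) (hs js ks : List A) (lh : length hs ≡ K) (lj : length js ≡ K) (lk : length ks ≡ K) where

        total-level : V x y → ℕ
        total-level v = sumOn (λ u → fR u x y v) hs + sumOn (λ u → fT x u y v) js + sumOn (λ u → fL x y u v) ks

        -- The three roles are averaged together, so the vertex may be poor in one of them and
        -- compensate in another.
        average-vertex : ∃ λ v → K * β + K * β + K * β ≤ total-level v
        average-vertex = ∑-pigeonhole (s x y) total-level (K * β + K * β + K * β) (begin
          N * (K * β + K * β + K * β) ≡⟨ expand N (K * β) ⟩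
          N * (K * β) + N * (K * β) + N * (K * β)
            ≤⟨ +-mono-≤ (+-mono-≤ (part lh (∑-sumOn N β (λ u → fR u x y) hs (λ u → fR-mean u x y)))
                                  (part lj (∑-sumOn N β (λ u → fT x u y) js (λ u → fT-mean x u y))))
                        (part lk (∑-sumOn N β (λ u → fL x y u) ks (λ u → fL-mean x y u))) ⟩
          ∑ N f₁ + ∑ N f₂ + ∑ N f₃
            ≡⟨ sym (trans (∑-distrib-+ N (λ v → f₁ v + f₂ v) f₃) (cong (_+ ∑ N f₃) (∑-distrib-+ N f₁ f₂))) ⟩
          ∑ N total-level ∎)
          where
          open ≤-Reasoning
          N : ℕ
          N = suc (s x y)
          f₁ f₂ f₃ : V x y → ℕ
          f₁ v = sumOn (λ u → fR u x y v) hs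
          f₂ v = sumOn (λ u → fT x u y v) js
          f₃ v = sumOn (λ u → fL x y u v) ks
          expand : ∀ N t → N * (t + t + t) ≡ N * t + N * t + N * t
          expand = solve-∀
          part : ∀ {k t} → k ≡ K → N * (k * β) ≤ t → N * (K * β) ≤ t
          part refl p = p

        popular-levels : ∀ n → n ≤ K → 3 * (n * Λ) < K → ∃ λ v → ∃ λ (g : Fin (suc Λ)) → ∃ λ (h : Fin (suc Λ)) → ∃ λ (k : Fin (suc Λ)) → Sufficient (g , h , k) ×
          n ≤ length (above (toℕ g) (λ u → fR u x y v) hs) ×
          n ≤ length (above (toℕ h) (λ u → fT x u y v) js) ×
          n ≤ length (above (toℕ k) (λ u → fL x y u v) ks)
        popular-levels n n≤K small with average-vertex
        ... | v , v-large
          with popular-level n Λ (λ u → fR u x y v) (λ u → fR≤ u x y v) hs (≤-trans n≤K (≤-reflexive (sym lh)))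
             | popular-level n Λ (λ u → fT x u y v) (λ u → fT≤ x u y v) js (≤-trans n≤K (≤-reflexive (sym lj)))
             | popular-level n Λ (λ u → fL x y u v) (λ u → fL≤ x y u v) ks (≤-trans n≤K (≤-reflexive (sym lk)))
        ... | g , g-many , g-bound | h , h-many , h-bound | k , k-many , k-bound =
          -- The error `3 * (n * Λ)` is smaller than `K`, so it disappears on division by `K`.
          v , g , h , k , s≤s⁻¹ (*-cancelˡ-< K _ _ (begin-strict
            K * (3 * β)                     ≡⟨ expand K β ⟩
            K * β + K * β + K * β           ≤⟨ v-large ⟩
            total-level v                   ≤⟨ +-mono-≤ (+-mono-≤ (bound lh g-bound) (bound lj h-bound)) (bound lk k-bound) ⟩
            K * toℕ g + n * Λ + (K * toℕ h + n * Λ) + (K * toℕ k + n * Λ)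
                                            ≡⟨ collect K (toℕ g) (toℕ h) (toℕ k) (n * Λ) ⟩
            K * (toℕ g + toℕ h + toℕ k) + 3 * (n * Λ)
                                            <⟨ +-monoʳ-< (K * (toℕ g + toℕ h + toℕ k)) small ⟩
            K * (toℕ g + toℕ h + toℕ k) + K ≡⟨ trans (+-comm _ K) (sym (*-suc K _)) ⟩
            K * suc (toℕ g + toℕ h + toℕ k) ∎)) , g-many , h-many , k-many
          where
          open ≤-Reasoning
          expand : ∀ K β → K * (3 * β) ≡ K * β + K * β + K * β
          expand = solve-∀
          collect : ∀ K g h k t → K * g + t + (K * h + t) + (K * k + t) ≡ K * (g + h + k) + 3 * t
          collect = solve-∀
          bound : ∀ {len t g} → len ≡ K → t ≤ len * g + n * Λ → t ≤ K * g + n * Λ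
          bound refl p = p

      assemble : ∀ {n} (p q : Fin n) → p Fin.< q → ∀ {x y K hs js ks ys} → n ≤ K → 3 * (n * Λ) < K →
        length hs ≡ K → length js ≡ K → length ks ≡ K → ks ⊆ ys →
        ∃ λ θ → Sufficient θ × ∃ λ zs → toList zs ⊆ hs ++ x ∷ (js ++ y ∷ ys) × ∃ (Good p q θ zs (lookup zs p) (lookup zs q))
      assemble {n} p q p<q {x} {y} {K} {hs} {js} {ks} {ys} n≤K small lh lj lk τ =
        from-levels (popular-levels x y K hs js ks lh lj lk n n≤K small)
        where
        Result : Set
        Result = ∃ λ θ → Sufficient θ × ∃ λ zs → toList zs ⊆ hs ++ x ∷ (js ++ y ∷ ys) × ∃ (Good p q θ zs (lookup zs p) (lookup zs q))
        module _ (v : V x y) (g h k : Fin (suc Λ)) (sufficient : Sufficient (g , h , k)) where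
          hs′ js′ ks′ : List A
          hs′ = above (toℕ g) (λ u → fR u x y v) hs
          js′ = above (toℕ h) (λ u → fT x u y v) js
          ks′ = above (toℕ k) (λ u → fL x y u v) ks
          from-vector : (∃ λ (zs : Vec A n) → toList zs ⊆ hs′ ++ x ∷ (js′ ++ y ∷ ks′) × lookup zs p ≡ x × lookup zs q ≡ y ×
            (∀ u → u Fin.< p → toℕ g ≤ fR (lookup zs u) x y v) ×
            (∀ u → p Fin.< u → u Fin.< q → toℕ h ≤ fT x (lookup zs u) y v) ×
            (∀ u → q Fin.< u → toℕ k ≤ fL x y (lookup zs u) v)) → Result
          from-vector (zs , σ , at , at′ , before , between , after) = (g , h , k) , sufficient , zs ,
            ⊆-trans σ (++⁺ (filter-⊆ (λ u → toℕ g ≤? fR u x y v) hs) (refl ∷ ++⁺ (filter-⊆ (λ u → toℕ h ≤? fT x u y v) js)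
              (refl ∷ ⊆-trans (filter-⊆ (λ u → toℕ k ≤? fL x y u v) ks) τ))) ,
            transport {θ = g , h , k} {zs = zs} at at′ (v , λ u → before u , between u , after u)
          vector : n ≤ length hs′ → n ≤ length js′ → n ≤ length ks′ → Result
          vector hn jn kn = from-vector (two-positions p q p<q
            (λ u → toℕ g ≤ fR u x y v) (λ u → toℕ h ≤ fT x u y v) (λ u → toℕ k ≤ fL x y u v) hs′ x js′ y ks′
            (all-filter (λ u → toℕ g ≤? fR u x y v) hs) (all-filter (λ u → toℕ h ≤? fT x u y v) js)
            (all-filter (λ u → toℕ k ≤? fL x y u v) ks) hn jn kn)
        from-levels : _ → Result
        from-levels (v , g , h , k , sufficient , hn , jn , kn) = vector v g h k sufficient hn jn kn

      find-good : ∀ {n} (p q : Fin n) → p Fin.< q → ∀ K → n ≤ K → 3 * (n * Λ) < K → ∀ ys → K + suc (K + suc K) ≤ length ys →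
        ∃ λ θ → Sufficient θ × ∃ λ zs → toList zs ⊆ ys × ∃ (Good p q θ zs (lookup zs p) (lookup zs q))
      find-good {n} p q p<q K n≤K small ys long with split-at K (K + suc K) ys long
      ... | hs , x , ys₁ , refl , lh , long₁ with split-at K K ys₁ long₁
      ... | js , y , ys₂ , refl , lj , long₂ with initial-list K ys₂ long₂
      ... | ks , τ , lk = assemble p q p<q n≤K small lh lj lk τ

    indices : ∀ n′ → List (Fin n′ × Fin n′ × Θ)
    indices n′ = cartesianProduct (allFin n′) (cartesianProduct (allFin n′) Θs)

    module Chosen (n n′ K N : ℕ) (n′≤K : n′ ≤ K) (small : 3 * (n′ * Λ) < K)
      (ramsey-pairs : RamseyFamily Θs 2 (2 + n) n′) (ramsey-tuples : RamseyFamily (indices n′) n′ (K + suc (K + suc K)) N)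
      {A : Set} (lev : Levels A Λ β) (xs : List A) (N≤ : N ≤ length xs) where
        open Levels lev

        goodness : Fin n′ × Fin n′ × Θ → Vec A n′ → Bool
        goodness (p , q , θ) zs = does (good? lev p q θ zs)

        private
          homogeneous = ramsey-tuples goodness xs N≤

        ys : List A
        ys = proj₁ homogeneous

        ys⊆xs : ys ⊆ xs
        ys⊆xs = proj₁ (proj₂ homogeneous)

        ys-long : K + suc (K + suc K) ≤ length ys
        ys-long = proj₁ (proj₂ (proj₂ homogeneous))

        -- For each pair of positions `find-good` produces a tuple of its own. Homogeneity carries
        -- the existence of a good vertex over to the single tuple `zs₀`, which then serves all
        -- pairs; the vertex itself may change.
        good-transfer : ∀ p q θ zs → toList zs ⊆ ys → ∃ (Good lev p q θ zs (lookup zs p) (lookup zs q)) →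
          ∀ zs′ → toList zs′ ⊆ ys → ∃ (Good lev p q θ zs′ (lookup zs′ p) (lookup zs′ q))
        good-transfer p q θ zs σ good zs′ σ′ = witness (good? lev p q θ zs′) (begin
          goodness (p , q , θ) zs′ ≡⟨ proj₂ h zs′ σ′ ⟩
          proj₁ h                  ≡⟨ sym (proj₂ h zs σ) ⟩
          goodness (p , q , θ) zs  ≡⟨ dec-true (good? lev p q θ zs) good ⟩
          true                     ∎)
          where
          open ≡-Reasoning
          h : Homogeneous (goodness (p , q , θ)) ys
          h = proj₂ (proj₂ (proj₂ homogeneous)) (∈-cartesianProduct⁺ (∈-allFin p) (∈-cartesianProduct⁺ (∈-allFin q) (∈-Θs θ)))
          witness : ∀ {P : Set} (d : Dec P) → does d ≡ true → P
          witness (yes p) _ = p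

        zs₀ : Vec A n′
        zs₀ = proj₁ (initial n′ ys (≤-trans (≤-trans n′≤K (m≤m+n K _)) ys-long))

        zs₀⊆ys : toList zs₀ ⊆ ys
        zs₀⊆ys = proj₂ (initial n′ ys (≤-trans (≤-trans n′≤K (m≤m+n K _)) ys-long))

        Choice : Fin n′ → Fin n′ → Set
        Choice p q = Σ Θ λ θ → Σ (V (lookup zs₀ p) (lookup zs₀ q)) λ v →
          p Fin.< q → Sufficient θ × Good lev p q θ zs₀ (lookup zs₀ p) (lookup zs₀ q) v

        choose : ∀ p q → Choice p q
        choose p q with p FinP.<? q
        -- An arbitrary profile and vertex; nothing is claimed about them unless `p < q`.
        ... | no p≮q = (zero , zero , zero) , zero , λ p<q → ⊥-elim (p≮q p<q)
        ... | yes p<q = from-good (find-good lev p q p<q K n′≤K small ys ys-long)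
          where
          from-good : (∃ λ θ → Sufficient θ × ∃ λ zs → toList zs ⊆ ys × ∃ (Good lev p q θ zs (lookup zs p) (lookup zs q))) → Choice p q
          from-good (θ , sufficient , zs , σ , good) with good-transfer p q θ zs σ good zs₀ zs₀⊆ys
          ... | v , good′ = θ , v , λ _ → sufficient , good′

        colour : Θ → Vec (Fin n′) 2 → Bool
        colour θ (p ∷ q ∷ []) = does (proj₁ (choose p q) ≟Θ θ)

        private
          monochromatic = ramsey-pairs colour (allFin n′) (≤-reflexive (sym (length-tabulate (λ i → i))))

        ps : List (Fin n′)
        ps = proj₁ monochromatic

        ps⊆ : ps ⊆ allFin n′
        ps⊆ = proj₁ (proj₂ monochromatic)

        -- The indicator of the profile of the first pair is constant on all pairs and true on that
        -- one. The `2 +` in `2 + n` guarantees a first pair even for small `n`.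
        common-level : ∀ qs → qs ⊆ ps → 2 + n ≤ length qs → Σ Θ λ θ → ∀ {p q} → p ∷ q ∷ [] ⊆ ps → proj₁ (choose p q) ≡ θ
        common-level (p₀ ∷ q₀ ∷ qs) σ _ = θ₀ , λ {p} {q} τ → decode p q (begin
          colour θ₀ (p ∷ q ∷ [])   ≡⟨ proj₂ h (p ∷ q ∷ []) τ ⟩
          proj₁ h                  ≡⟨ sym (proj₂ h (p₀ ∷ q₀ ∷ []) (⊆-trans (refl ∷ refl ∷ minimum qs) σ)) ⟩
          colour θ₀ (p₀ ∷ q₀ ∷ []) ≡⟨ dec-true (θ₀ ≟Θ θ₀) refl ⟩
          true                     ∎)
          where
          open ≡-Reasoning
          θ₀ : Θ
          θ₀ = proj₁ (choose p₀ q₀)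
          h : Homogeneous (colour θ₀) ps
          h = proj₂ (proj₂ (proj₂ monochromatic)) (∈-Θs θ₀)
          decode : ∀ p q → colour θ₀ (p ∷ q ∷ []) ≡ true → proj₁ (choose p q) ≡ θ₀
          decode p q eq with proj₁ (choose p q) ≟Θ θ₀
          ... | yes r = r
        common-level (p₀ ∷ []) σ (s≤s ())

        ws : Vec (Fin n′) n
        ws = proj₁ (initial n ps (≤-trans (m≤n+m n 2) (proj₁ (proj₂ (proj₂ monochromatic)))))

        ws⊆ps : toList ws ⊆ ps
        ws⊆ps = proj₂ (initial n ps (≤-trans (m≤n+m n 2) (proj₁ (proj₂ (proj₂ monochromatic)))))

        w : Fin n → Fin n′
        w = lookup ws

        w-mono : ∀ {i j} → i Fin.< j → w i Fin.< w j
        w-mono i<j = pair-< (⊆-trans (pair-⊆ ws i<j) (⊆-trans ws⊆ps ps⊆))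

        z : Fin n → A
        z i = lookup zs₀ (w i)

        vertex : ∀ i j → V (z i) (z j)
        vertex i j = proj₁ (proj₂ (choose (w i) (w j)))

        -- The vertices of a triad contribute one component each, as left, right and top vertex, of
        -- the same profile, and that profile is `Sufficient`.
        selected : ∀ {i j k} → i Fin.< j → j Fin.< k →
          3 * β ≤ fL (z i) (z j) (z k) (vertex i j) + fR (z i) (z j) (z k) (vertex j k) + fT (z i) (z j) (z k) (vertex i k)
        selected {i} {j} {k} i<j j<k =
          bound (proj₁ common) (proj₂ common (⊆-trans (pair-⊆ ws i<j) ws⊆ps)) (proj₂ common (⊆-trans (pair-⊆ ws j<k) ws⊆ps))
            (proj₂ common (⊆-trans (pair-⊆ ws i<k) ws⊆ps))
            (proj₂ (proj₂ (choose (w i) (w j))) (w-mono i<j)) (proj₂ (proj₂ (choose (w j) (w k))) (w-mono j<k))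
            (proj₂ (proj₂ (choose (w i) (w k))) (w-mono i<k))
          where
          i<k : i Fin.< k
          i<k = <-trans i<j j<k
          common = common-level ps ⊆-refl (proj₁ (proj₂ (proj₂ monochromatic)))
          bound : ∀ θ {θ₁ θ₂ θ₃} → θ₁ ≡ θ → θ₂ ≡ θ → θ₃ ≡ θ →
            Sufficient θ₁ × Good lev (w i) (w j) θ₁ zs₀ (z i) (z j) (vertex i j) →
            Sufficient θ₂ × Good lev (w j) (w k) θ₂ zs₀ (z j) (z k) (vertex j k) →
            Sufficient θ₃ × Good lev (w i) (w k) θ₃ zs₀ (z i) (z k) (vertex i k) →
            3 * β ≤ fL (z i) (z j) (z k) (vertex i j) + fR (z i) (z j) (z k) (vertex j k) + fT (z i) (z j) (z k) (vertex i k)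
          bound (g , h , l) refl refl refl (sufficient , good₁) (_ , good₂) (_ , good₃) = begin
            3 * β                 ≤⟨ sufficient ⟩
            toℕ g + toℕ h + toℕ l ≡⟨ rotate (toℕ g) (toℕ h) (toℕ l) ⟩
            toℕ l + toℕ g + toℕ h ≤⟨ +-mono-≤ (+-mono-≤ (proj₂ (proj₂ (good₁ (w k))) (w-mono j<k)) (proj₁ (good₂ (w i)) (w-mono i<j)))
                                              (proj₁ (proj₂ (good₃ (w j))) (w-mono i<j) (w-mono j<k)) ⟩
            _                     ∎
            where
            open ≤-Reasoning
            rotate : ∀ a b c → a + b + c ≡ c + a + b
            rotate = solve-∀

    abstract
      select : ∀ n → ∃ λ N → ∀ {A : Set} (lev : Levels A Λ β) xs → N ≤ length xs → let open Levels lev in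
        Σ (Fin n → A) λ z → (∀ {i j} → i Fin.< j → z i ∷ z j ∷ [] ⊆ xs) × Σ (∀ i j → V (z i) (z j)) λ v →
          ∀ {i j k} → i Fin.< j → j Fin.< k →
            3 * β ≤ fL (z i) (z j) (z k) (v i j) + fR (z i) (z j) (z k) (v j k) + fT (z i) (z j) (z k) (v i k)
      select n with ramsey-family Θs 2 (2 + n)
      -- `K` has to exceed the error `3 * (n′ * Λ)` and to be at least the tuple length `n′`; only
      -- these two facts about it are kept.
      ... | n′ , ramsey-pairs with suc (3 * (n′ * Λ)) + n′ | m≤n+m n′ (suc (3 * (n′ * Λ))) | m≤m+n (suc (3 * (n′ * Λ))) n′
      ... | K | n′≤K | small with ramsey-family (indices n′) n′ (K + suc (K + suc K))
      ... | N , ramsey-tuples = N , λ lev xs N≤ →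
        let module S = Chosen n n′ K N n′≤K small ramsey-pairs ramsey-tuples lev xs N≤ in
        S.z , (λ i<j → ⊆-trans (pair-⊆ S.zs₀ (S.w-mono i<j)) (⊆-trans S.zs₀⊆ys S.ys⊆xs)) , S.vertex , S.selected

-- Configurations in dense palettes.

module Palettes where

  open import Defs using (∑)
  open Sums
  open Certificates
  open import Data.Nat hiding (_≟_)
  open import Data.Nat.Properties hiding (_≟_)
  open import Data.Nat.Tactic.RingSolver using (solve-∀)
  import Data.Integer as ℤ
  import Data.Integer.Properties as ℤP
  import Data.Integer.Tactic.RingSolver as ℤSolver
  open import Data.Fin using (Fin; zero; suc; punchIn)
  open import Data.Fin.Properties using (any?)
  open import Data.Bool using (Bool; true; false; not; _∧_; _≟_)
  open import Data.Product using (∃; _×_; _,_; proj₁; proj₂)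
  open import Data.Sum using (_⊎_; inj₁; inj₂; [_,_]′)
  open import Data.Empty using (⊥; ⊥-elim)
  open import Function using (_∘_)
  open import Relation.Nullary using (Dec; yes; no; does; ¬_; _×-dec_; _⊎-dec_)
  open import Relation.Binary.PropositionalEquality

  Palette : ℕ → Set
  Palette m = Fin m → Fin m → Fin m → Bool

  module _ {m : ℕ} (P : Palette m) where

    -- Realised in a hypergraph, the first four give the alternatives (1), (2), (3) and (4).
    Right-Edge Left-Edge Back-Edge Cross-Edge Configuration : Set
    Right-Edge = ∃ λ a → ∃ λ u → ∃ λ g → ∃ λ b → ∃ λ v → ∃ λ h →
      P a u g ≡ true × P b v g ≡ true × P u v h ≡ true
    Left-Edge = ∃ λ u → ∃ λ a → ∃ λ g → ∃ λ v → ∃ λ b → ∃ λ h →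
      P u a g ≡ true × P v b g ≡ true × P u v h ≡ true
    Back-Edge = ∃ λ a → ∃ λ u → ∃ λ g → ∃ λ v → ∃ λ b → ∃ λ h →
      P a u g ≡ true × P v b g ≡ true × P u v h ≡ true
    Cross-Edge = ∃ λ u → ∃ λ q → ∃ λ g → ∃ λ p → ∃ λ w → ∃ λ α → ∃ λ y → ∃ λ x → ∃ λ β → ∃ λ h →
      P u q g ≡ true × P p w g ≡ true × P α y w ≡ true × P x β u ≡ true × P α β h ≡ true
    Configuration = Right-Edge ⊎ Left-Edge ⊎ Back-Edge ⊎ Cross-Edge

    configuration? : Dec Configuration
    configuration? =
      (any? λ a → any? λ u → any? λ g → any? λ b → any? λ v → any? λ h →
        (P a u g ≟ true) ×-dec (P b v g ≟ true) ×-dec (P u v h ≟ true)) ⊎-dec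
      (any? λ u → any? λ a → any? λ g → any? λ v → any? λ b → any? λ h →
        (P u a g ≟ true) ×-dec (P v b g ≟ true) ×-dec (P u v h ≟ true)) ⊎-dec
      (any? λ a → any? λ u → any? λ g → any? λ v → any? λ b → any? λ h →
        (P a u g ≟ true) ×-dec (P v b g ≟ true) ×-dec (P u v h ≟ true)) ⊎-dec
      (any? λ u → any? λ q → any? λ g → any? λ p → any? λ w → any? λ α → any? λ y → any? λ x → any? λ β → any? λ h →
        (P u q g ≟ true) ×-dec (P p w g ≟ true) ×-dec (P α y w ≟ true) ×-dec (P x β u ≟ true) ×-dec (P α β h ≟ true))

    -- Call `x y` joined if they have a top. Then no two right neighbours of `g` are joined, nor two
    -- left neighbours, nor a right neighbour to a left one. If `u` and `w` are a left and a right
    -- neighbour of `g`, no left neighbour of `w` is joined to a right neighbour of `u`.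
    record Free : Set where
      field
        no-right : ∀ {a u g b v h} → P a u g ≡ true → P b v g ≡ true → P u v h ≡ true → ⊥
        no-left  : ∀ {u a g v b h} → P u a g ≡ true → P v b g ≡ true → P u v h ≡ true → ⊥
        no-back  : ∀ {a u g v b h} → P a u g ≡ true → P v b g ≡ true → P u v h ≡ true → ⊥
        no-cross : ∀ {u q g p w α y x β h} →
          P u q g ≡ true → P p w g ≡ true → P α y w ≡ true → P x β u ≡ true → P α β h ≡ true → ⊥

    free : ¬ Configuration → Free
    free none = record
      { no-right = λ p q r → none (inj₁ (_ , _ , _ , _ , _ , _ , p , q , r))
      ; no-left  = λ p q r → none (inj₂ (inj₁ (_ , _ , _ , _ , _ , _ , p , q , r)))
      ; no-back  = λ p q r → none (inj₂ (inj₂ (inj₁ (_ , _ , _ , _ , _ , _ , p , q , r))))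
      ; no-cross = λ p q r s t → none (inj₂ (inj₂ (inj₂ (_ , _ , _ , _ , _ , _ , _ , _ , _ , _ , p , q , r , s , t))))
      }

    codegree : Fin m → Fin m → ℕ
    codegree x y = ∑ m λ g → χ (P x y g)

    topDegree : Fin m → ℕ
    topDegree v = ∑ m λ x → ∑ m λ y → χ (P x y v)

    degree : Fin m → ℕ
    degree v = ∑ m (codegree v) + ∑ m (λ x → codegree x v) + topDegree v

    total : ℕ
    total = ∑ m λ x → ∑ m λ y → codegree x y

    isLeft isRight : Fin m → Fin m → Bool
    isLeft g x = does (any? λ y → P x y g ≟ true)
    isRight g y = does (any? λ x → P x y g ≟ true)

    isLeft⁺ : ∀ {x y g} → P x y g ≡ true → isLeft g x ≡ true
    isLeft⁺ {x} {y} {g} p with any? (λ y → P x y g ≟ true)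
    ... | yes _ = refl
    ... | no none = ⊥-elim (none (y , p))

    isLeft⁻ : ∀ {x g} → isLeft g x ≡ true → ∃ λ y → P x y g ≡ true
    isLeft⁻ {x} {g} eq with any? (λ y → P x y g ≟ true)
    ... | yes p = p

    isRight⁺ : ∀ {x y g} → P x y g ≡ true → isRight g y ≡ true
    isRight⁺ {x} {y} {g} p with any? (λ x → P x y g ≟ true)
    ... | yes _ = refl
    ... | no none = ⊥-elim (none (x , p))

    isRight⁻ : ∀ {y g} → isRight g y ≡ true → ∃ λ x → P x y g ≡ true
    isRight⁻ {y} {g} eq with any? (λ x → P x y g ≟ true)
    ... | yes p = p

  -- Exchanges right edges with left edges and preserves back edges and cross edges, so statements
  -- about right neighbours also yield those about left neighbours.
  reverse : ∀ {m} → Palette m → Palette m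
  reverse P x y g = P y x g

  reverse-free : ∀ {m} {P : Palette m} → Free P → Free (reverse P)
  reverse-free F = record
    { no-right = λ p q r → no-left q p r
    ; no-left  = λ p q r → no-right q p r
    ; no-back  = λ p q r → no-back q p r
    ; no-cross = λ p q r s t → no-cross q p s r t
    }
    where open Free F

  card : ∀ {m} → (Fin m → Bool) → ℕ
  card {m} X = ∑ m (χ ∘ X)

  χ-true : ∀ {b} → b ≡ true → χ b ≡ 1
  χ-true refl = refl

  χ-imp : ∀ {b n} → (b ≡ true → 1 ≤ n) → χ b ≤ n
  χ-imp {true} p = p refl
  χ-imp {false} p = z≤n

  χ-≤ : ∀ {b c} → (b ≡ true → c ≡ true) → χ b ≤ χ c
  χ-≤ {true} p rewrite p refl = ≤-refl
  χ-≤ {false} p = z≤n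

  card-disjoint : ∀ {m} {X Y Z : Fin m → Bool} →
    (∀ e → X e ≡ true → Y e ≡ true → ⊥) → (∀ e → X e ≡ true → Z e ≡ true) → (∀ e → Y e ≡ true → Z e ≡ true) →
    card X + card Y ≤ card Z
  card-disjoint {m} {X} {Y} {Z} dis X⊆Z Y⊆Z =
    subst (_≤ card Z) (∑-distrib-+ m (χ ∘ X) (χ ∘ Y)) (∑-mono m pointwise)
    where
    pointwise : ∀ e → χ (X e) + χ (Y e) ≤ χ (Z e)
    pointwise e with X e in x | Y e in y
    ... | true | true = ⊥-elim (dis e x y)
    ... | true | false rewrite X⊆Z e x = ≤-refl
    ... | false | true rewrite Y⊆Z e y = ≤-refl
    ... | false | false = z≤n

  card-full : ∀ m → card {m} (λ _ → true) ≡ m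
  card-full m = trans (∑-const m 1) (*-identityʳ m)

  card-disjoint-≤ : ∀ {m} {X Y : Fin m → Bool} → (∀ e → X e ≡ true → Y e ≡ true → ⊥) → card X + card Y ≤ m
  card-disjoint-≤ {m} {X} {Y} dis =
    subst (card X + card Y ≤_) (card-full m) (card-disjoint {Z = λ _ → true} dis (λ _ _ → refl) (λ _ _ → refl))

  quarter : ∀ {a b m} → a + b ≤ m → 4 * (a * b) ≤ m * m
  quarter {a} {b} {m} p = ≤-trans am-gm (*-mono-≤ p p)
    where
    ordered : ∀ a k → 4 * (a * (a + k)) ≤ (a + (a + k)) * (a + (a + k))
    ordered a k = subst (4 * (a * (a + k)) ≤_) (identity a k) (m≤m+n _ (k * k))
      where
      identity : ∀ a k → 4 * (a * (a + k)) + k * k ≡ (a + (a + k)) * (a + (a + k))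
      identity = solve-∀
    am-gm : 4 * (a * b) ≤ (a + b) * (a + b)
    am-gm with ≤-total a b
    ... | inj₁ a≤b = subst (λ c → 4 * (a * c) ≤ (a + c) * (a + c)) (m+[n∸m]≡n a≤b) (ordered a (b ∸ a))
    ... | inj₂ b≤a = subst₂ _≤_ (cong (4 *_) (*-comm b a)) (cong₂ _*_ (+-comm b a) (+-comm b a))
      (subst (λ c → 4 * (b * c) ≤ (b + c) * (b + c)) (m+[n∸m]≡n b≤a) (ordered b (a ∸ b)))

  -- Degree bounds in palettes without configurations.

  module Degrees {m : ℕ} (P : Palette m) (F : Free P) where
    open Free F

    L R : Fin m → Fin m → Bool
    L = isLeft P
    R = isRight P

    codegree-pos : ∀ {x y} → 0 < codegree P x y → ∃ λ g → P x y g ≡ true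
    codegree-pos {x} {y} p with ∑-pos m (λ g → χ (P x y g)) p
    ... | g , q with P x y g in eq
    ... | true = g , eq

    codegree-zero : ∀ {x y} → (∀ g → P x y g ≡ true → ⊥) → codegree P x y ≡ 0
    codegree-zero {x} {y} none with codegree P x y in eq
    ... | zero = refl
    ... | suc k with codegree-pos {x} {y} (subst (0 <_) (sym eq) (s≤s z≤n))
    ... | g , p = ⊥-elim (none g p)

    -- If `e` were both, some edge `x e v` would join the left neighbours `x` and `e` of `v`.
    left-right-disjoint : ∀ v e → L v e ≡ true → R v e ≡ true → ⊥
    left-right-disjoint v e p q with isLeft⁻ P {g = v} p | isRight⁻ P {g = v} q
    ... | y , e-y | x , x-e = no-left x-e e-y x-e

    topDegree≤ : ∀ v → topDegree P v ≤ card (L v) * card (R v)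
    topDegree≤ v = subst (topDegree P v ≤_) (∑∑-product m m (χ ∘ L v) (χ ∘ R v))
      (∑-mono m λ x → ∑-mono m λ y → χ-imp λ p →
        ≤-reflexive (sym (cong₂ _*_ (χ-true (isLeft⁺ P p)) (χ-true (isRight⁺ P p)))))

    module _ (s : ℕ) (max : ∀ x y → codegree P x y ≤ s) where

      -- Only one of the two orders can occur: if `v e g` is an edge, then `e` is a right and `v` a
      -- left neighbour of `g`, and an edge `e v h` would be a back edge.
      codegrees≤ : ∀ v e → codegree P v e + codegree P e v ≤ s
      codegrees≤ v e with codegree P v e in eq
      ... | zero = max e v
      ... | suc k with codegree P e v in eq′
      ... | zero = subst (_≤ s) (trans eq (sym (+-identityʳ _))) (max v e)
      ... | suc k′ with codegree-pos {v} {e} (subst (0 <_) (sym eq) (s≤s z≤n))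
                      | codegree-pos {e} {v} (subst (0 <_) (sym eq′) (s≤s z≤n))
      ... | g , p | h , q = ⊥-elim (no-back p p q)

      -- A partner in `X` contributes no edge with `v` as left or right colour, every other partner
      -- at most `s` by `codegrees≤`.
      degree≤ : ∀ v (X : Fin m → Bool) →
        (∀ e → X e ≡ true → ∀ g → P v e g ≡ true → ⊥) →
        (∀ e → X e ≡ true → ∀ g → P e v g ≡ true → ⊥) →
        degree P v + s * card X ≤ m * s + topDegree P v
      degree≤ v X out in′ = begin
        A + B + T + s * card X ≡⟨ regroup A B T (s * card X) ⟩
        A + B + s * card X + T ≡⟨ cong (_+ T) (sym collect) ⟩
        ∑ m cost + T           ≤⟨ +-monoˡ-≤ T (∑-mono m cost≤) ⟩
        ∑ m (λ _ → s) + T      ≡⟨ cong (_+ T) (∑-const m s) ⟩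
        m * s + T              ∎
        where
        open ≤-Reasoning
        A = ∑ m (codegree P v)
        B = ∑ m (λ x → codegree P x v)
        T = topDegree P v
        cost : Fin m → ℕ
        cost e = codegree P v e + codegree P e v + s * χ (X e)
        regroup : ∀ a b c d → a + b + c + d ≡ a + b + d + c
        regroup = solve-∀
        collect : ∑ m cost ≡ A + B + s * card X
        collect = trans (∑-distrib-+ m _ _)
          (cong₂ _+_ (∑-distrib-+ m (codegree P v) (λ e → codegree P e v)) (∑-distribˡ-* m s (χ ∘ X)))
        cost≤ : ∀ e → cost e ≤ s
        cost≤ e with X e in eq
        ... | true rewrite codegree-zero {v} {e} (out e eq) | codegree-zero {e} {v} (in′ e eq) =
          ≤-reflexive (*-identityʳ s)
        ... | false = subst (_≤ s) (sym (trans (cong (codegree P v e + codegree P e v +_) (*-zeroʳ s)) (+-identityʳ _))) (codegrees≤ v e)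

  -- The colours of a and b are chosen with maximal codegree s; c and w are tops over a b, and w is also
  -- a right neighbour of c.  The degree of a then turns out to be too small.
  module Core {m : ℕ} (P : Palette m) (F : Free P) (large : ∀ v → 4 * (m * m) < 9 * degree P v)
    {a b c w x₀ : Fin m} (abc : P a b c ≡ true) (abw : P a b w ≡ true) (x₀wc : P x₀ w c ≡ true)
    (max : ∀ x y → codegree P x y ≤ codegree P a b) where

    open Free F
    open Degrees P F

    s l r z lʷ rʷ lᵃ : ℕ
    s = codegree P a b
    l = card (L c)
    r = card (R c)
    Z : Fin m → Bool
    Z e = not (L c e) ∧ not (R c e)
    z = card Z
    lʷ = card (L w)
    rʷ = card (R w)
    lᵃ = card (L a)

    Z-intro : ∀ {e} → (L c e ≡ true → ⊥) → (R c e ≡ true → ⊥) → Z e ≡ true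
    Z-intro {e} p q with L c e | R c e
    ... | true | _ = ⊥-elim (p refl)
    ... | false | true = ⊥-elim (q refl)
    ... | false | false = refl

    l+r+z≡m : l + r + z ≡ m
    l+r+z≡m = begin
      l + r + z                                     ≡⟨ cong (_+ z) (sym (∑-distrib-+ m _ _)) ⟩
      ∑ m (λ e → χ (L c e) + χ (R c e)) + z         ≡⟨ sym (∑-distrib-+ m _ _) ⟩
      ∑ m (λ e → χ (L c e) + χ (R c e) + χ (Z e))   ≡⟨ ∑-cong m pointwise ⟩
      ∑ m (λ _ → 1)                                 ≡⟨ card-full m ⟩
      m                                             ∎
      where
      open ≡-Reasoning
      pointwise : ∀ e → χ (L c e) + χ (R c e) + χ (Z e) ≡ 1
      pointwise e with L c e in p | R c e in q
      ... | true | true = ⊥-elim (left-right-disjoint c e p q)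
      ... | true | false = refl
      ... | false | true = refl
      ... | false | false = refl

    -- An edge `v e g` gives a cross edge: `a` is a left neighbour of `e`, `b` is a right neighbour
    -- of `v`, and `a b` is joined.
    top-separated : ∀ {v e} → P a b v ≡ true → P a b e ≡ true → ∀ g → P v e g ≡ true → ⊥
    top-separated abv abe g vge = no-cross vge vge abe abv abe

    degree-top : ∀ {v} → P a b v ≡ true → degree P v + s * s ≤ m * s + topDegree P v
    degree-top {v} abv = degree≤ s max v (P a b)
      (λ e abe → top-separated abv abe) (λ e abe → top-separated abe abv)

    degree-c : degree P c + s * s ≤ m * s + l * r
    degree-c = ≤-trans (degree-top abc) (+-monoʳ-≤ (m * s) (topDegree≤ c))

    lʷ+rʷ≤m : lʷ + rʷ ≤ m
    lʷ+rʷ≤m = card-disjoint-≤ (left-right-disjoint w)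

    lʷ≤m : lʷ ≤ m
    lʷ≤m = ≤-trans (m≤m+n lʷ rʷ) lʷ+rʷ≤m

    -- Right neighbours of `c` are not joined, and `w` is one of them, so `R c` supplies no
    -- partners. This is where the edge `x₀ w c` enters.
    degree-w : degree P w + s * r ≤ m * s + lʷ * (m ∸ lʷ)
    degree-w = ≤-trans
      (degree≤ s max w (R c)
        (λ e e∈R g p → no-right x₀wc (proj₂ (isRight⁻ P {g = c} e∈R)) p)
        (λ e e∈R g p → no-right (proj₂ (isRight⁻ P {g = c} e∈R)) x₀wc p))
      (+-monoʳ-≤ (m * s) (≤-trans (topDegree≤ w) (*-monoʳ-≤ lʷ (subst (_≤ m ∸ lʷ) (m+n∸m≡n lʷ rʷ) (∸-monoˡ-≤ lʷ lʷ+rʷ≤m)))))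

    degree-a : degree P a + s * l ≤ m * s + topDegree P a
    degree-a = degree≤ s max a (L c)
      (λ e e∈L g p → no-left abc (proj₂ (isLeft⁻ P {g = c} e∈L)) p)
      (λ e e∈L g p → no-left (proj₂ (isLeft⁻ P {g = c} e∈L)) abc p)

    -- `a` and `w` are a left and a right neighbour of `c`. If `e` is a left neighbour of both, with
    -- an edge `e y a`, then `y` is a right neighbour of `a` joined to the left neighbour `e` of
    -- `w`: a cross edge.
    La∩Lw : ∀ e → L a e ≡ true → L w e ≡ true → ⊥
    La∩Lw e p q with isLeft⁻ P {g = a} p | isLeft⁻ P {g = w} q
    ... | y , eya | _ , eyw = no-cross abc x₀wc eyw eya eya

    lᵃ+lʷ≤m : lᵃ + lʷ ≤ m
    lᵃ+lʷ≤m = card-disjoint-≤ La∩Lw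

    La∖R Lw∖R Lw∩R : Fin m → Bool
    La∖R e = L a e ∧ not (R c e)
    Lw∖R e = L w e ∧ not (R c e)
    Lw∩R e = L w e ∧ R c e

    ∖-intro : ∀ {x y} → x ≡ true → (y ≡ true → ⊥) → x ∧ not y ≡ true
    ∖-intro {y = true} _ q = ⊥-elim (q refl)
    ∖-intro {y = false} refl _ = refl

    ∖-elim : ∀ {x y} → x ∧ not y ≡ true → x ≡ true × (y ≡ true → ⊥)
    ∖-elim {true} {false} _ = refl , λ ()

    ∧-intro : ∀ {x y} → x ≡ true → y ≡ true → x ∧ y ≡ true
    ∧-intro refl refl = refl

    ∧-elim : ∀ {x y} → x ∧ y ≡ true → x ≡ true × y ≡ true
    ∧-elim {true} {true} _ = refl , refl

    private
      M S Lᶻ Rᶻ Xᶻ : ℤ.ℤ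
      M = ℤ.+ m
      S = ℤ.+ s
      Lᶻ = ℤ.+ l
      Rᶻ = ℤ.+ r
      Xᶻ = ℤ.+ lʷ

    nonneg : ∀ n → ℤ.+ 0 ℤ.≤ ℤ.+ n
    nonneg n = ℤ.+≤+ z≤n

    z-value : ℤ.+ z ≡ M ℤ.- Lᶻ ℤ.- Rᶻ
    z-value = trans (solved (ℤ.+ z) Lᶻ Rᶻ) (cong (λ n → n ℤ.- Lᶻ ℤ.- Rᶻ) (cong ℤ.+_ l+r+z≡m))
      where
      solved : ∀ z l r → z ≡ l ℤ.+ r ℤ.+ z ℤ.- l ℤ.- r
      solved = ℤSolver.solve-∀

    excess-c : ℤ.+ 0 ℤ.< ℤ.+ 9 ℤ.* (Lᶻ ℤ.* Rᶻ) ℤ.+ ℤ.+ 9 ℤ.* (S ℤ.* (M ℤ.- S)) ℤ.- ℤ.+ 4 ℤ.* (M ℤ.* M)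
    excess-c = subst (λ k → ℤ.+ 0 ℤ.< ℤ.+ 9 ℤ.* k ℤ.+ ℤ.+ 9 ℤ.* (S ℤ.* (M ℤ.- S)) ℤ.- ℤ.+ 4 ℤ.* (M ℤ.* M))
      (ℤP.pos-* l r) (degree-excess m s s (l * r) (degree P c) (large c) degree-c)

    excess-w : ℤ.+ 0 ℤ.< ℤ.+ 9 ℤ.* (S ℤ.* (M ℤ.- Rᶻ)) ℤ.- ℤ.+ 4 ℤ.* (M ℤ.* M) ℤ.+ ℤ.+ 9 ℤ.* (Xᶻ ℤ.* (M ℤ.- Xᶻ))
    excess-w = subst (ℤ.+ 0 ℤ.<_)
      (trans (cong (λ k → ℤ.+ 9 ℤ.* k ℤ.+ ℤ.+ 9 ℤ.* (S ℤ.* (M ℤ.- Rᶻ)) ℤ.- ℤ.+ 4 ℤ.* (M ℤ.* M))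
               (trans (ℤP.pos-* lʷ (m ∸ lʷ)) (cong (Xᶻ ℤ.*_) (cast-∸ lʷ≤m))))
             (regroup (ℤ.+ 9 ℤ.* (Xᶻ ℤ.* (M ℤ.- Xᶻ))) (ℤ.+ 9 ℤ.* (S ℤ.* (M ℤ.- Rᶻ))) (ℤ.+ 4 ℤ.* (M ℤ.* M))))
      (degree-excess m s r (lʷ * (m ∸ lʷ)) (degree P w) (large w) degree-w)
      where
      regroup : ∀ a b c → a ℤ.+ b ℤ.- c ≡ b ℤ.- c ℤ.+ a
      regroup = ℤSolver.solve-∀

    excess-product : ℤ.+ 0 ℤ.< ℤ.+ 36 ℤ.* (Lᶻ ℤ.* Rᶻ) ℤ.- ℤ.+ 7 ℤ.* (M ℤ.* M)
    excess-product = product-excess M (Lᶻ ℤ.* Rᶻ) S excess-c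

    excess-a : ℤ.+ 0 ℤ.< ℤ.+ 36 ℤ.* (S ℤ.* (M ℤ.- Lᶻ)) ℤ.- ℤ.+ 7 ℤ.* (M ℤ.* M)
    excess-a = quarter-excess M (ℤ.+ topDegree P a) S Lᶻ
      (degree-excess m s l (topDegree P a) (degree P a) (large a) degree-a)
      (subst₂ (λ u v → ℤ.+ 0 ℤ.≤ u ℤ.- v) (ℤP.pos-* m m) (ℤP.pos-* 4 (topDegree P a))
        (cast-≤ (≤-trans (*-monoʳ-≤ 4 (topDegree≤ a)) (quarter {card (L a)} {card (R a)} (card-disjoint-≤ (left-right-disjoint a))))))

    -- Here `w` is viewed as a top over `a b`, like `c`, rather than as a neighbour of `c`.
    excess-topDegree : ℤ.+ 0 ℤ.< ℤ.+ 36 ℤ.* (ℤ.+ topDegree P w) ℤ.- ℤ.+ 7 ℤ.* (M ℤ.* M)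
    excess-topDegree = product-excess M (ℤ.+ topDegree P w) S
      (degree-excess m s s (topDegree P w) (degree P w) (large w) (degree-top abw))

    3m≤4s+4r : 3 * m ≤ 4 * s + 4 * r
    3m≤4s+4r with 3 * m ≤? 4 * s + 4 * r
    ... | yes p = p
    ... | no ¬p = ⊥-elim (right-plus-top-absurd M Lᶻ Rᶻ S (nonneg m) (nonneg l) (nonneg r) (nonneg s) excess-c excess-a
      (subst (ℤ.+ 0 ℤ.<_) shape (difference-pos (ℤ.+<+ (≰⇒> ¬p)))))
      where
      regroup : ∀ a b c → a ℤ.- (b ℤ.+ c) ≡ a ℤ.- b ℤ.- c
      regroup = ℤSolver.solve-∀
      shape : ℤ.+ (3 * m) ℤ.- ℤ.+ (4 * s + 4 * r) ≡ ℤ.+ 3 ℤ.* M ℤ.- ℤ.+ 4 ℤ.* S ℤ.- ℤ.+ 4 ℤ.* Rᶻ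
      shape = trans (cong₂ ℤ._-_ (ℤP.pos-* 3 m) (cong₂ ℤ._+_ (ℤP.pos-* 4 s) (ℤP.pos-* 4 r)))
                    (regroup (ℤ.+ 3 ℤ.* M) (ℤ.+ 4 ℤ.* S) (ℤ.+ 4 ℤ.* Rᶻ))

    6z≤m : 6 * z ≤ m
    6z≤m with 6 * z ≤? m
    ... | yes p = p
    ... | no ¬p = ⊥-elim (rest-absurd M Lᶻ Rᶻ (nonneg m) (nonneg l) (nonneg r) excess-product
      (subst (ℤ.+ 0 ℤ.≤_) (cong (ℤ._- M) (trans (ℤP.pos-* 6 z) (cong (ℤ.+ 6 ℤ.*_) z-value)))
        (cast-≤ (<⇒≤ (≰⇒> ¬p)))))

    m≤4l : m ≤ 4 * l
    m≤4l with m ≤? 4 * l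
    ... | yes p = p
    ... | no ¬p = ⊥-elim (short-left-absurd M Lᶻ Rᶻ (nonneg m) (nonneg l)
      (subst (ℤ.+ 0 ℤ.≤_) z-value (nonneg z)) excess-product
      (subst (λ k → ℤ.+ 0 ℤ.≤ M ℤ.- k) (ℤP.pos-* 4 l) (cast-≤ (<⇒≤ (≰⇒> ¬p)))))

    m>0 : 0 < m
    m>0 = nonempty a
      where
      nonempty : ∀ {n} → Fin n → 0 < n
      nonempty zero = s≤s z≤n
      nonempty (suc _) = s≤s z≤n

    s>0 : 0 < s
    s>0 = ≤-trans (≤-reflexive (sym (χ-true abc))) (term≤∑ m (λ g → χ (P a b g)) c)

    -- If the left end of an edge below `w` lies in `R c`, its right end avoids `L c` (a back edge)
    -- and `R c` (a right edge), so it lies in the small set `Z`.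
    topDegree-w≤ : topDegree P w ≤ card Lw∖R * rʷ + card Lw∩R * z
    topDegree-w≤ = begin
      topDegree P w ≤⟨ (∑-mono m λ x → ∑-mono m λ y → χ-imp (pointwise x y)) ⟩
      ∑ m (λ x → ∑ m λ y → χ (Lw∖R x) * χ (R w y) + χ (Lw∩R x) * χ (Z y))
        ≡⟨ ∑-cong m (λ x → ∑-distrib-+ m (λ y → χ (Lw∖R x) * χ (R w y)) (λ y → χ (Lw∩R x) * χ (Z y))) ⟩
      ∑ m (λ x → ∑ m (λ y → χ (Lw∖R x) * χ (R w y)) + ∑ m (λ y → χ (Lw∩R x) * χ (Z y)))
        ≡⟨ ∑-distrib-+ m _ _ ⟩
      ∑ m (λ x → ∑ m (λ y → χ (Lw∖R x) * χ (R w y))) + ∑ m (λ x → ∑ m (λ y → χ (Lw∩R x) * χ (Z y)))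
        ≡⟨ cong₂ _+_ (∑∑-product m m (χ ∘ Lw∖R) (χ ∘ R w)) (∑∑-product m m (χ ∘ Lw∩R) (χ ∘ Z)) ⟩
      card Lw∖R * rʷ + card Lw∩R * z ∎
      where
      open ≤-Reasoning
      into-Z : ∀ {x y} → P x y w ≡ true → R c x ≡ true → Z y ≡ true
      into-Z p x∈R = Z-intro
        (λ y∈L → no-back (proj₂ (isRight⁻ P {g = c} x∈R)) (proj₂ (isLeft⁻ P {g = c} y∈L)) p)
        (λ y∈R → no-right (proj₂ (isRight⁻ P {g = c} x∈R)) (proj₂ (isRight⁻ P {g = c} y∈R)) p)
      pointwise : ∀ x y → P x y w ≡ true → 1 ≤ χ (Lw∖R x) * χ (R w y) + χ (Lw∩R x) * χ (Z y)
      pointwise x y p with R c x ≟ true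
      ... | no x∉R rewrite ∖-intro (isLeft⁺ P p) x∉R | isRight⁺ P p = m≤m+n 1 _
      ... | yes x∈R rewrite ∧-intro (isLeft⁺ P p) x∈R | into-Z p x∈R = m≤n+m 1 _

    Lw-split : card Lw∖R + card Lw∩R ≤ lʷ
    Lw-split = card-disjoint
      (λ e p q → proj₂ (∖-elim {L w e} p) (proj₂ (∧-elim {L w e} q)))
      (λ e p → proj₁ (∖-elim {L w e} p)) (λ e p → proj₁ (∧-elim {L w e} p))

    ∖R-sum : card La∖R + card Lw∖R + r ≤ m
    ∖R-sum = ≤-trans (+-monoˡ-≤ r both) (card-disjoint-≤ (λ e p q → off-R-elim e p q))
      where
      off-R : Fin m → Bool
      off-R e = not (R c e)
      off-R-elim : ∀ e → off-R e ≡ true → R c e ≡ true → ⊥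
      off-R-elim e p q with R c e
      off-R-elim e () refl | true
      off-R-intro : ∀ e x → x ∧ off-R e ≡ true → off-R e ≡ true
      off-R-intro e true p = p
      both : card La∖R + card Lw∖R ≤ card off-R
      both = card-disjoint
        (λ e p q → La∩Lw e (proj₁ (∖-elim {L a e} p)) (proj₁ (∖-elim {L w e} q)))
        (λ e p → off-R-intro e (L a e) p) (λ e p → off-R-intro e (L w e) p)

    -- Otherwise the disjoint sets `La∖R`, `Lw∖R` and `R c` leave at most `m - s - r ≤ m / 4`
    -- colours for `Lw∖R`, and then `w` cannot have top degree above `7 m² / 36`.
    La∖R≤s : card La∖R ≤ s
    La∖R≤s with card La∖R ≤? s
    ... | yes p = p
    ... | no ¬p = ⊥-elim (thin-absurd M (ℤ.+ topDegree P w) (ℤ.+ p) (ℤ.+ q) (ℤ.+ rʷ) (ℤ.+ z)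
        (nonneg m) (nonneg p) (nonneg q) (nonneg rʷ) excess-topDegree
        (subst (λ k → ℤ.+ 0 ℤ.≤ k ℤ.- ℤ.+ topDegree P w) (cong₂ ℤ._+_ (ℤP.pos-* p rʷ) (ℤP.pos-* q z)) (cast-≤ topDegree-w≤))
        (subst (ℤ.+ 0 ℤ.≤_) (regroup M (ℤ.+ p) (ℤ.+ q) (ℤ.+ rʷ)) (cast-≤ p+q+rʷ≤m))
        (subst (λ k → ℤ.+ 0 ℤ.≤ M ℤ.- k) (ℤP.pos-* 4 p) (cast-≤ 4p≤m))
        (subst (λ k → ℤ.+ 0 ℤ.≤ M ℤ.- k) (ℤP.pos-* 6 z) (cast-≤ 6z≤m)))
      where
      p q : ℕ
      p = card Lw∖R
      q = card Lw∩R
      regroup : ∀ m p q w → m ℤ.- (p ℤ.+ q ℤ.+ w) ≡ m ℤ.- p ℤ.- q ℤ.- w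
      regroup = ℤSolver.solve-∀
      p+q+rʷ≤m : p + q + rʷ ≤ m
      p+q+rʷ≤m = ≤-trans (+-monoˡ-≤ rʷ Lw-split) lʷ+rʷ≤m
      4p≤m : 4 * p ≤ m
      4p≤m = +-cancelʳ-≤ (4 * s + 4 * r) _ _ (begin
        4 * p + (4 * s + 4 * r) ≡⟨ collect p s r ⟩
        4 * (s + p + r)         ≤⟨ *-monoʳ-≤ 4 (≤-trans (+-monoˡ-≤ r (+-monoˡ-≤ p (<⇒≤ (≰⇒> ¬p)))) ∖R-sum) ⟩
        4 * m                   ≡⟨⟩
        m + 3 * m               ≤⟨ +-monoʳ-≤ m 3m≤4s+4r ⟩
        m + (4 * s + 4 * r)     ∎)
        where
        open ≤-Reasoning
        collect : ∀ p s r → 4 * p + (4 * s + 4 * r) ≡ 4 * (s + p + r)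
        collect = solve-∀

    -- Lower bounds on `lʷ` which `lᵃ + lʷ ≤ m` converts into `lᵃ ≤ 2 l` or `lᵃ ≤ 2 s + 2 l - m`.
    -- The second belongs to `s ≥ m / 2`.
    few-or-many : m ≤ 2 * l + lʷ ⊎ 2 * m ≤ 2 * s + 2 * l + lʷ
    few-or-many with ≤-total (2 * s) m
    ... | inj₁ 2s≤m = inj₁ few
      where
      regroup : ∀ m a b → m ℤ.- (a ℤ.+ b) ≡ m ℤ.- a ℤ.- b
      regroup = ℤSolver.solve-∀
      few : m ≤ 2 * l + lʷ
      few with m ≤? 2 * l + lʷ
      ... | yes p = p
      ... | no ¬p = ⊥-elim (few-tops-absurd M Lᶻ Rᶻ S Xᶻ (ℤ.+<+ m>0) (nonneg l)
        (cast-≤ (subst (r ≤_) l+r+z≡m (≤-trans (m≤n+m r l) (m≤m+n (l + r) z))))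
        (subst (λ k → ℤ.+ 0 ℤ.≤ k ℤ.- M) (ℤP.pos-* 4 l) (cast-≤ m≤4l))
        (subst (λ k → ℤ.+ 0 ℤ.≤ M ℤ.- k) (ℤP.pos-* 2 s) (cast-≤ 2s≤m))
        excess-product excess-w
        (subst (ℤ.+ 0 ℤ.<_) (trans (regroup M (ℤ.+ (2 * l)) Xᶻ) (cong (λ k → M ℤ.- k ℤ.- Xᶻ) (ℤP.pos-* 2 l)))
          (difference-pos (ℤ.+<+ (≰⇒> ¬p)))))
    ... | inj₂ m≤2s = inj₂ many
      where
      regroup : ∀ m a b c → m ℤ.- (a ℤ.+ b ℤ.+ c) ≡ m ℤ.- a ℤ.- b ℤ.- c
      regroup = ℤSolver.solve-∀
      shape : ℤ.+ (2 * m) ℤ.- ℤ.+ (2 * s + 2 * l + lʷ) ≡ ℤ.+ 2 ℤ.* M ℤ.- ℤ.+ 2 ℤ.* S ℤ.- ℤ.+ 2 ℤ.* Lᶻ ℤ.- Xᶻ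
      shape = trans (regroup (ℤ.+ (2 * m)) (ℤ.+ (2 * s)) (ℤ.+ (2 * l)) Xᶻ)
        (cong (ℤ._- Xᶻ) (cong₂ ℤ._-_ (cong₂ ℤ._-_ (ℤP.pos-* 2 m) (ℤP.pos-* 2 s)) (ℤP.pos-* 2 l)))
      many : 2 * m ≤ 2 * s + 2 * l + lʷ
      many with 2 * m ≤? 2 * s + 2 * l + lʷ
      ... | yes p = p
      ... | no ¬p = ⊥-elim (many-tops-absurd M Lᶻ Rᶻ S Xᶻ (nonneg m) (nonneg l) (ℤ.+<+ s>0)
        (subst (λ k → ℤ.+ 0 ℤ.≤ k ℤ.- M) (ℤP.pos-* 4 l) (cast-≤ m≤4l))
        (subst (λ k → ℤ.+ 0 ℤ.≤ k ℤ.- M) (ℤP.pos-* 2 s) (cast-≤ m≤2s))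
        excess-c excess-w
        (subst (ℤ.+ 0 ℤ.<_) shape (difference-pos (ℤ.+<+ (≰⇒> ¬p)))))

    -- In the second case the weaker bound on `lᵃ` is offset by a codegree of at most `m - s`: tops
    -- over `e a` and tops over `a b` are disjoint, since a common one would have the joined left
    -- neighbours `e` and `a`.
    into-a≤ : ∀ {e B I} → B ≡ codegree P e a → I ≤ lᵃ → B + I ≤ s + 2 * l
    into-a≤ {e} {B} {I} refl I≤ = [ (λ few → +-mono-≤ (max e a) (≤-trans I≤ (+-cancelʳ-≤ lʷ _ _ (≤-trans lᵃ+lʷ≤m few))))
                            , (λ many → +-cancelʳ-≤ (s + lʷ) _ _ (begin
        B + I + (s + lʷ)         ≡⟨ pair B I s lʷ ⟩
        (B + s) + (I + lʷ)       ≤⟨ +-mono-≤ B+s≤m (≤-trans (+-monoˡ-≤ lʷ I≤) lᵃ+lʷ≤m) ⟩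
        m + m                    ≡⟨ cong (m +_) (sym (+-identityʳ m)) ⟩
        2 * m                    ≤⟨ many ⟩
        2 * s + 2 * l + lʷ       ≡⟨ unpair s l lʷ ⟩
        s + 2 * l + (s + lʷ)     ∎)) ]′ few-or-many
      where
      open ≤-Reasoning
      pair : ∀ b i s x → b + i + (s + x) ≡ (b + s) + (i + x)
      pair = solve-∀
      unpair : ∀ s l x → 2 * s + 2 * l + x ≡ s + 2 * l + (s + x)
      unpair = solve-∀
      B+s≤m : codegree P e a + s ≤ m
      B+s≤m = card-disjoint-≤ {X = P e a} {Y = P a b} (λ g p q → no-left p q p)

    -- The top degree of `a` split by right end, so that it can be charged to partners together with
    -- the codegrees.
    ind : Fin m → ℕ
    ind e = ∑ m λ x → χ (P x e a)

    ind-pos : ∀ {e} → 0 < ind e → ∃ λ x → P x e a ≡ true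
    ind-pos {e} p with ∑-pos m (λ x → χ (P x e a)) p
    ... | x , q with P x e a in eq
    ... | true = x , eq

    ind-zero : ∀ {e} → (∀ x → P x e a ≡ true → ⊥) → ind e ≡ 0
    ind-zero {e} none with ind e in eq
    ... | zero = refl
    ... | suc k with ind-pos {e} (subst (0 <_) (sym eq) (s≤s z≤n))
    ... | x , p = ⊥-elim (none x p)

    Z∩La Z∩Ra : Fin m → Bool
    Z∩La e = Z e ∧ L a e
    Z∩Ra e = Z e ∧ R a e

    -- A cross edge at `c`: `a` is a left neighbour of `w` through `a b w`, and `e` is a right
    -- neighbour of `a`.
    no-both : ∀ {e x} → P x e a ≡ true → ∀ g → P a e g ≡ true → ⊥
    no-both p g q = no-cross abc x₀wc abw p q

    -- For `e` in `L c` the codegrees vanish, as `a` is in `L c` too, and the left ends counted by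
    -- `ind e` lie in `Z∩La`. For `e` in both `R a` and `R c` the codegrees vanish and `La∖R≤s`
    -- bounds the rest. Outside `L c` only colours of `Z∩Ra` may cost more than `s`, by at most
    -- `2 l`.
    cost≤ : ∀ e → codegree P a e + codegree P e a + ind e + s * χ (L c e) ≤
      s + card Z∩La * χ (L c e) + 2 * l * χ (Z∩Ra e)
    cost≤ e with L c e ≟ true
    ... | yes e∈L
      rewrite e∈L
            | codegree-zero {a} {e} (λ g p → no-left abc (proj₂ (isLeft⁻ P {g = c} e∈L)) p)
            | codegree-zero {e} {a} (λ g p → no-left (proj₂ (isLeft⁻ P {g = c} e∈L)) abc p)
            | *-identityʳ s | *-identityʳ (card Z∩La) = begin
        ind e + s              ≤⟨ +-monoˡ-≤ s ind≤ ⟩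
        card Z∩La + s          ≡⟨ +-comm (card Z∩La) s ⟩
        s + card Z∩La          ≤⟨ m≤m+n _ _ ⟩
        s + card Z∩La + _      ∎
      where
      open ≤-Reasoning
      ind≤ : ind e ≤ card Z∩La
      ind≤ = ∑-mono m λ x → χ-≤ λ p → ∧-intro
        (Z-intro (λ x∈L → no-left (proj₂ (isLeft⁻ P {g = c} x∈L)) (proj₂ (isLeft⁻ P {g = c} e∈L)) p)
                 (λ x∈R → no-back (proj₂ (isRight⁻ P {g = c} x∈R)) (proj₂ (isLeft⁻ P {g = c} e∈L)) p))
        (isLeft⁺ P p)
    ... | no e∉L = subst₂ _≤_ (sym (drop _ s (no-χ e∉L)))
      (cong (_+ 2 * l * χ (Z∩Ra e)) (sym (drop s (card Z∩La) (no-χ e∉L)))) bound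
      where
      no-χ : ∀ {b} → (b ≡ true → ⊥) → χ b ≡ 0
      no-χ {true} p = ⊥-elim (p refl)
      no-χ {false} p = refl
      drop : ∀ n k {y} → y ≡ 0 → n + k * y ≡ n
      drop n k refl = trans (cong (n +_) (*-zeroʳ k)) (+-identityʳ n)
      bound : codegree P a e + codegree P e a + ind e ≤ s + 2 * l * χ (Z∩Ra e)
      bound with R a e ≟ true
      ... | no e∉Ra rewrite ind-zero {e} (λ x p → e∉Ra (isRight⁺ P p)) =
        ≤-trans (≤-reflexive (+-identityʳ _)) (≤-trans (codegrees≤ s max a e) (m≤m+n s _))
      ... | yes e∈Ra with isRight⁻ P {g = a} e∈Ra | R c e ≟ true
      ... | x , xea | yes e∈R
        rewrite codegree-zero {a} {e} (no-both xea)
              | codegree-zero {e} {a} (λ g p → no-back (proj₂ (isRight⁻ P {g = c} e∈R)) abc p) =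
        ≤-trans (≤-trans ind≤ La∖R≤s) (m≤m+n s _)
        where
        ind≤ : ind e ≤ card La∖R
        ind≤ = ∑-mono m λ x → χ-≤ λ p → ∖-intro (isLeft⁺ P p)
          (λ x∈R → no-right (proj₂ (isRight⁻ P {g = c} x∈R)) (proj₂ (isRight⁻ P {g = c} e∈R)) p)
      ... | x , xea | no e∉R
        rewrite codegree-zero {a} {e} (no-both xea) | ∧-intro (Z-intro e∉L e∉R) e∈Ra | *-identityʳ (2 * l) =
        into-a≤ {e} refl (∑-mono m λ x → χ-≤ (isLeft⁺ P))

    degree-a-final : degree P a + s * l ≤ m * s + 2 * (l * z)
    degree-a-final = begin
      degree P a + s * l
        ≡⟨ cong (λ t → ∑ m (codegree P a) + ∑ m (λ e → codegree P e a) + t + s * l) (∑-swap m m (λ x y → χ (P x y a))) ⟩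
      ∑ m (codegree P a) + ∑ m (λ e → codegree P e a) + ∑ m ind + s * l
        ≡⟨ sym collect ⟩
      ∑ m (λ e → codegree P a e + codegree P e a + ind e + s * χ (L c e))
        ≤⟨ ∑-mono m cost≤ ⟩
      ∑ m (λ e → s + card Z∩La * χ (L c e) + 2 * l * χ (Z∩Ra e))
        ≡⟨ trans (∑-distrib-+ m _ _) (cong₂ _+_ (trans (∑-distrib-+ m _ _)
             (cong₂ _+_ (∑-const m s) (∑-distribˡ-* m (card Z∩La) (χ ∘ L c)))) (∑-distribˡ-* m (2 * l) (χ ∘ Z∩Ra))) ⟩
      m * s + card Z∩La * l + 2 * l * card Z∩Ra
        -- Gives both parts of `Z` the weight `2 l`; being disjoint, they have at most `z` colours
        -- together.
        ≤⟨ m≤m+n _ (card Z∩La * l) ⟩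
      m * s + card Z∩La * l + 2 * l * card Z∩Ra + card Z∩La * l
        ≡⟨ regroup (m * s) (card Z∩La) l (card Z∩Ra) ⟩
      m * s + 2 * (l * (card Z∩La + card Z∩Ra))
        ≤⟨ +-monoʳ-≤ (m * s) (*-monoʳ-≤ 2 (*-monoʳ-≤ l Z-split)) ⟩
      m * s + 2 * (l * z) ∎
      where
      open ≤-Reasoning
      collect : ∑ m (λ e → codegree P a e + codegree P e a + ind e + s * χ (L c e)) ≡
        ∑ m (codegree P a) + ∑ m (λ e → codegree P e a) + ∑ m ind + s * l
      collect = trans (∑-distrib-+ m _ _) (cong₂ _+_ (trans (∑-distrib-+ m _ _)
        (cong (_+ ∑ m ind) (∑-distrib-+ m (codegree P a) (λ e → codegree P e a)))) (∑-distribˡ-* m s (χ ∘ L c)))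
      regroup : ∀ k u l v → k + u * l + 2 * l * v + u * l ≡ k + 2 * (l * (u + v))
      regroup = solve-∀
      Z-split : card Z∩La + card Z∩Ra ≤ z
      Z-split = card-disjoint
        (λ e p q → left-right-disjoint a e (proj₂ (∧-elim {Z e} p)) (proj₂ (∧-elim {Z e} q)))
        (λ e p → proj₁ (∧-elim {Z e} p)) (λ e p → proj₁ (∧-elim {Z e} p))

    absurd : ⊥
    absurd = excess-absurd M Lᶻ Rᶻ S excess-c
      (subst (ℤ.+ 0 ℤ.<_) shape (degree-excess m s l (2 * (l * z)) (degree P a) (large a) degree-a-final))
      where
      regroup : ∀ m l s z → ℤ.+ 9 ℤ.* (ℤ.+ 2 ℤ.* (l ℤ.* z)) ℤ.+ ℤ.+ 9 ℤ.* (s ℤ.* (m ℤ.- l)) ℤ.- ℤ.+ 4 ℤ.* (m ℤ.* m) ≡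
        ℤ.+ 9 ℤ.* (s ℤ.* (m ℤ.- l)) ℤ.+ ℤ.+ 18 ℤ.* (l ℤ.* z) ℤ.- ℤ.+ 4 ℤ.* (m ℤ.* m)
      regroup = ℤSolver.solve-∀
      shape : ℤ.+ 9 ℤ.* (ℤ.+ (2 * (l * z))) ℤ.+ ℤ.+ 9 ℤ.* (S ℤ.* (M ℤ.- Lᶻ)) ℤ.- ℤ.+ 4 ℤ.* (M ℤ.* M) ≡
        ℤ.+ 9 ℤ.* (S ℤ.* (M ℤ.- Lᶻ)) ℤ.+ ℤ.+ 18 ℤ.* (Lᶻ ℤ.* (M ℤ.- Lᶻ ℤ.- Rᶻ)) ℤ.- ℤ.+ 4 ℤ.* (M ℤ.* M)
      shape = trans (cong (λ k → ℤ.+ 9 ℤ.* k ℤ.+ ℤ.+ 9 ℤ.* (S ℤ.* (M ℤ.- Lᶻ)) ℤ.- ℤ.+ 4 ℤ.* (M ℤ.* M))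
                       (trans (ℤP.pos-* 2 (l * z)) (cong (ℤ.+ 2 ℤ.*_) (ℤP.pos-* l z))))
        (trans (regroup M Lᶻ S (ℤ.+ z))
          (cong (λ k → ℤ.+ 9 ℤ.* (S ℤ.* (M ℤ.- Lᶻ)) ℤ.+ ℤ.+ 18 ℤ.* (Lᶻ ℤ.* k) ℤ.- ℤ.+ 4 ℤ.* (M ℤ.* M)) z-value))

  -- Palettes with large degrees, and the reduction to them.

  reverse-degree : ∀ {m} (P : Palette m) v → degree (reverse P) v ≡ degree P v
  reverse-degree {m} P v = cong₂ _+_ (+-comm (∑ m λ x → codegree P x v) (∑ m (codegree P v))) (∑-swap m m (λ x y → χ (P y x v)))

  -- If some top over `a b` is a neighbour of `c`, `Core` applies to the palette or to its reverse.
  -- If none is, the tops over `a b`, `L c` and `R c` are pairwise disjoint, and the degree of `c`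
  -- alone gives a contradiction.
  no-large-degrees : ∀ {m} (P : Palette (suc m)) → Free P → (∀ v → 4 * (suc m * suc m) < 9 * degree P v) → ⊥
  no-large-degrees {m} P F large = finish (any? λ w → (P a b w ≟ true) ×-dec ((isLeft P c w ≟ true) ⊎-dec (isRight P c w ≟ true)))
    where
    open Degrees P F
    row : (x : Fin (suc m)) → ∃ λ y → ∀ y′ → codegree P x y′ ≤ codegree P x y
    row x = argmax m (codegree P x)
    best : ∃ λ x → ∀ x′ → codegree P x′ (proj₁ (row x′)) ≤ codegree P x (proj₁ (row x))
    best = argmax m (λ x → codegree P x (proj₁ (row x)))
    a b : Fin (suc m)
    a = proj₁ best
    b = proj₁ (row a)
    s : ℕ
    s = codegree P a b
    max : ∀ x y → codegree P x y ≤ s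
    max x y = ≤-trans (proj₂ (row x) y) (proj₂ best x)
    s>0 : 0 < s
    s>0 = positive s max
      where
      positive : ∀ s → (∀ x y → codegree P x y ≤ s) → 0 < s
      positive (suc _) _ = s≤s z≤n
      positive zero none with ≤-trans (large zero) (≤-reflexive (trans (cong (9 *_) degree≡0) refl))
        where
        vanish : ∀ {f : Fin (suc m) → ℕ} → (∀ i → f i ≤ 0) → ∑ (suc m) f ≡ 0
        vanish p = n≤0⇒n≡0 (≤-trans (∑-mono (suc m) p) (≤-reflexive (trans (∑-const (suc m) 0) (*-zeroʳ (suc m)))))
        degree≡0 : degree P zero ≡ 0
        degree≡0 = cong₂ _+_ (cong₂ _+_ (vanish (none zero)) (vanish (λ x → none x zero)))
          (vanish λ x → ≤-reflexive (vanish λ y → ≤-trans (term≤∑ (suc m) (λ g → χ (P x y g)) zero) (none x y)))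
      ... | ()
    c : Fin (suc m)
    c = proj₁ (codegree-pos {a} {b} s>0)
    abc : P a b c ≡ true
    abc = proj₂ (codegree-pos {a} {b} s>0)
    finish : Dec (∃ λ w → P a b w ≡ true × (isLeft P c w ≡ true ⊎ isRight P c w ≡ true)) → ⊥
    finish (yes (w , abw , inj₂ w∈R)) = Core.absurd P F large abc abw (proj₂ (isRight⁻ P {g = c} w∈R)) max
    finish (yes (w , abw , inj₁ w∈L)) =
      Core.absurd (reverse P) (reverse-free F) (λ v → subst (λ d → 4 * (suc m * suc m) < 9 * d) (sym (reverse-degree P v)) (large v))
        abc abw (proj₂ (isLeft⁻ P {g = c} w∈L)) (λ x y → max y x)
    finish (no outside) = outside-absurd (ℤ.+ suc m) (ℤ.+ l) (ℤ.+ r) (ℤ.+ s) excess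
        (subst (ℤ.+ 0 ℤ.≤_) (regroup (ℤ.+ suc m) (ℤ.+ l) (ℤ.+ r) (ℤ.+ s)) (cast-≤ l+r+s≤m))
        (cast-≤ (≤-trans (m≤n+m s (l + r)) l+r+s≤m)) (ℤ.+≤+ z≤n) (ℤ.+≤+ z≤n)
      where
      l r : ℕ
      l = card (L c)
      r = card (R c)
      regroup : ∀ m l r s → m ℤ.- (l ℤ.+ r ℤ.+ s) ≡ m ℤ.- l ℤ.- r ℤ.- s
      regroup = ℤSolver.solve-∀
      l+r+s≤m : l + r + s ≤ suc m
      l+r+s≤m = begin
        l + r + s ≡⟨ cong (_+ s) (sym (∑-distrib-+ (suc m) (χ ∘ L c) (χ ∘ R c))) ⟩
        ∑ (suc m) (λ e → χ (L c e) + χ (R c e)) + s ≡⟨ sym (∑-distrib-+ (suc m) (λ e → χ (L c e) + χ (R c e)) (χ ∘ P a b)) ⟩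
        ∑ (suc m) (λ e → χ (L c e) + χ (R c e) + χ (P a b e)) ≤⟨ ∑-mono (suc m) pointwise ⟩
        ∑ (suc m) (λ _ → 1) ≡⟨ card-full (suc m) ⟩
        suc m ∎
        where
        open ≤-Reasoning
        pointwise : ∀ e → χ (L c e) + χ (R c e) + χ (P a b e) ≤ 1
        pointwise e with P a b e in p
        ... | true with L c e in x | R c e in y
        ... | true | _ = ⊥-elim (outside (e , p , inj₁ x))
        ... | false | true = ⊥-elim (outside (e , p , inj₂ y))
        ... | false | false = ≤-refl
        pointwise e | false with L c e in x | R c e in y
        ... | true | true = ⊥-elim (left-right-disjoint c e x y)
        ... | true | false = ≤-refl
        ... | false | true = ≤-refl
        ... | false | false = z≤n
      separated : ∀ {u v} → P a b u ≡ true → P a b v ≡ true → ∀ g → P u v g ≡ true → ⊥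
      separated abu abv g uvg = Free.no-cross F uvg uvg abv abu abv
      excess : ℤ.+ 0 ℤ.< ℤ.+ 9 ℤ.* (ℤ.+ l ℤ.* ℤ.+ r) ℤ.+ ℤ.+ 9 ℤ.* (ℤ.+ s ℤ.* (ℤ.+ suc m ℤ.- ℤ.+ s)) ℤ.- ℤ.+ 4 ℤ.* (ℤ.+ suc m ℤ.* ℤ.+ suc m)
      excess = subst (λ k → ℤ.+ 0 ℤ.< ℤ.+ 9 ℤ.* k ℤ.+ ℤ.+ 9 ℤ.* (ℤ.+ s ℤ.* (ℤ.+ suc m ℤ.- ℤ.+ s)) ℤ.- ℤ.+ 4 ℤ.* (ℤ.+ suc m ℤ.* ℤ.+ suc m))
        (ℤP.pos-* l r) (degree-excess (suc m) s s (l * r) (degree P c) (large c)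
          (≤-trans (degree≤ s max c (P a b) (λ e abe → separated abc abe) (λ e abe → separated abe abc))
                   (+-monoʳ-≤ (suc m * s) (topDegree≤ c))))

  -- Asymptotically m³ / 3, with increments matching the degree threshold 4 m² / 9.
  squares : ℕ → ℕ
  squares zero = 0
  squares (suc m) = suc m * suc m + squares m

  delete : ∀ {m} → Palette (suc m) → Fin (suc m) → Palette m
  delete P v x y g = P (punchIn v x) (punchIn v y) (punchIn v g)

  -- Only an inequality, because `degree` counts a triple once for each place that `v` occupies in
  -- it.
  total≤delete : ∀ {m} (P : Palette (suc m)) v → total P ≤ degree P v + total (delete P v)
  total≤delete {m} P v = begin
    total P
      ≡⟨ ∑-punchIn m (λ x → ∑ (suc m) (codegree P x)) v ⟩
    ∑ (suc m) (codegree P v) + ∑ m (λ x → ∑ (suc m) (codegree P (ι x)))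
      ≡⟨ cong (∑ (suc m) (codegree P v) +_) (∑-cong m λ x → ∑-punchIn m (codegree P (ι x)) v) ⟩
    ∑ (suc m) (codegree P v) + ∑ m (λ x → codegree P (ι x) v + ∑ m (λ y → codegree P (ι x) (ι y)))
      ≡⟨ cong (∑ (suc m) (codegree P v) +_) (∑-distrib-+ m _ _) ⟩
    ∑ (suc m) (codegree P v) + (∑ m (λ x → codegree P (ι x) v) + ∑ m (λ x → ∑ m (λ y → codegree P (ι x) (ι y))))
      ≡⟨ cong (λ t → ∑ (suc m) (codegree P v) + (∑ m (λ x → codegree P (ι x) v) + t)) inner ⟩
    ∑ (suc m) (codegree P v) + (∑ m (λ x → codegree P (ι x) v) + (∑ m (λ x → ∑ m λ y → χ (P (ι x) (ι y) v)) + total (delete P v)))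
      ≤⟨ +-monoʳ-≤ (∑ (suc m) (codegree P v)) (+-mono-≤ (∑-punchIn≤ m (λ x → codegree P x v) v) (+-monoˡ-≤ (total (delete P v)) tops≤)) ⟩
    ∑ (suc m) (codegree P v) + (∑ (suc m) (λ x → codegree P x v) + (topDegree P v + total (delete P v)))
      ≡⟨ regroup (∑ (suc m) (codegree P v)) (∑ (suc m) (λ x → codegree P x v)) (topDegree P v) (total (delete P v)) ⟩
    degree P v + total (delete P v) ∎
    where
    open ≤-Reasoning
    ι : Fin m → Fin (suc m)
    ι = punchIn v
    regroup : ∀ a b c d → a + (b + (c + d)) ≡ a + b + c + d
    regroup = solve-∀
    inner : ∑ m (λ x → ∑ m (λ y → codegree P (ι x) (ι y))) ≡ ∑ m (λ x → ∑ m λ y → χ (P (ι x) (ι y) v)) + total (delete P v)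
    inner = trans
      (∑-cong m λ x → trans (∑-cong m λ y → ∑-punchIn m (λ g → χ (P (ι x) (ι y) g)) v) (∑-distrib-+ m _ _))
      (∑-distrib-+ m _ _)
    tops≤ : ∑ m (λ x → ∑ m λ y → χ (P (ι x) (ι y) v)) ≤ topDegree P v
    tops≤ = ≤-trans (∑-mono m λ x → ∑-punchIn≤ m (λ y → χ (P (ι x) y v)) v)
                    (∑-punchIn≤ m (λ x → ∑ (suc m) λ y → χ (P x y v)) v)

  delete-configuration : ∀ {m} (P : Palette (suc m)) v → Configuration (delete P v) → Configuration P
  delete-configuration P v (inj₁ (_ , _ , _ , _ , _ , _ , p)) = inj₁ (_ , _ , _ , _ , _ , _ , p)
  delete-configuration P v (inj₂ (inj₁ (_ , _ , _ , _ , _ , _ , p))) = inj₂ (inj₁ (_ , _ , _ , _ , _ , _ , p))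
  delete-configuration P v (inj₂ (inj₂ (inj₁ (_ , _ , _ , _ , _ , _ , p)))) = inj₂ (inj₂ (inj₁ (_ , _ , _ , _ , _ , _ , p)))
  delete-configuration P v (inj₂ (inj₂ (inj₂ (_ , _ , _ , _ , _ , _ , _ , _ , _ , _ , p)))) =
    inj₂ (inj₂ (inj₂ (_ , _ , _ , _ , _ , _ , _ , _ , _ , _ , p)))

  -- The density hypothesis survives each deletion and fails for `m = 0`, so the deletions reach
  -- either a configuration or a palette with all degrees large.
  dense-palette : ∀ m (P : Palette m) → 4 * squares m < 9 * total P → Configuration P
  dense-palette zero P ()
  dense-palette (suc m) P dense with any? (λ v → 9 * degree P v ≤? 4 * (suc m * suc m))
  ... | yes (v , low) = delete-configuration P v (dense-palette m (delete P v) (+-cancelˡ-< (4 * (suc m * suc m)) _ _ (begin-strict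
        4 * (suc m * suc m) + 4 * squares m  ≡⟨ sym (*-distribˡ-+ 4 (suc m * suc m) (squares m)) ⟩
        4 * squares (suc m)                  <⟨ dense ⟩
        9 * total P                          ≤⟨ *-monoʳ-≤ 9 (total≤delete P v) ⟩
        9 * (degree P v + total (delete P v)) ≡⟨ *-distribˡ-+ 9 (degree P v) _ ⟩
        9 * degree P v + 9 * total (delete P v) ≤⟨ +-monoˡ-≤ _ low ⟩
        4 * (suc m * suc m) + 9 * total (delete P v) ∎)))
    where open ≤-Reasoning
  ... | no high with configuration? P
  ... | yes config = config
  ... | no none = ⊥-elim (no-large-degrees P (free P none) (λ v → ≰⇒> (λ low → high (v , low))))

-- Sampling a dense pattern of vertices from a hypergraph.

module PaletteSampling where

  open import Defs using (∑)
  open Sums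
  open RamseyTheory
  open LevelSelection
  open import Data.Nat
  open import Data.Nat.Properties
  open import Data.Nat.DivMod using (_/_; m/n*n≤m; m≡m%n+[m/n]*n; m%n<n; /-mono-≤; m*n/n≡m)
  open import Data.Nat.Tactic.RingSolver using (solve-∀)
  open import Data.Fin as Fin using (Fin; zero; suc)
  open import Data.Bool using (Bool)
  open import Data.List using ([]; _∷_; allFin)
  open import Data.List.Properties using (length-tabulate)
  open import Data.List.Relation.Binary.Sublist.Propositional using (_⊆_)
  open import Data.Product using (Σ; ∃; _×_; _,_; proj₁; proj₂)
  open import Function using (_∘_)
  open import Relation.Binary.PropositionalEquality

  m<[1+m/n]*n : ∀ m n .{{_ : NonZero n}} → m ≤ suc (m / n) * n
  m<[1+m/n]*n m n = ≤-trans (≤-reflexive (m≡m%n+[m/n]*n m n)) (+-monoˡ-≤ ((m / n) * n) (<⇒≤ (m%n<n m n)))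

  module Rounding (n D B : ℕ) .{{_ : NonZero D}} .{{_ : NonZero (n * D)}} (f : Fin n → ℕ) (f≤ : ∀ x → f x ≤ B * D) where

    mean : ℕ
    mean = ∑ n f / (n * D)

    -- Measured in units of `D` and shifted so that the average is about `B` for every `f`. The
    -- bounds `B + B` and `B ∸ 1` are then independent of the sizes of the parts, as a Ramsey number
    -- chosen in advance requires.
    level : Fin n → ℕ
    level x = f x / D + (B ∸ mean)

    level≤ : ∀ x → level x ≤ B + B
    level≤ x = +-mono-≤ (≤-trans (/-mono-≤ {o = D} {p = D} (f≤ x) ≤-refl) (≤-reflexive (m*n/n≡m B D))) (m∸n≤m B mean)

    level-mean : n * (B ∸ 1) ≤ ∑ n level
    level-mean = begin
      n * (B ∸ 1)              ≡⟨ trans (*-distribˡ-∸ n B 1) (cong (n * B ∸_) (*-identityʳ n)) ⟩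
      n * B ∸ n                ≤⟨ m≤n+o⇒m∸n≤o (n * B) n bound ⟩
      ∑ n level                ∎
      where
      open ≤-Reasoning
      rounded : n * mean ≤ ∑ n (λ x → f x / D) + n
      rounded = *-cancelʳ-≤ (n * mean) _ D (begin
        n * mean * D                            ≡⟨ trans (*-assoc n mean D) (trans (cong (n *_) (*-comm mean D)) (trans (sym (*-assoc n D mean)) (*-comm (n * D) mean))) ⟩
        mean * (n * D)                          ≤⟨ m/n*n≤m (∑ n f) (n * D) ⟩
        ∑ n f                                   ≤⟨ ∑-mono n (λ x → ≤-trans (m<[1+m/n]*n (f x) D) (≤-reflexive (*-comm (suc (f x / D)) D))) ⟩
        ∑ n (λ x → D * suc (f x / D))           ≡⟨ ∑-distribˡ-* n D (λ x → suc (f x / D)) ⟩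
        D * ∑ n (λ x → 1 + f x / D)             ≡⟨ cong (D *_) (trans (∑-distrib-+ n (λ _ → 1) (λ x → f x / D)) (cong (_+ ∑ n (λ x → f x / D)) (trans (∑-const n 1) (*-identityʳ n)))) ⟩
        D * (n + ∑ n (λ x → f x / D))           ≡⟨ trans (*-comm D _) (cong (_* D) (+-comm n _)) ⟩
        (∑ n (λ x → f x / D) + n) * D           ∎)
      bound : n * B ≤ n + ∑ n level
      bound = begin
        n * B                                           ≤⟨ *-monoʳ-≤ n (m≤n+m∸n B mean) ⟩
        n * (mean + (B ∸ mean))                         ≡⟨ *-distribˡ-+ n mean (B ∸ mean) ⟩
        n * mean + n * (B ∸ mean)                       ≤⟨ +-monoˡ-≤ _ rounded ⟩
        ∑ n (λ x → f x / D) + n + n * (B ∸ mean)        ≡⟨ regroup (∑ n (λ x → f x / D)) n (n * (B ∸ mean)) ⟩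
        n + (∑ n (λ x → f x / D) + n * (B ∸ mean))      ≡⟨ cong (n +_) (sym (trans (∑-distrib-+ n (λ x → f x / D) (λ _ → B ∸ mean)) (cong (∑ n (λ x → f x / D) +_) (∑-const n (B ∸ mean))))) ⟩
        n + ∑ n level                                   ∎
        where
        regroup : ∀ a n c → a + n + c ≡ n + (a + c)
        regroup = solve-∀

    -- All that `first-order` uses about rounding: `a` and `b` are the rounded mean and the rounded
    -- value.
    unround : ∀ x → ∃ λ a → ∃ λ b → ∑ n f ≤ suc a * (n * D) × b * (n * D) ≤ n * f x × a + level x ≤ B + b
    unround x = mean , f x / D , m<[1+m/n]*n (∑ n f) (n * D) ,
      (begin
        f x / D * (n * D) ≡⟨ trans (sym (*-assoc (f x / D) n D)) (trans (cong (_* D) (*-comm (f x / D) n)) (*-assoc n (f x / D) D)) ⟩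
        n * (f x / D * D) ≤⟨ *-monoʳ-≤ n (m/n*n≤m (f x) D) ⟩
        n * f x           ∎) ,
      ≤-reflexive (begin-equality
        mean + (f x / D + (B ∸ mean)) ≡⟨ regroup mean (f x / D) (B ∸ mean) ⟩
        mean + (B ∸ mean) + f x / D   ≡⟨ cong (_+ f x / D) (m+[n∸m]≡n mean≤B) ⟩
        B + f x / D                   ∎)
      where
      open ≤-Reasoning
      regroup : ∀ a b c → a + (b + c) ≡ a + c + b
      regroup = solve-∀
      mean≤B : mean ≤ B
      mean≤B = ≤-trans (/-mono-≤ {o = n * D} {p = n * D} (begin
        ∑ n f            ≤⟨ ∑-mono n f≤ ⟩
        ∑ n (λ _ → B * D) ≡⟨ ∑-const n (B * D) ⟩
        n * (B * D)      ≡⟨ trans (sym (*-assoc n B D)) (trans (cong (_* D) (*-comm n B)) (*-assoc B n D)) ⟩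
        B * (n * D)      ∎) ≤-refl) (≤-reflexive (m*n/n≡m B (n * D)))

  -- Trilinear potentials and the trade of one share.

  record Additive {X : Set} (a : (X → ℕ) → ℕ) : Set where
    field
      a-cong : ∀ {φ ψ} → (∀ x → φ x ≡ ψ x) → a φ ≡ a ψ
      a-+    : ∀ φ ψ → a (λ x → φ x + ψ x) ≡ a φ + a ψ

  open Additive

  additive-∑ : ∀ n → Additive (∑ n)
  additive-∑ n = record { a-cong = ∑-cong n ; a-+ = ∑-distrib-+ n }

  additive-+ : ∀ {X : Set} {a b : (X → ℕ) → ℕ} → Additive a → Additive b → Additive (λ φ → a φ + b φ)
  additive-+ {a = a} {b} A B = record
    { a-cong = λ p → cong₂ _+_ (a-cong A p) (a-cong B p)
    ; a-+    = λ φ ψ → trans (cong₂ _+_ (a-+ A φ ψ) (a-+ B φ ψ)) (interchange (a φ) (a ψ) (b φ) (b ψ))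
    }
    where
    interchange : ∀ a b c d → a + b + (c + d) ≡ a + c + (b + d)
    interchange = solve-∀

  additive-* : ∀ {X : Set} {a : (X → ℕ) → ℕ} k → Additive a → Additive (λ φ → k * a φ)
  additive-* {a = a} k A = record
    { a-cong = λ p → cong (k *_) (a-cong A p)
    ; a-+    = λ φ ψ → trans (cong (k *_) (a-+ A φ ψ)) (*-distribˡ-+ k _ _)
    }

  additive-point : ∀ {X : Set} k (v : X) → Additive (λ φ → k * φ v)
  additive-point k v = record { a-cong = λ p → cong (k *_) (p v) ; a-+ = λ φ ψ → *-distribˡ-+ k (φ v) (ψ v) }

  additive-∘ : ∀ {X : Set} {n} (pt : Fin n → X) → Additive (λ (φ : X → ℕ) → ∑ n (φ ∘ pt))
  additive-∘ {n = n} pt = record { a-cong = λ p → ∑-cong n (p ∘ pt) ; a-+ = λ φ ψ → ∑-distrib-+ n (φ ∘ pt) (ψ ∘ pt) }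

  module Trilinear {X Y Z : Set} {a a′ : (X → ℕ) → ℕ} {b b′ : (Y → ℕ) → ℕ} {c c′ : (Z → ℕ) → ℕ}
    (A : Additive a) (A′ : Additive a′) (B : Additive b) (B′ : Additive b′) (C : Additive c) (C′ : Additive c′)
    (e : X → Y → Z → ℕ) where

    ⟨_,_,_⟩ : ((X → ℕ) → ℕ) → ((Y → ℕ) → ℕ) → ((Z → ℕ) → ℕ) → ℕ
    ⟨ a , b , c ⟩ = a λ x → b λ y → c (e x y)

    -- Grouped by order in the primed functionals, which will be the share being traded: order zero,
    -- order one, and the rest.
    expand : ⟨ (λ φ → a φ + a′ φ) , (λ φ → b φ + b′ φ) , (λ φ → c φ + c′ φ) ⟩ ≡
      ⟨ a , b , c ⟩ + (⟨ a′ , b , c ⟩ + ⟨ a , b′ , c ⟩ + ⟨ a , b , c′ ⟩) +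
      (⟨ a , b′ , c′ ⟩ + ⟨ a′ , b , c′ ⟩ + ⟨ a′ , b′ , c ⟩ + ⟨ a′ , b′ , c′ ⟩)
    expand = trans (cong₂ _+_ (spread A) (spread A′))
      (regroup ⟨ a , b , c ⟩ ⟨ a , b , c′ ⟩ ⟨ a , b′ , c ⟩ ⟨ a , b′ , c′ ⟩ ⟨ a′ , b , c ⟩ ⟨ a′ , b , c′ ⟩ ⟨ a′ , b′ , c ⟩ ⟨ a′ , b′ , c′ ⟩)
      where
      spread : ∀ {d} → Additive d → ⟨ d , (λ φ → b φ + b′ φ) , (λ φ → c φ + c′ φ) ⟩ ≡
        ⟨ d , b , c ⟩ + ⟨ d , b , c′ ⟩ + (⟨ d , b′ , c ⟩ + ⟨ d , b′ , c′ ⟩)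
      spread D = trans (a-cong D λ x → cong₂ _+_ (a-+ B _ _) (a-+ B′ _ _))
        (trans (a-+ D _ _) (cong₂ _+_ (a-+ D _ _) (a-+ D _ _)))
      regroup : ∀ p q r s t u v w → p + q + (r + s) + (t + u + (v + w)) ≡ p + (t + r + q) + (s + u + v + w)
      regroup = solve-∀

  -- n times the measure with mass 1 at each chosen point and r shares of the uniform distribution.
  mix : ∀ n {t} → (Fin t → Fin n) → ℕ → (Fin n → ℕ) → ℕ
  mix n {t} pt r φ = n * ∑ t (φ ∘ pt) + r * ∑ n φ

  mix-additive : ∀ n {t} (pt : Fin t → Fin n) r → Additive (mix n pt r)
  mix-additive n pt r = additive-+ (additive-* n (additive-∘ pt)) (additive-* r (additive-∑ n))

  mix-suc : ∀ n {t} (pt : Fin t → Fin n) r φ → mix n pt (suc r) φ ≡ mix n pt r φ + ∑ n φ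
  mix-suc n {t} pt r φ = regroup (n * ∑ t (φ ∘ pt)) (∑ n φ) (r * ∑ n φ)
    where
    regroup : ∀ a b c → a + (b + c) ≡ a + c + b
    regroup = solve-∀

  cons : ∀ {X : Set} {t} → X → (Fin t → X) → Fin (suc t) → X
  cons x f zero = x
  cons x f (suc i) = f i

  mix-cons : ∀ n {t} (pt : Fin t → Fin n) v r φ → mix n (cons v pt) r φ ≡ mix n pt r φ + n * φ v
  mix-cons n {t} pt v r φ = regroup n (φ v) (∑ t (φ ∘ pt)) (r * ∑ n φ)
    where
    regroup : ∀ n x y c → n * (x + y) + c ≡ n * y + c + n * x
    regroup = solve-∀

  mix-≤ : ∀ n {t} (pt : Fin t → Fin n) r φ k → (∀ x → φ x ≤ k) → mix n pt r φ ≤ n * (t + r) * k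
  mix-≤ n {t} pt r φ k φ≤ = begin
    n * ∑ t (φ ∘ pt) + r * ∑ n φ
      ≤⟨ +-mono-≤ (*-monoʳ-≤ n (∑-mono t (φ≤ ∘ pt))) (*-monoʳ-≤ r (∑-mono n φ≤)) ⟩
    n * ∑ t (λ _ → k) + r * ∑ n (λ _ → k)
      ≡⟨ cong₂ (λ u v → n * u + r * v) (∑-const t k) (∑-const n k) ⟩
    n * (t * k) + r * (n * k)
      ≡⟨ regroup n t r k ⟩
    n * (t + r) * k ∎
    where
    open ≤-Reasoning
    regroup : ∀ n t r k → n * (t * k) + r * (n * k) ≡ n * (t + r) * k
    regroup = solve-∀

  additive-∑-swap : ∀ {X : Set} {a : (X → ℕ) → ℕ} → Additive a → (∀ k φ → a (λ x → k * φ x) ≡ k * a φ) →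
    ∀ m (ψ : X → Fin m → ℕ) → a (λ x → ∑ m (ψ x)) ≡ ∑ m (λ y → a (λ x → ψ x y))
  additive-∑-swap A hom zero ψ = trans (hom 0 (λ _ → 0)) refl
  additive-∑-swap {a = a} A hom (suc m) ψ = trans (a-+ A _ _) (cong (a (λ x → ψ x zero) +_) (additive-∑-swap A hom m (λ x → ψ x ∘ suc)))

  mix-* : ∀ n {t} (pt : Fin t → Fin n) r k φ → mix n pt r (λ x → k * φ x) ≡ k * mix n pt r φ
  mix-* n {t} pt r k φ = trans (cong₂ (λ u v → n * u + r * v) (∑-distribˡ-* t k (φ ∘ pt)) (∑-distribˡ-* n k φ))
    (regroup n r k (∑ t (φ ∘ pt)) (∑ n φ))
    where
    regroup : ∀ n r k x y → n * (k * x) + r * (k * y) ≡ k * (n * x + r * y)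
    regroup = solve-∀

  mix-∑ : ∀ n {t} (pt : Fin t → Fin n) r m (ψ : Fin n → Fin m → ℕ) →
    mix n pt r (λ x → ∑ m (ψ x)) ≡ ∑ m (λ y → mix n pt r (λ x → ψ x y))
  mix-∑ n pt r = additive-∑-swap (mix-additive n pt r) (mix-* n pt r)

  nested-cong : ∀ {X Y Z : Set} {a a′ : (X → ℕ) → ℕ} {b b′ : (Y → ℕ) → ℕ} {c c′ : (Z → ℕ) → ℕ} (e : X → Y → Z → ℕ) →
    Additive a → Additive b → (∀ φ → a φ ≡ a′ φ) → (∀ φ → b φ ≡ b′ φ) → (∀ φ → c φ ≡ c′ φ) →
    (a λ x → b λ y → c (e x y)) ≡ (a′ λ x → b′ λ y → c′ (e x y))
  nested-cong e A B p q r =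
    trans (a-cong A λ x → trans (a-cong B λ y → r (e x y)) (q _)) (p _)

  module Triad (N₁ N₂ N₃ : ℕ) {{nz₁ : NonZero N₁}} {{nz₂ : NonZero N₂}} {{nz₃ : NonZero N₃}}
    {t : ℕ} (p₁ : Fin t → Fin N₁) (p₂ : Fin t → Fin N₂) (p₃ : Fin t → Fin N₃)
    (ε : Fin N₁ → Fin N₂ → Fin N₃ → Bool) where

    E : Fin N₁ → Fin N₂ → Fin N₃ → ℕ
    E x y w = χ (ε x y w)

    ⟨_,_,_⟩ : ((Fin N₁ → ℕ) → ℕ) → ((Fin N₂ → ℕ) → ℕ) → ((Fin N₃ → ℕ) → ℕ) → ℕ
    ⟨ a , b , c ⟩ = a λ x → b λ y → c (E x y)

    -- Up to scaling, this interpolates between the number of edges (`t = 0`) and the number of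
    -- sampled triples that are edges (`r = 0`).
    potential : ℕ → ℕ
    potential r = ⟨ mix N₁ p₁ r , mix N₂ p₂ r , mix N₃ p₃ r ⟩

    S : ℕ
    S = N₁ * (N₂ * N₃)

    module Share (r : ℕ) where

      q : ℕ
      q = t + r

      a : (Fin N₁ → ℕ) → ℕ
      a = mix N₁ p₁ r
      b : (Fin N₂ → ℕ) → ℕ
      b = mix N₂ p₂ r
      c : (Fin N₃ → ℕ) → ℕ
      c = mix N₃ p₃ r

      left : Fin N₁ → ℕ
      left x = b λ y → c (E x y)

      right : Fin N₂ → ℕ
      right y = a λ x → c (E x y)

      top : Fin N₃ → ℕ
      top w = a λ x → b λ y → E x y w

      mix-mix≤ : ∀ {M M′} (p : Fin t → Fin M) (p′ : Fin t → Fin M′) (φ : Fin M → Fin M′ → Bool) →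
        mix M p r (λ x → mix M′ p′ r λ y → χ (φ x y)) ≤ q * q * (M * M′)
      mix-mix≤ {M} {M′} p p′ φ = ≤-trans
        (mix-≤ M p r _ (M′ * q * 1) (λ x → mix-≤ M′ p′ r _ 1 (λ y → χ≤1 (φ x y))))
        (≤-reflexive (regroup M M′ q))
        where
        regroup : ∀ a b q → a * q * (b * q * 1) ≡ q * q * (a * b)
        regroup = solve-∀

      module L = Rounding N₁ (N₂ * N₃) (q * q) {{m*n≢0 N₂ N₃}} {{m*n≢0 N₁ (N₂ * N₃) {{nz₁}} {{m*n≢0 N₂ N₃}}}}
        left (λ x → mix-mix≤ p₂ p₃ (ε x))
      module R = Rounding N₂ (N₁ * N₃) (q * q) {{m*n≢0 N₁ N₃}} {{m*n≢0 N₂ (N₁ * N₃) {{nz₂}} {{m*n≢0 N₁ N₃}}}}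
        right (λ y → mix-mix≤ p₁ p₃ (λ x → ε x y))
      module T = Rounding N₃ (N₁ * N₂) (q * q) {{m*n≢0 N₁ N₂}} {{m*n≢0 N₃ (N₁ * N₂) {{nz₃}} {{m*n≢0 N₁ N₂}}}}
        top (λ w → mix-mix≤ p₁ p₂ (λ x y → ε x y w))

      -- Of the error `6 * S`, three units come from rounding the three means and three from the
      -- `∸ 1` in the required level.
      first-order : ∀ x y w → 3 * (q * q ∸ 1) ≤ L.level x + R.level y + T.level w →
        ∑ N₁ left + ∑ N₂ right + ∑ N₃ top ≤ N₁ * left x + N₂ * right y + N₃ * top w + 6 * S
      first-order x y w high = combine (L.unround x) (R.unround y) (T.unround w)
        where
        open ≤-Reasoning
        B : ℕ
        B = q * q
        swap₂ : ∀ a b c → b * (a * c) ≡ a * (b * c)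
        swap₂ = solve-∀
        swap₃ : ∀ a b c → c * (a * b) ≡ a * (b * c)
        swap₃ = solve-∀
        collect : ∀ a b c S → suc a * S + suc b * S + suc c * S ≡ (a + b + c + 3) * S
        collect = solve-∀
        distribute : ∀ a b c S → (a + b + c + 3 + 3) * S ≡ a * S + b * S + c * S + 6 * S
        distribute = solve-∀
        pair : ∀ a b c d e f → a + b + c + (d + e + f) ≡ a + d + (b + e) + (c + f)
        pair = solve-∀
        unpair : ∀ B a b c → 1 + B + a + (1 + B + b) + (1 + B + c) ≡ a + b + c + 3 + 3 * B
        unpair = solve-∀
        combine :
          (∃ λ a → ∃ λ b → ∑ N₁ left ≤ suc a * (N₁ * (N₂ * N₃)) × b * (N₁ * (N₂ * N₃)) ≤ N₁ * left x × a + L.level x ≤ B + b) →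
          (∃ λ a → ∃ λ b → ∑ N₂ right ≤ suc a * (N₂ * (N₁ * N₃)) × b * (N₂ * (N₁ * N₃)) ≤ N₂ * right y × a + R.level y ≤ B + b) →
          (∃ λ a → ∃ λ b → ∑ N₃ top ≤ suc a * (N₃ * (N₁ * N₂)) × b * (N₃ * (N₁ * N₂)) ≤ N₃ * top w × a + T.level w ≤ B + b) →
          ∑ N₁ left + ∑ N₂ right + ∑ N₃ top ≤ N₁ * left x + N₂ * right y + N₃ * top w + 6 * S
        combine (a₁ , b₁ , up₁ , low₁ , gap₁) (a₂ , b₂ , up₂ , low₂ , gap₂) (a₃ , b₃ , up₃ , low₃ , gap₃) = begin
          ∑ N₁ left + ∑ N₂ right + ∑ N₃ top
            ≤⟨ +-mono-≤ (+-mono-≤ up₁ (≤-trans up₂ (≤-reflexive (cong (suc a₂ *_) (swap₂ N₁ N₂ N₃))))) (≤-trans up₃ (≤-reflexive (cong (suc a₃ *_) (swap₃ N₁ N₂ N₃)))) ⟩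
          suc a₁ * S + suc a₂ * S + suc a₃ * S   ≡⟨ collect a₁ a₂ a₃ S ⟩
          (a₁ + a₂ + a₃ + 3) * S                 ≤⟨ *-monoˡ-≤ S (+-monoˡ-≤ 3 sums) ⟩
          (b₁ + b₂ + b₃ + 3 + 3) * S             ≡⟨ distribute b₁ b₂ b₃ S ⟩
          b₁ * S + b₂ * S + b₃ * S + 6 * S
            ≤⟨ +-monoˡ-≤ (6 * S) (+-mono-≤ (+-mono-≤ low₁ (≤-trans (≤-reflexive (cong (b₂ *_) (sym (swap₂ N₁ N₂ N₃)))) low₂)) (≤-trans (≤-reflexive (cong (b₃ *_) (sym (swap₃ N₁ N₂ N₃)))) low₃)) ⟩
          N₁ * left x + N₂ * right y + N₃ * top w + 6 * S ∎
          where
          sums : a₁ + a₂ + a₃ ≤ b₁ + b₂ + b₃ + 3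
          sums = +-cancelʳ-≤ (3 * (B ∸ 1)) _ _ (begin
            a₁ + a₂ + a₃ + 3 * (B ∸ 1)   ≤⟨ +-monoʳ-≤ (a₁ + a₂ + a₃) high ⟩
            a₁ + a₂ + a₃ + (L.level x + R.level y + T.level w)
              ≡⟨ pair a₁ a₂ a₃ (L.level x) (R.level y) (T.level w) ⟩
            a₁ + L.level x + (a₂ + R.level y) + (a₃ + T.level w)
              ≤⟨ +-mono-≤ (+-mono-≤ gap₁ gap₂) gap₃ ⟩
            B + b₁ + (B + b₂) + (B + b₃) ≤⟨ +-mono-≤ (+-mono-≤ (+-monoˡ-≤ b₁ (m≤n+m∸n B 1)) (+-monoˡ-≤ b₂ (m≤n+m∸n B 1))) (+-monoˡ-≤ b₃ (m≤n+m∸n B 1)) ⟩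
            1 + (B ∸ 1) + b₁ + (1 + (B ∸ 1) + b₂) + (1 + (B ∸ 1) + b₃) ≡⟨ unpair (B ∸ 1) b₁ b₂ b₃ ⟩
            b₁ + b₂ + b₃ + 3 + 3 * (B ∸ 1) ∎)

      -- Trading one share of the uniform distribution for new vertices loses only second-order terms.
      module Trade (v₁ : Fin N₁) (v₂ : Fin N₂) (v₃ : Fin N₃) (high : 3 * (q * q ∸ 1) ≤ L.level v₁ + R.level v₂ + T.level v₃) where

        σ₁ δ₁ : (Fin N₁ → ℕ) → ℕ
        σ₁ = ∑ N₁
        δ₁ φ = N₁ * φ v₁
        σ₂ δ₂ : (Fin N₂ → ℕ) → ℕ
        σ₂ = ∑ N₂
        δ₂ φ = N₂ * φ v₂
        σ₃ δ₃ : (Fin N₃ → ℕ) → ℕ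
        σ₃ = ∑ N₃
        δ₃ φ = N₃ * φ v₃
        A : Additive a
        A = mix-additive N₁ p₁ r
        B : Additive b
        B = mix-additive N₂ p₂ r
        C : Additive c
        C = mix-additive N₃ p₃ r

        traded : ℕ
        traded = ⟨ mix N₁ (cons v₁ p₁) r , mix N₂ (cons v₂ p₂) r , mix N₃ (cons v₃ p₃) r ⟩

        old : potential (suc r) ≡ ⟨ a , b , c ⟩ + (⟨ σ₁ , b , c ⟩ + ⟨ a , σ₂ , c ⟩ + ⟨ a , b , σ₃ ⟩) +
          (⟨ a , σ₂ , σ₃ ⟩ + ⟨ σ₁ , b , σ₃ ⟩ + ⟨ σ₁ , σ₂ , c ⟩ + ⟨ σ₁ , σ₂ , σ₃ ⟩)
        old = trans
          (nested-cong E (mix-additive N₁ p₁ (suc r)) (mix-additive N₂ p₂ (suc r)) (mix-suc N₁ p₁ r) (mix-suc N₂ p₂ r) (mix-suc N₃ p₃ r))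
          (Trilinear.expand A (additive-∑ N₁) B (additive-∑ N₂) C (additive-∑ N₃) E)

        new : traded ≡ ⟨ a , b , c ⟩ + (⟨ δ₁ , b , c ⟩ + ⟨ a , δ₂ , c ⟩ + ⟨ a , b , δ₃ ⟩) +
          (⟨ a , δ₂ , δ₃ ⟩ + ⟨ δ₁ , b , δ₃ ⟩ + ⟨ δ₁ , δ₂ , c ⟩ + ⟨ δ₁ , δ₂ , δ₃ ⟩)
        new = trans
          (nested-cong E (mix-additive N₁ (cons v₁ p₁) r) (mix-additive N₂ (cons v₂ p₂) r)
            (mix-cons N₁ p₁ v₁ r) (mix-cons N₂ p₂ v₂ r) (mix-cons N₃ p₃ v₃ r))
          (Trilinear.expand A (additive-point N₁ v₁) B (additive-point N₂ v₂) C (additive-point N₃ v₃) E)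

        first : ⟨ σ₁ , b , c ⟩ + ⟨ a , σ₂ , c ⟩ + ⟨ a , b , σ₃ ⟩ ≤ ⟨ δ₁ , b , c ⟩ + ⟨ a , δ₂ , c ⟩ + ⟨ a , b , δ₃ ⟩ + 6 * S
        first = subst₂ _≤_
          (cong₂ _+_ (cong (⟨ σ₁ , b , c ⟩ +_) (sym (mix-∑ N₁ p₁ r N₂ (λ x y → c (E x y)))))
            (sym (trans (a-cong A λ x → mix-∑ N₂ p₂ r N₃ (E x)) (mix-∑ N₁ p₁ r N₃ (λ x w → b (λ y → E x y w))))))
          (cong (_+ 6 * S) (cong₂ _+_ (cong (⟨ δ₁ , b , c ⟩ +_) (sym (mix-* N₁ p₁ r N₂ (λ x → c (E x v₂)))))
            (sym (trans (a-cong A λ x → mix-* N₂ p₂ r N₃ (λ y → E x y v₃)) (mix-* N₁ p₁ r N₃ (λ x → b (λ y → E x y v₃)))))))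
          (first-order v₁ v₂ v₃ high)

        ∑≤ : ∀ n φ k → (∀ x → φ x ≤ k) → ∑ n φ ≤ n * k
        ∑≤ n φ k p = ≤-trans (∑-mono n p) (≤-reflexive (∑-const n k))

        E≤ : ∀ x y w → E x y w ≤ 1
        E≤ x y w = χ≤1 (ε x y w)

        second : ⟨ a , σ₂ , σ₃ ⟩ + ⟨ σ₁ , b , σ₃ ⟩ + ⟨ σ₁ , σ₂ , c ⟩ + ⟨ σ₁ , σ₂ , σ₃ ⟩ ≤ (3 * q + 1) * S
        second = ≤-trans
          (+-mono-≤ (+-mono-≤ (+-mono-≤
            (mix-≤ N₁ p₁ r _ (N₂ * (N₃ * 1)) λ x → ∑≤ N₂ _ (N₃ * 1) λ y → ∑≤ N₃ _ 1 (E≤ x y))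
            (∑≤ N₁ _ (N₂ * q * (N₃ * 1)) λ x → mix-≤ N₂ p₂ r _ (N₃ * 1) λ y → ∑≤ N₃ _ 1 (E≤ x y)))
            (∑≤ N₁ _ (N₂ * (N₃ * q * 1)) λ x → ∑≤ N₂ _ (N₃ * q * 1) λ y → mix-≤ N₃ p₃ r _ 1 (E≤ x y)))
            (∑≤ N₁ _ (N₂ * (N₃ * 1)) λ x → ∑≤ N₂ _ (N₃ * 1) λ y → ∑≤ N₃ _ 1 (E≤ x y)))
          (≤-reflexive (regroup N₁ N₂ N₃ q))
          where
          regroup : ∀ a b c q → a * q * (b * (c * 1)) + a * (b * q * (c * 1)) + a * (b * (c * q * 1)) + a * (b * (c * 1)) ≡ (3 * q + 1) * (a * (b * c))
          regroup = solve-∀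

        -- Terms of order zero agree. Order one loses at most `6 * S`, the old terms of higher order
        -- are at most `(3 * q + 1) * S`, and the new ones are nonnegative.
        trade : potential (suc r) ≤ traded + (3 * q + 7) * S
        trade = begin
          potential (suc r) ≡⟨ old ⟩
          ⟨ a , b , c ⟩ + (⟨ σ₁ , b , c ⟩ + ⟨ a , σ₂ , c ⟩ + ⟨ a , b , σ₃ ⟩) +
            (⟨ a , σ₂ , σ₃ ⟩ + ⟨ σ₁ , b , σ₃ ⟩ + ⟨ σ₁ , σ₂ , c ⟩ + ⟨ σ₁ , σ₂ , σ₃ ⟩)
            ≤⟨ +-mono-≤ (+-monoʳ-≤ ⟨ a , b , c ⟩ first) second ⟩
          ⟨ a , b , c ⟩ + (⟨ δ₁ , b , c ⟩ + ⟨ a , δ₂ , c ⟩ + ⟨ a , b , δ₃ ⟩ + 6 * S) + (3 * q + 1) * S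
            ≡⟨ collect ⟨ a , b , c ⟩ (⟨ δ₁ , b , c ⟩ + ⟨ a , δ₂ , c ⟩ + ⟨ a , b , δ₃ ⟩) q S ⟩
          ⟨ a , b , c ⟩ + (⟨ δ₁ , b , c ⟩ + ⟨ a , δ₂ , c ⟩ + ⟨ a , b , δ₃ ⟩) + (3 * q + 7) * S
            ≤⟨ +-monoˡ-≤ ((3 * q + 7) * S) (m≤m+n _ (⟨ a , δ₂ , δ₃ ⟩ + ⟨ δ₁ , b , δ₃ ⟩ + ⟨ δ₁ , δ₂ , c ⟩ + ⟨ δ₁ , δ₂ , δ₃ ⟩)) ⟩
          ⟨ a , b , c ⟩ + (⟨ δ₁ , b , c ⟩ + ⟨ a , δ₂ , c ⟩ + ⟨ a , b , δ₃ ⟩) +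
            (⟨ a , δ₂ , δ₃ ⟩ + ⟨ δ₁ , b , δ₃ ⟩ + ⟨ δ₁ , δ₂ , c ⟩ + ⟨ δ₁ , δ₂ , δ₃ ⟩) + (3 * q + 7) * S
            ≡⟨ cong (_+ (3 * q + 7) * S) (sym new) ⟩
          traded + (3 * q + 7) * S ∎
          where
          open ≤-Reasoning
          collect : ∀ x y q S → x + (y + 6 * S) + (3 * q + 1) * S ≡ x + y + (3 * q + 7) * S
          collect = solve-∀

  -- Trading all shares, in all triads at once.

  record Hypergraph (N : ℕ) : Set where
    field
      s : Fin N → Fin N → ℕ
      e : ∀ i j k → Fin (suc (s i j)) → Fin (suc (s j k)) → Fin (suc (s i k)) → Bool

    n : Fin N → Fin N → ℕ
    n i j = suc (s i j)

    volume : Fin N → Fin N → Fin N → ℕ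
    volume i j k = n i j * (n j k * n i k)

  open Hypergraph

  Family : ∀ {N} → Hypergraph N → Set
  Family {N} H = ∀ (i j : Fin N) → Fin (n H i j)

  restrict : ∀ {M N} → (Fin M → Fin N) → Hypergraph N → Hypergraph M
  restrict z H = record { s = λ i j → s H (z i) (z j) ; e = λ i j k → e H (z i) (z j) (z k) }

  module At {N} (H : Hypergraph N) {t} (F : Fin t → Family H) (i j k : Fin N) =
    Triad (n H i j) (n H j k) (n H i k) (λ c → F c i j) (λ c → F c j k) (λ c → F c i k) (e H i j k)

  levels : ∀ {N} (H : Hypergraph N) {t} (F : Fin t → Family H) r → Levels (Fin N) ((t + r) * (t + r) + (t + r) * (t + r)) ((t + r) * (t + r) ∸ 1)
  levels H F r = record
    { s = s H
    ; fL = λ i j k → At.Share.L.level H F i j k r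
    ; fR = λ i j k → At.Share.R.level H F i j k r
    ; fT = λ i j k → At.Share.T.level H F i j k r
    ; fL≤ = λ i j k → At.Share.L.level≤ H F i j k r
    ; fR≤ = λ i j k → At.Share.R.level≤ H F i j k r
    ; fT≤ = λ i j k → At.Share.T.level≤ H F i j k r
    ; fL-mean = λ i j k → At.Share.L.level-mean H F i j k r
    ; fR-mean = λ i j k → At.Share.R.level-mean H F i j k r
    ; fT-mean = λ i j k → At.Share.T.level-mean H F i j k r
    }

  edges : ∀ {N} (H : Hypergraph N) → Fin N → Fin N → Fin N → ℕ
  edges H i j k = ∑ (n H i j) λ x → ∑ (n H j k) λ y → ∑ (n H i k) λ w → χ (e H i j k x y w)

  sampled : ∀ {N} (H : Hypergraph N) {m} → (Fin m → Family H) → Fin N → Fin N → Fin N → ℕ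
  sampled H {m} F i j k = ∑ m λ a → ∑ m λ b → ∑ m λ c → χ (e H i j k (F a i j) (F b j k) (F c i k))

  abstract
    potential : ∀ {N} (H : Hypergraph N) {t} → (Fin t → Family H) → ℕ → Fin N → Fin N → Fin N → ℕ
    potential H F r i j k = At.potential H F i j k r

    potential-trade : ∀ {M N} (H : Hypergraph N) {t} (F : Fin t → Family H) r (z : Fin M → Fin N) (v : Family (restrict z H)) i j k →
      3 * ((t + r) * (t + r) ∸ 1) ≤
        Levels.fL (levels H F r) (z i) (z j) (z k) (v i j) + Levels.fR (levels H F r) (z i) (z j) (z k) (v j k) +
        Levels.fT (levels H F r) (z i) (z j) (z k) (v i k) →
      potential H F (suc r) (z i) (z j) (z k) ≤
      potential (restrict z H) (cons v (λ c i j → F c (z i) (z j))) r i j k + (3 * (t + r) + 7) * volume H (z i) (z j) (z k)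
    potential-trade H F r z v i j k high = At.Share.Trade.trade H F (z i) (z j) (z k) r (v i j) (v j k) (v i k) high

    potential-start : ∀ {N} (H : Hypergraph N) (F : Fin 0 → Family H) m i j k → potential H F m i j k ≡ m * (m * (m * edges H i j k))
    potential-start H F m i j k = uniform (n H i j) (n H j k) (n H i k) (λ c → F c i j) (λ c → F c j k) (λ c → F c i k) (λ x y w → χ (e H i j k x y w))
      where
      uniform : ∀ N₁ N₂ N₃ (p₁ : Fin 0 → Fin N₁) (p₂ : Fin 0 → Fin N₂) (p₃ : Fin 0 → Fin N₃) (E : Fin N₁ → Fin N₂ → Fin N₃ → ℕ) →
        (mix N₁ p₁ m λ x → mix N₂ p₂ m λ y → mix N₃ p₃ m (E x y)) ≡ m * (m * (m * ∑ N₁ λ x → ∑ N₂ λ y → ∑ N₃ (E x y)))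
      uniform N₁ N₂ N₃ p₁ p₂ p₃ E = trans
        (nested-cong E (mix-additive N₁ p₁ m) (mix-additive N₂ p₂ m) (empty N₁ p₁) (empty N₂ p₂) (empty N₃ p₃))
        (cong (m *_) (trans (∑-cong N₁ λ x → trans (cong (m *_) (∑-distribˡ-* N₂ m _)) refl)
          (trans (∑-distribˡ-* N₁ m _) (cong (m *_) (∑-distribˡ-* N₁ m _)))))
        where
        empty : ∀ N (p : Fin 0 → Fin N) φ → mix N p m φ ≡ m * ∑ N φ
        empty N p φ = cong (_+ m * ∑ N φ) (*-zeroʳ N)

    potential-end : ∀ {N} (H : Hypergraph N) {m} (F : Fin m → Family H) i j k → potential H F 0 i j k ≡ volume H i j k * sampled H F i j k
    potential-end H {m} F i j k = points (n H i j) (n H j k) (n H i k) (λ c → F c i j) (λ c → F c j k) (λ c → F c i k) (λ x y w → χ (e H i j k x y w))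
      where
      points : ∀ N₁ N₂ N₃ (p₁ : Fin m → Fin N₁) (p₂ : Fin m → Fin N₂) (p₃ : Fin m → Fin N₃) (E : Fin N₁ → Fin N₂ → Fin N₃ → ℕ) →
        (mix N₁ p₁ 0 λ x → mix N₂ p₂ 0 λ y → mix N₃ p₃ 0 (E x y)) ≡
        N₁ * (N₂ * N₃) * ∑ m λ a → ∑ m λ b → ∑ m λ c → E (p₁ a) (p₂ b) (p₃ c)
      points N₁ N₂ N₃ p₁ p₂ p₃ E = trans
        (nested-cong {a′ = λ φ → N₁ * ∑ m (φ ∘ p₁)} {b′ = λ φ → N₂ * ∑ m (φ ∘ p₂)} {c′ = λ φ → N₃ * ∑ m (φ ∘ p₃)} E
          (mix-additive N₁ p₁ 0) (mix-additive N₂ p₂ 0) (λ φ → +-identityʳ _) (λ φ → +-identityʳ _) (λ φ → +-identityʳ _))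
        (trans (cong (N₁ *_) (trans (∑-cong m λ a → cong (N₂ *_) (∑-distribˡ-* m N₃ _))
          (trans (∑-distribˡ-* m N₂ _) (cong (N₂ *_) (∑-distribˡ-* m N₃ _)))))
          (regroup N₁ N₂ N₃ _))
        where
        regroup : ∀ a b c d → a * (b * (c * d)) ≡ a * (b * c) * d
        regroup = solve-∀

  Monotone : ∀ {M N} → (Fin M → Fin N) → Set
  Monotone z = ∀ {i j} → i Fin.< j → z i Fin.< z j

  Traded : ℕ → ℕ → ℕ → ℕ → Set
  Traded M t r N = (H : Hypergraph N) (F : Fin t → Family H) →
    Σ (Fin M → Fin N) λ z → Monotone z × Σ (Family (restrict z H)) λ v → ∀ {i j k} → i Fin.< j → j Fin.< k →
      potential H F (suc r) (z i) (z j) (z k) ≤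
      potential (restrict z H) (cons v (λ c i j → F c (z i) (z j))) r i j k + (3 * (t + r) + 7) * volume H (z i) (z j) (z k)

  trade-all : ∀ M t r → ∃ (Traded M t r)
  trade-all M t r = proj₁ selection , λ H F → found H F
    (proj₂ selection (levels H F r) (allFin (proj₁ selection)) (≤-reflexive (sym (length-tabulate (λ i → i)))))
    where
    q : ℕ
    q = t + r
    selection = Selection.select (q * q + q * q) (q * q ∸ 1) M
    found : ∀ {N} (H : Hypergraph N) (F : Fin t → Family H) → let open Levels (levels H F r) hiding (s) in
      (Σ (Fin M → Fin N) λ z → (∀ {i j} → i Fin.< j → z i ∷ z j ∷ [] ⊆ allFin N) × Σ (∀ i j → V (z i) (z j)) λ v →
        ∀ {i j k} → i Fin.< j → j Fin.< k →
          3 * (q * q ∸ 1) ≤ fL (z i) (z j) (z k) (v i j) + fR (z i) (z j) (z k) (v j k) + fT (z i) (z j) (z k) (v i k)) →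
      Σ (Fin M → Fin N) λ z → Monotone z × Σ (Family (restrict z H)) λ v → ∀ {i j k} → i Fin.< j → j Fin.< k →
        potential H F (suc r) (z i) (z j) (z k) ≤
        potential (restrict z H) (cons v (λ c i j → F c (z i) (z j))) r i j k + (3 * q + 7) * volume H (z i) (z j) (z k)
    found H F (z , sorted , v , high) = z , (λ i<j → pair-< (sorted i<j)) , v , λ {i} {j} {k} i<j j<k →
      potential-trade H F r z v i j k (high i<j j<k)

  Exhausted : ℕ → ℕ → ℕ → ℕ → ℕ → Set
  Exhausted r t m M N = (H : Hypergraph N) (F : Fin t → Family H) →
    Σ (Fin M → Fin N) λ z → Monotone z × Σ (Fin m → Family (restrict z H)) λ G → ∀ {i j k} → i Fin.< j → j Fin.< k →
      potential H F r (z i) (z j) (z k) ≤ potential (restrict z H) G 0 i j k + r * (3 * m + 7) * volume H (z i) (z j) (z k)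

  exhausted-suc : ∀ {r t m M K N} → t + r ≤ m → Exhausted r (suc t) m M K → Traded K t r N → Exhausted (suc r) t m M N
  exhausted-suc {r} {t} {m} {M} {K} {N} t+r≤m later now H F = compose (now H F)
    where
    chain : ∀ x y w S → x ≤ y + (3 * (t + r) + 7) * S → y ≤ w + r * (3 * m + 7) * S → x ≤ w + suc r * (3 * m + 7) * S
    chain x y w S p q = begin
      x                                                     ≤⟨ p ⟩
      y + (3 * (t + r) + 7) * S                             ≤⟨ +-mono-≤ q (*-monoˡ-≤ S (+-monoˡ-≤ 7 (*-monoʳ-≤ 3 t+r≤m))) ⟩
      w + r * (3 * m + 7) * S + (3 * m + 7) * S             ≡⟨ regroup w r (3 * m + 7) S ⟩
      w + suc r * (3 * m + 7) * S                           ∎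
      where
      open ≤-Reasoning
      regroup : ∀ w r c S → w + r * c * S + c * S ≡ w + suc r * c * S
      regroup = solve-∀
    compose :
      (Σ (Fin K → Fin N) λ z → Monotone z × Σ (Family (restrict z H)) λ v → ∀ {i j k} → i Fin.< j → j Fin.< k →
        potential H F (suc r) (z i) (z j) (z k) ≤
        potential (restrict z H) (cons v (λ c i j → F c (z i) (z j))) r i j k + (3 * (t + r) + 7) * volume H (z i) (z j) (z k)) →
      Σ (Fin M → Fin N) λ z → Monotone z × Σ (Fin m → Family (restrict z H)) λ G → ∀ {i j k} → i Fin.< j → j Fin.< k →
        potential H F (suc r) (z i) (z j) (z k) ≤ potential (restrict z H) G 0 i j k + suc r * (3 * m + 7) * volume H (z i) (z j) (z k)
    compose (z , mono , v , first) =
      let z′ , mono′ , G , rest = later (restrict z H) (cons v (λ c i j → F c (z i) (z j))) in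
      z ∘ z′ , mono ∘ mono′ , G , λ {i} {j} {k} i<j j<k →
        chain (potential H F (suc r) (z (z′ i)) (z (z′ j)) (z (z′ k)))
          (potential (restrict z H) (cons v (λ c i j → F c (z i) (z j))) r (z′ i) (z′ j) (z′ k))
          (potential (restrict (z ∘ z′) H) G 0 i j k) (volume H (z (z′ i)) (z (z′ j)) (z (z′ k)))
          (first (mono′ i<j) (mono′ j<k)) (rest i<j j<k)

  -- The sizes are found backwards: the later trades determine how many indices the present one must
  -- leave. Each trade costs at most `3 * m + 7` volumes, as `t + r ≤ m`.
  exhaust : ∀ r t m M → r + t ≡ m → ∃ (Exhausted r t m M)
  exhaust zero t .t M refl = M , λ H F → (λ i → i) , (λ i<j → i<j) , F , λ {i} {j} {k} _ _ → m≤m+n (potential H F 0 i j k) _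
  exhaust (suc r) t m M eq =
    let K , later = exhaust r (suc t) m M (trans (+-suc r t) eq)
        N , now = trade-all K t r
    in N , exhausted-suc (≤-trans (≤-reflexive (+-comm t r)) (≤-trans (n≤1+n (r + t)) (≤-reflexive eq))) later now

  -- The loss is quadratic in `m` and the main term cubic, so for large `m` the pattern is almost as
  -- dense as the triad.
  Sampled : ℕ → ℕ → ℕ → Set
  Sampled m M N = (H : Hypergraph N) →
    Σ (Fin M → Fin N) λ z → Monotone z × Σ (Fin m → Family (restrict z H)) λ F → ∀ {i j k} → i Fin.< j → j Fin.< k →
      m * (m * (m * edges H (z i) (z j) (z k))) ≤ volume H (z i) (z j) (z k) * (sampled (restrict z H) F i j k + m * (3 * m + 7))

  exhausted⇒sampled : ∀ {m M N} → Exhausted m 0 m M N → Sampled m M N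
  exhausted⇒sampled {m} process H =
    let z , mono , F , bound = process H (λ ()) in
    z , mono , F , λ {i} {j} {k} i<j j<k →
      chain (edges H (z i) (z j) (z k)) (volume H (z i) (z j) (z k)) (sampled (restrict z H) F i j k)
        (potential-start H (λ ()) m (z i) (z j) (z k)) (bound i<j j<k) (potential-end (restrict z H) F i j k)
    where
    chain : ∀ {p p′} E S x → p ≡ m * (m * (m * E)) → p ≤ p′ + m * (3 * m + 7) * S → p′ ≡ S * x →
      m * (m * (m * E)) ≤ S * (x + m * (3 * m + 7))
    chain E S x refl le refl = ≤-trans le (≤-reflexive (regroup S x (m * (3 * m + 7))))
      where
      regroup : ∀ S x c → S * x + c * S ≡ S * (x + c)
      regroup = solve-∀

  abstract
    sample : ∀ m M → ∃ (Sampled m M)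
    sample m M = proj₁ (exhaust m 0 m M (+-identityʳ m)) , exhausted⇒sampled (proj₂ (exhaust m 0 m M (+-identityʳ m)))

-- From the hypergraph to a palette and back to the four alternatives.

module Realisation where

  open import Defs
  open Sums
  open RamseyTheory
  open Palettes using (Palette; Configuration; total; squares; dense-palette)
  module X = PaletteSampling
  open import Data.Nat as ℕ using (ℕ; zero; suc; pred; >-nonZero; _≤_; z≤n; s≤s; _*_; _+_)
  open import Data.Nat.Properties using (≤-trans; ≤-reflexive; *-monoʳ-≤; *-monoˡ-≤; +-monoʳ-≤; +-monoˡ-≤; +-mono-≤; *-cancelˡ-≤; *-cancelʳ-≤; *-cancelˡ-<; +-cancelʳ-≤; m≤m+n; suc-pred; *-assoc; *-comm; *-identityʳ; +-identityʳ; +-assoc; *-distribˡ-+; module ≤-Reasoning)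
  open import Data.Nat.Tactic.RingSolver using (solve-∀)
  open import Data.Integer using (+_; -[1+_])
  import Data.Integer as ℤ
  import Data.Integer.Properties as ℤP
  open import Data.Fin using (Fin; zero; suc; toℕ; cast; fromℕ<; _<_)
  open import Data.Fin.Properties using (<-trans; toℕ-fromℕ<; _<?_)
  open import Data.Bool using (Bool; true; false)
  open import Data.List using (List; []; _∷_; allFin; cartesianProduct)
  open import Data.List.Properties using (length-tabulate)
  open import Data.List.Membership.Propositional.Properties using (∈-cartesianProduct⁺; ∈-allFin)
  open import Data.List.Relation.Binary.Sublist.Propositional using (_⊆_; ⊆-trans)
  open import Data.Vec using (Vec; []; _∷_; toList; lookup)
  open import Data.Product using (Σ; ∃; _×_; _,_; proj₁; proj₂)
  open import Data.Sum using (_⊎_; inj₁; inj₂)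
  open import Data.Rational as ℚ using (ℚ; 0ℚ; mkℚ; _/_; *<*)
  open import Data.Rational.Properties using (toℚᵘ-mono-≤; toℚᵘ-homo-+; toℚᵘ-homo-*; toℚᵘ-fromℚᵘ)
  open import Data.Rational.Unnormalised using (mkℚᵘ)
  import Data.Rational.Unnormalised as ℚᵘ
  import Data.Rational.Unnormalised.Properties as ℚᵘP
  open import Data.Empty using (⊥-elim)
  open import Function using (_∘_)
  open import Relation.Nullary using (yes; no)
  open import Relation.Binary.PropositionalEquality

  -- `suc d` is the denominator of `δ`, so `δ ≥ 1 / suc d`; this weaker density is what is
  -- multiplied out.
  density-in-ℕ : ∀ δ → 0ℚ ℚ.< δ → ∃ λ d → ∀ S E → ((+ 4) / 27 ℚ.+ δ) ℚ.* ℕ→ℚ S ℚ.≤ ℕ→ℚ E →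
    (4 * suc d + 27) * S ≤ 27 * suc d * E
  density-in-ℕ (mkℚ (+ zero) d _) (*<* (ℤ.+<+ ()))
  density-in-ℕ (mkℚ -[1+ p ] d _) (*<* ())
  density-in-ℕ δ@(mkℚ (+ suc p) d _) _ = d , bound
    where
    bound : ∀ S E → ((+ 4) / 27 ℚ.+ δ) ℚ.* ℕ→ℚ S ℚ.≤ ℕ→ℚ E → (4 * suc d + 27) * S ≤ 27 * suc d * E
    bound S E le = ≤-trans (*-monoˡ-≤ S (+-monoʳ-≤ (4 * suc d) (m≤m+n 27 (p * 27)))) (ℤ.drop‿+≤+ (subst₂ ℤ._≤_ lhs rhs cleared))
      where
      unnormalised : (mkℚᵘ (+ 4) 26 ℚᵘ.+ mkℚᵘ (+ suc p) d) ℚᵘ.* mkℚᵘ (+ S) 0 ℚᵘ.≤ mkℚᵘ (+ E) 0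
      unnormalised = ℚᵘP.≤-respʳ-≃ (toℚᵘ-fromℚᵘ (mkℚᵘ (+ E) 0))
        (ℚᵘP.≤-respˡ-≃ (ℚᵘP.≃-trans (toℚᵘ-homo-* ((+ 4) / 27 ℚ.+ δ) (ℕ→ℚ S))
            (ℚᵘP.*-cong (toℚᵘ-homo-+ ((+ 4) / 27) δ) (toℚᵘ-fromℚᵘ (mkℚᵘ (+ S) 0))))
          (toℚᵘ-mono-≤ le))
      cleared : (+ 4 ℤ.* + suc d ℤ.+ + suc p ℤ.* + 27) ℤ.* + S ℤ.* + 1 ℤ.≤ + E ℤ.* + (27 * suc d * 1)
      cleared = ℚᵘP.drop-*≤* unnormalised
      lhs : (+ 4 ℤ.* + suc d ℤ.+ + suc p ℤ.* + 27) ℤ.* + S ℤ.* + 1 ≡ + ((4 * suc d + (27 + p * 27)) * S)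
      lhs = trans (ℤP.*-identityʳ ((+ 4 ℤ.* + suc d ℤ.+ + suc p ℤ.* + 27) ℤ.* + S)) (sym (ℤP.pos-* (4 * suc d + (27 + p * 27)) S))
      rhs : + E ℤ.* + (27 * suc d * 1) ≡ + (27 * suc d * E)
      rhs = trans (sym (ℤP.pos-* E _)) (cong +_ (regroup E (suc d)))
        where
        regroup : ∀ e d → e * (27 * d * 1) ≡ 27 * d * e
        regroup = solve-∀

  squares-closed : ∀ m → 6 * squares m ≡ m * (m + 1) * (2 * m + 1)
  squares-closed zero = refl
  squares-closed (suc m) = begin
    6 * (suc m * suc m + squares m)                     ≡⟨ split (suc m * suc m) (squares m) ⟩
    6 * (suc m * suc m) + 6 * squares m                 ≡⟨ cong (λ t → 6 * (suc m * suc m) + t) (squares-closed m) ⟩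
    6 * (suc m * suc m) + m * (m + 1) * (2 * m + 1)     ≡⟨ close m ⟩
    suc m * (suc m + 1) * (2 * suc m + 1)               ∎
    where
    open ≡-Reasoning
    split : ∀ a b → 6 * (a + b) ≡ 6 * a + 6 * b
    split = solve-∀
    close : ∀ m → 6 * (suc m * suc m) + m * (m + 1) * (2 * m + 1) ≡ suc m * (suc m + 1) * (2 * suc m + 1)
    close = solve-∀

  -- With m = 11 / δ the sampling error m (3m + 7) and the lower-order terms of squares m stay below δ m³.
  dense-enough : ∀ d (let m = 11 * suc d) S E T → 0 ℕ.< S → (4 * suc d + 27) * S ≤ 27 * suc d * E →
    m * (m * (m * E)) ≤ S * (T + m * (3 * m + 7)) → 4 * squares m ℕ.< 9 * T
  dense-enough d (suc S′) E T _ density sampled = *-cancelˡ-< 3 _ _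
    (≤-trans (≤-trans (s≤s (≤-reflexive (scale m))) denser) (≤-reflexive (triple T)))
    where
    open ≤-Reasoning
    D m S : ℕ
    D = suc d
    m = 11 * D
    S = suc S′
    triple : ∀ T → 27 * T ≡ 3 * (9 * T)
    triple = solve-∀
    scale : ∀ m → 3 * (4 * squares m) ≡ 2 * (m * (m + 1) * (2 * m + 1))
    scale m = trans (rearrange (squares m)) (cong (2 *_) (squares-closed m))
      where
      rearrange : ∀ x → 3 * (4 * x) ≡ 2 * (6 * x)
      rearrange = solve-∀
    cancelled : m * m * m * (4 * D + 27) ≤ 27 * D * (T + m * (3 * m + 7))
    cancelled = *-cancelʳ-≤ _ _ S (begin
      m * m * m * (4 * D + 27) * S          ≡⟨ *-assoc (m * m * m) (4 * D + 27) S ⟩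
      m * m * m * ((4 * D + 27) * S)        ≤⟨ *-monoʳ-≤ (m * m * m) density ⟩
      m * m * m * (27 * D * E)              ≡⟨ rotate m D E ⟩
      27 * D * (m * (m * (m * E)))          ≤⟨ *-monoʳ-≤ (27 * D) sampled ⟩
      27 * D * (S * (T + m * (3 * m + 7)))  ≡⟨ swap (27 * D) S (T + m * (3 * m + 7)) ⟩
      27 * D * (T + m * (3 * m + 7)) * S    ∎)
      where
      rotate : ∀ m D E → m * m * m * (27 * D * E) ≡ 27 * D * (m * (m * (m * E)))
      rotate = solve-∀
      swap : ∀ a S b → a * (S * b) ≡ a * b * S
      swap = solve-∀
    -- With `m = 11 * D` the gain `27 * (m * m * m)` equals `D * (297 * (m * m))`, so a factor `D`
    -- cancels throughout.
    reduced : 4 * (m * m * m) + 297 * (m * m) ≤ 27 * T + 81 * (m * m) + 189 * m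
    reduced = *-cancelˡ-≤ D (begin
      D * (4 * (m * m * m) + 297 * (m * m)) ≡⟨ expand D m ⟩
      m * m * m * (4 * D) + m * m * (11 * D) * 27 ≡⟨ sym (*-distribˡ-+ (m * m * m) (4 * D) 27) ⟩
      m * m * m * (4 * D + 27)              ≤⟨ cancelled ⟩
      27 * D * (T + m * (3 * m + 7))        ≡⟨ collapse D m T ⟩
      D * (27 * T + 81 * (m * m) + 189 * m) ∎)
      where
      expand : ∀ D m → D * (4 * (m * m * m) + 297 * (m * m)) ≡ m * m * m * (4 * D) + m * m * (11 * D) * 27
      expand = solve-∀
      collapse : ∀ D m T → 27 * D * (T + m * (3 * m + 7)) ≡ D * (27 * T + 81 * (m * m) + 189 * m)
      collapse = solve-∀
    m≤mm : m ≤ m * m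
    m≤mm = ≤-trans (≤-reflexive (sym (*-identityʳ m))) (*-monoʳ-≤ m (s≤s z≤n))
    -- `210 = 27 * 11 - 81 - 6`, where 6 is the quadratic coefficient of `12 * squares m`. It has to
    -- cover the linear terms `192 * m` through `m ≤ m * m`, and 11 is the least factor for which it
    -- does.
    denser : 2 * (m * (m + 1) * (2 * m + 1)) ℕ.< 27 * T
    denser = +-cancelʳ-≤ (81 * (m * m) + 210 * (m * m)) _ _ (begin
      suc (2 * (m * (m + 1) * (2 * m + 1))) + (81 * (m * m) + 210 * (m * m))
        ≡⟨ gather m ⟩
      (4 * (m * m * m) + 297 * (m * m)) + (1 + 2 * m)
        ≤⟨ +-mono-≤ reduced (+-monoˡ-≤ (2 * m) (s≤s z≤n)) ⟩
      27 * T + 81 * (m * m) + 189 * m + (m + 2 * m)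
        ≡⟨ spread T m ⟩
      27 * T + 81 * (m * m) + 192 * m
        ≤⟨ +-monoʳ-≤ (27 * T + 81 * (m * m)) (≤-trans (*-monoʳ-≤ 192 m≤mm) (*-monoˡ-≤ (m * m) (m≤m+n 192 18))) ⟩
      27 * T + 81 * (m * m) + 210 * (m * m)
        ≡⟨ +-assoc (27 * T) _ _ ⟩
      27 * T + (81 * (m * m) + 210 * (m * m)) ∎)
      where
      gather : ∀ m → suc (2 * (m * (m + 1) * (2 * m + 1))) + (81 * (m * m) + 210 * (m * m)) ≡ (4 * (m * m * m) + 297 * (m * m)) + (1 + 2 * m)
      gather = solve-∀
      spread : ∀ T m → 27 * T + 81 * (m * m) + 189 * m + (m + 2 * m) ≡ 27 * T + 81 * (m * m) + 192 * m
      spread = solve-∀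

  ∑³-cast : ∀ {a b c a′ b′ c′} (p : a ≡ a′) (q : b ≡ b′) (r : c ≡ c′) (f : Fin a′ → Fin b′ → Fin c′ → ℕ) →
    ∑ a (λ x → ∑ b λ y → ∑ c λ w → f (cast p x) (cast q y) (cast r w)) ≡ ∑ a′ (λ x → ∑ b′ λ y → ∑ c′ (f x y))
  ∑³-cast {a} {b} {c} {a′} {b′} {c′} p q r f = trans
    (∑-cong a λ x → trans (∑-cong b λ y → ∑-cast r (f (cast p x) (cast q y))) (∑-cast q (λ y → ∑ c′ (f (cast p x) y))))
    (∑-cast p (λ x → ∑ b′ λ y → ∑ c′ (f x y)))

  -- Parts V_ij with i ≥ j may be empty and then receive a dummy vertex.
  module Bridge {N : ℕ} (H : PHyp N) where

    vertex : ∀ {i j} → i < j → Fin (suc (pred (size H i j))) → V H i j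
    vertex {i} {j} i<j = cast (suc-pred (size H i j) {{>-nonZero (nonempty H i j i<j)}})

    edge′ : ∀ i j k → Fin (suc (pred (size H i j))) → Fin (suc (pred (size H j k))) → Fin (suc (pred (size H i k))) → Bool
    edge′ i j k x y w with i <? j | j <? k
    ... | yes i<j | yes j<k = edge H i j k (vertex i<j x) (vertex j<k y) (vertex (<-trans i<j j<k) w)
    ... | yes _ | no _ = false
    ... | no _ | _ = false

    hypergraph : X.Hypergraph N
    hypergraph = record { s = λ i j → pred (size H i j) ; e = edge′ }

    edge′-edge : ∀ {i j k} (i<j : i < j) (j<k : j < k) (i<k : i < k) x y w →
      edge′ i j k x y w ≡ edge H i j k (vertex i<j x) (vertex j<k y) (vertex i<k w)
    edge′-edge {i} {j} {k} i<j j<k i<k x y w with i <? j | j <? k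
    -- `vertex` gives the same result for any two proofs of the order, since `cast` ignores its
    -- equation.
    ... | yes _ | yes _ = refl
    ... | yes _ | no ≮ = ⊥-elim (≮ j<k)
    ... | no ≮ | _ = ⊥-elim (≮ i<j)

    size≡ : ∀ {i j} → i < j → suc (pred (size H i j)) ≡ size H i j
    size≡ {i} {j} i<j = suc-pred (size H i j) {{>-nonZero (nonempty H i j i<j)}}

    edges≡ : ∀ {i j k} → i < j → j < k → X.edges hypergraph i j k ≡ triadEdges H i j k
    edges≡ {i} {j} {k} i<j j<k = trans
      (∑-cong (suc (pred (size H i j))) λ x → ∑-cong (suc (pred (size H j k))) λ y → ∑-cong (suc (pred (size H i k))) λ w →
        cong χ (edge′-edge i<j j<k (<-trans i<j j<k) x y w))
      (∑³-cast (size≡ i<j) (size≡ j<k) (size≡ (<-trans i<j j<k)) (λ x y w → χ (edge H i j k x y w)))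

    volume≡ : ∀ {i j k} → i < j → j < k → X.Hypergraph.volume hypergraph i j k ≡ triadSize H i j k
    volume≡ {i} {j} {k} i<j j<k = trans
      (cong₂ _*_ (size≡ i<j) (trans (cong₂ _*_ (size≡ j<k) (size≡ (<-trans i<j j<k))) (*-comm (size H j k) (size H i k))))
      (sym (*-assoc (size H i j) (size H i k) (size H j k)))

  module Realised {N : ℕ} {H : PHyp N} {L m : ℕ} (S : SubHyp H L) (P : Palette m) (fam : Fin m → Fam S)
    (realise : ∀ {a b g} → P a b g ≡ true → ∀ {i j k} (i<j : i < j) (j<k : j < k) (i<k : i < k) →
      E0 S i j k (fam a i j i<j) (fam b j k j<k) (fam g i k i<k)) where

    position : ∀ k → k ℕ.< L → Σ (Fin L) λ p → toℕ p ≡ k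
    position k k<L = fromℕ< k<L , toℕ-fromℕ< k<L

    -- Each family of vertices is a single colour throughout; in (3) even the vertices with five
    -- indices depend only on the part in which they lie.
    conditions : ∀ n → L ≡ 4 * suc n → Configuration P → Cond1 S ⊎ Cond2 S ⊎ Cond3 S ⊎ Cond4 S (suc n)
    conditions n eq (inj₁ (a , u , g , b , v , h , aug , bvg , uvh)) = inj₁
      (fam b , fam v , fam g , fam u , fam a , fam h , λ i j k ij jk →
        realise bvg ij jk _ , realise uvh ij jk _ , realise aug ij jk _)
    conditions n eq (inj₂ (inj₁ (u , a , g , v , b , h , uag , vbg , uvh))) = inj₂ (inj₁
      (fam u , fam a , fam g , fam v , fam b , fam h , λ i j k ij jk →
        realise uag ij jk _ , realise uvh ij jk _ , realise vbg ij jk _))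
    conditions n eq (inj₂ (inj₂ (inj₁ (a , u , g , v , b , h , aug , vbg , uvh)))) = inj₂ (inj₂ (inj₁
      (fam a , fam u , fam a , fam b , fam g , fam h ,
       (λ _ j k _ _ _ jk _ _ → fam u j k jk) , (λ _ _ k l _ _ _ kl _ → fam v k l kl) ,
       λ _ _ _ _ _ ij jk kl lo → realise aug ij jk _ , realise aug ij jk _ , realise uvh jk kl _ , realise vbg kl lo _)))
    conditions n refl (inj₂ (inj₂ (inj₂ (u , q , g , p , w , α , y , x , β , h , uqg , pwg , αyw , xβu , αβh)))) =
      inj₂ (inj₂ (inj₂ (fam p , fam q , fam g , fam x , fam β , fam u , fam α , fam y , fam w ,
        (λ i j k ij jk → realise uqg ij jk _ , realise pwg ij jk _ , realise xβu ij jk _ , realise αyw ij jk _) ,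
        -- `n + (suc n + 0)` is the predecessor of `2 * suc n` in normal form: indices of `I` count
        -- from one, positions from zero.
        place (position (n + (suc n + 0)) (below (2 + 2 * n) (fits₁ n))) (position (2 * suc n) (below (1 + 2 * n) (fits₂ n)))
              (position (2 * suc n + 1) (below (2 * n) (fits₃ n))) (position (3 * suc n) (below n (fits₄ n)))
              (position n (below (3 + 3 * n) (fits₅ n))))))
      where
      below : ∀ {k} c → suc k + c ≡ 4 * suc n → k ℕ.< 4 * suc n
      below {k} c e = ≤-trans (m≤m+n (suc k) c) (≤-reflexive e)
      fits₁ : ∀ n → suc (n + (suc n + 0)) + (2 + 2 * n) ≡ 4 * suc n
      fits₁ = solve-∀
      fits₂ : ∀ n → suc (2 * suc n) + (1 + 2 * n) ≡ 4 * suc n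
      fits₂ = solve-∀
      fits₃ : ∀ n → suc (2 * suc n + 1) + 2 * n ≡ 4 * suc n
      fits₃ = solve-∀
      fits₄ : ∀ n → suc (3 * suc n) + n ≡ 4 * suc n
      fits₄ = solve-∀
      fits₅ : ∀ n → suc n + (3 + 3 * n) ≡ 4 * suc n
      fits₅ = solve-∀
      ordered : ∀ {i j : Fin (4 * suc n)} {k l} c → toℕ i ≡ k → toℕ j ≡ l → suc k + c ≡ l → i < j
      ordered {k = k} c refl refl e = ≤-trans (m≤m+n (suc k) c) (≤-reflexive e)
      gap₁ : ∀ n → suc (2 * suc n) + n ≡ 3 * suc n
      gap₁ = solve-∀
      gap₂ : ∀ n → suc n + suc n ≡ 2 * suc n
      gap₂ = solve-∀
      gap₃ : ∀ n → suc (2 * suc n) + 0 ≡ 2 * suc n + 1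
      gap₃ = solve-∀
      place : (Σ (Fin (4 * suc n)) λ p → toℕ p ≡ n + (suc n + 0)) → (Σ (Fin (4 * suc n)) λ q → toℕ q ≡ 2 * suc n) →
        (Σ (Fin (4 * suc n)) λ r → toℕ r ≡ 2 * suc n + 1) → (Σ (Fin (4 * suc n)) λ u → toℕ u ≡ 3 * suc n) →
        (Σ (Fin (4 * suc n)) λ v → toℕ v ≡ n) → _
      place (i , i≡) (j , j≡) (k , k≡) (l , l≡) (o , o≡) = i , j , k , l , o , cong suc i≡ , j≡ , k≡ , l≡ , cong suc o≡ ,
        <-trans {i = i} i<j j<l , <-trans {i = o} o<j j<k , fam α i j i<j , fam β j k j<k ,
        (fam y j l j<l , realise αyw i<j j<l _) , (fam x o j o<j , realise xβu o<j j<k _) ,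
        (fam h i k (<-trans {i = i} i<j j<k) , realise αβh i<j j<k _)
        where
        i<j : i < j
        i<j = ordered 0 i≡ j≡ (+-identityʳ (2 * suc n))
        j<k : j < k
        j<k = ordered 0 j≡ k≡ (gap₃ n)
        j<l : j < l
        j<l = ordered n j≡ l≡ (gap₁ n)
        o<j : o < j
        o<j = ordered (suc n) o≡ j≡ (gap₂ n)

  colour-triples : ∀ m → List (Fin m × Fin m × Fin m)
  colour-triples m = cartesianProduct (allFin m) (cartesianProduct (allFin m) (allFin m))

  module Sampling (d n M N : ℕ) (ramsey-triples : RamseyFamily (colour-triples (11 * suc d)) 3 (4 * suc n) M)
    (sample : X.Sampled (11 * suc d) M N) (H : PHyp N)
    (dense : ∀ {i j k} → i < j → j < k → (4 * suc d + 27) * triadSize H i j k ≤ 27 * suc d * triadEdges H i j k) where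

    open Bridge H

    m L : ℕ
    m = 11 * suc d
    L = 4 * suc n

    z : Fin M → Fin N
    z = proj₁ (sample hypergraph)

    z-mono : X.Monotone z
    z-mono = proj₁ (proj₂ (sample hypergraph))

    F : Fin m → X.Family (X.restrict z hypergraph)
    F = proj₁ (proj₂ (proj₂ (sample hypergraph)))

    sampled-edge : Fin m × Fin m × Fin m → Vec (Fin M) 3 → Bool
    sampled-edge (a , b , c) (i ∷ j ∷ k ∷ []) = edge′ (z i) (z j) (z k) (F a i j) (F b j k) (F c i k)

    homogeneous = ramsey-triples sampled-edge (allFin M) (≤-reflexive (sym (length-tabulate (λ i → i))))

    ys : List (Fin M)
    ys = proj₁ homogeneous

    ws : Vec (Fin M) L
    ws = proj₁ (initial L ys (proj₁ (proj₂ (proj₂ homogeneous))))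

    ws⊆ys : toList ws ⊆ ys
    ws⊆ys = proj₂ (initial L ys (proj₁ (proj₂ (proj₂ homogeneous))))

    w : Fin L → Fin M
    w = lookup ws

    w-mono : ∀ {i j} → i < j → w i < w j
    w-mono i<j = pair-< (⊆-trans (pair-⊆ ws i<j) (⊆-trans ws⊆ys (proj₁ (proj₂ homogeneous))))

    colour : ∀ a b c → Homogeneous (sampled-edge (a , b , c)) ys
    colour a b c = proj₂ (proj₂ (proj₂ homogeneous)) (∈-cartesianProduct⁺ (∈-allFin a) (∈-cartesianProduct⁺ (∈-allFin b) (∈-allFin c)))

    P : Palette m
    P a b c = proj₁ (colour a b c)

    P-edge : ∀ a b c {i j k} → i < j → j < k → sampled-edge (a , b , c) (w i ∷ w j ∷ w k ∷ []) ≡ P a b c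
    P-edge a b c i<j j<k = proj₂ (colour a b c) _ (⊆-trans (triple-⊆ ws i<j j<k) ws⊆ys)

    S : SubHyp H L
    S = record
      { ι = z ∘ w
      ; mono = λ _ _ i<j → z-mono (w-mono i<j)
      ; E0 = λ i j k l r t → edge H (z (w i)) (z (w j)) (z (w k)) l r t ≡ true
      ; E0⊆ = λ _ _ _ _ _ _ _ _ isEdge → isEdge
      }

    fam : Fin m → Fam S
    fam c i j i<j = vertex (z-mono (w-mono i<j)) (F c (w i) (w j))

    realise : ∀ {a b g} → P a b g ≡ true → ∀ {i j k} (i<j : i < j) (j<k : j < k) (i<k : i < k) →
      edge H (z (w i)) (z (w j)) (z (w k)) (fam a i j i<j) (fam b j k j<k) (fam g i k i<k) ≡ true
    realise {a} {b} {g} Pabg i<j j<k i<k = trans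
      (sym (edge′-edge (z-mono (w-mono i<j)) (z-mono (w-mono j<k)) (z-mono (w-mono i<k)) _ _ _))
      (trans (P-edge a b g i<j j<k) Pabg)

    private
      spaced : ∀ {k} c → suc k + c ≡ L → k ℕ.< L
      spaced {k} c e = ≤-trans (m≤m+n (suc k) c) (≤-reflexive e)
      place₁ : ∀ n → 1 + (3 + 4 * n) ≡ 4 * suc n
      place₁ = solve-∀
      place₂ : ∀ n → 2 + (2 + 4 * n) ≡ 4 * suc n
      place₂ = solve-∀
      place₃ : ∀ n → 3 + (1 + 4 * n) ≡ 4 * suc n
      place₃ = solve-∀
      i₁ i₂ i₃ : Fin L
      i₁ = fromℕ< (spaced {0} (3 + 4 * n) (place₁ n))
      i₂ = fromℕ< (spaced {1} (2 + 4 * n) (place₂ n))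
      i₃ = fromℕ< (spaced {2} (1 + 4 * n) (place₃ n))
      i₁<i₂ : i₁ < i₂
      i₁<i₂ = subst₂ ℕ._<_ (sym (toℕ-fromℕ< (spaced {0} (3 + 4 * n) (place₁ n)))) (sym (toℕ-fromℕ< (spaced {1} (2 + 4 * n) (place₂ n)))) (s≤s z≤n)
      i₂<i₃ : i₂ < i₃
      i₂<i₃ = subst₂ ℕ._<_ (sym (toℕ-fromℕ< (spaced {1} (2 + 4 * n) (place₂ n)))) (sym (toℕ-fromℕ< (spaced {2} (1 + 4 * n) (place₃ n)))) (s≤s (s≤s z≤n))

    -- The palette is the same in all triads, so its density can be read off from one of them, here
    -- on the first three indices, which exist because `L ≥ 4`.
    P-dense : 4 * squares m ℕ.< 9 * total P
    P-dense = dense-enough d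
      (X.Hypergraph.volume hypergraph (z (w i₁)) (z (w i₂)) (z (w i₃))) (X.edges hypergraph (z (w i₁)) (z (w i₂)) (z (w i₃))) (total P) (s≤s z≤n)
      (subst₂ (λ s e → (4 * suc d + 27) * s ≤ 27 * suc d * e) (sym (volume≡ lo hi)) (sym (edges≡ lo hi)) (dense lo hi))
      (subst (λ t → m * (m * (m * X.edges hypergraph (z (w i₁)) (z (w i₂)) (z (w i₃)))) ≤
                     X.Hypergraph.volume hypergraph (z (w i₁)) (z (w i₂)) (z (w i₃)) * (t + m * (3 * m + 7)))
        (∑-cong m λ a → ∑-cong m λ b → ∑-cong m λ c → cong χ (P-edge a b c i₁<i₂ i₂<i₃))
        (proj₂ (proj₂ (proj₂ (sample hypergraph))) (w-mono i₁<i₂) (w-mono i₂<i₃)))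
      where
      lo = z-mono (w-mono i₁<i₂)
      hi = z-mono (w-mono i₂<i₃)

    result : Σ (SubHyp H L) λ H0 → Cond1 H0 ⊎ Cond2 H0 ⊎ Cond3 H0 ⊎ Cond4 H0 (suc n)
    result = S , Realised.conditions S P fam (λ {a} {b} {g} → realise {a} {b} {g}) n refl (dense-palette m P P-dense)

-- The choice of `N` from `δ` and `n`.

open import Defs
open import Data.Nat using (ℕ; zero; suc; _*_)
open import Data.Integer using (+_)
open import Data.Product using (Σ; _×_; _,_)
open import Data.Sum using (_⊎_; inj₁)
open import Data.Rational using (ℚ; 0ℚ; _<_; _+_; _/_)

theorem28 : (δ : ℚ) → 0ℚ < δ → (n : ℕ) → Σ ℕ λ N →
    (H : PHyp N) → DensityAtLeast H ((+ 4) / 27 + δ) →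
    Σ (SubHyp H (4 * n)) λ H0 →
    Cond1 H0 ⊎ Cond2 H0 ⊎ Cond3 H0 ⊎ Cond4 H0 n
-- With no indices, the requirements of the first alternative are vacuous.
theorem28 δ 0<δ zero = 0 , λ H _ →
  record { ι = λ () ; mono = λ () ; E0 = λ () ; E0⊆ = λ () } ,
  inj₁ ((λ ()) , (λ ()) , (λ ()) , (λ ()) , (λ ()) , (λ ()) , λ ())
theorem28 δ 0<δ (suc n) =
  let d , dense = Realisation.density-in-ℕ δ 0<δ
      m = 11 * suc d
      -- `M` is fixed before `N`: sampling must leave enough indices for the final application of
      -- Ramsey's theorem.
      M , ramsey-triples = RamseyTheory.ramsey-family (Realisation.colour-triples m) 3 (4 * suc n)
      N , sample = PaletteSampling.sample m M
  in N , λ H density → Realisation.Sampling.result d n M N ramsey-triples sample H (λ {i} {j} {k} i<j j<k →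
       dense (triadSize H i j k) (triadEdges H i j k) (density i j k i<j j<k))
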